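{- Let $a,b,q$ be complex numbers with $|q|<1$ and $a,b\neq -q^{ -N}$ for any positive integer $N$. Then $$(-bq;q)_{\infty}\sum_{n=0}^{\infty}\frac{a^nq^{n(n+1)/2}}{(q;q)_n(-bq;q)_n}=(-aq;q)_{\infty}\sum_{n=0}^{\infty}\frac{b^nq^{n(n+1)/2}}{(q;q)_n(-aq;q)_n}.$$
   Context: Notation: $(x;q)_0=1$, $(x;q)_n=\prod_{j=0}^{n-1}(1-xq^{j})$ for $n\ge 1$, and $(x;q)_\infty=\prod_{j=0}^{\infty}(1-xq^{j})$. The condition $a,b\ne -q^{ -N}$ means $1+aq^N\neq 0$ and $1+bq^N\ne 0$. -}

module Defs where

open import Level using (0ℓ)
open import Algebra.Bundles.Raw using (RawRing)
import Algebra.Definitions.RawSemiring as RawSemiringDefinitions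
open import Data.Bool.Base using (if_then_else_)
open import Data.Empty using (⊥; ⊥-elim)
open import Data.Integer.Base as ℤ using (+_; -[1+_])
import Data.Integer.Properties as ℤₚ
open import Data.Nat.Base as ℕ using (ℕ; zero; suc)
import Data.Nat.DivMod as ℕ
import Data.Nat.Properties as ℕₚ
open import Data.Product using (Σ-syntax; ∃-syntax; _×_; _,_; proj₁; proj₂)
open import Data.Rational.Base as ℚ using (ℚ; 0ℚ; 1ℚ; ½)
import Data.Rational.Properties as ℚₚ
open import Data.Rational.Solver using (module +-*-Solver)
import Data.Rational.Unnormalised.Base as ℚᵘ
import Data.Rational.Unnormalised.Properties as ℚᵘₚ
open import Data.Sum.Base using (_⊎_; inj₁; inj₂)
open import Function.Base using (_∘_)
open import Relation.Nullary using (yes; no)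
open import Relation.Nullary.Decidable using (Dec; does)
open import Relation.Binary.PropositionalEquality

module Rational where
  open import Data.Rational.Base
  open ℚₚ

  0<½ : 0ℚ < ½
  0<½ = positive⁻¹ ½

  *-pos : ∀ {p q} → 0ℚ < p → 0ℚ < q → 0ℚ < p * q
  *-pos {p} {q} 0<p 0<q = subst (_< p * q) (*-zeroʳ p) (*-monoʳ-<-pos p {{positive 0<p}} 0<q)

  *-nn : ∀ {p q} → 0ℚ ≤ p → 0ℚ ≤ q → 0ℚ ≤ p * q
  *-nn {p} {q} 0≤p 0≤q =
    subst (_≤ p * q) (*-zeroʳ p) (*-monoˡ-≤-nonNeg p {{nonNegative 0≤p}} 0≤q)

  +-pos : ∀ {p q} → 0ℚ < p → 0ℚ < q → 0ℚ < p + q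
  +-pos 0<p 0<q = +-mono-< 0<p 0<q

  half-pos : ∀ {ε} → 0ℚ < ε → 0ℚ < ε * ½
  half-pos 0<ε = *-pos 0<ε 0<½

  halves : ∀ ε → ε * ½ + ε * ½ ≡ ε
  halves ε = trans (sym (*-distribˡ-+ ε ½ ½)) (*-identityʳ ε)

  *-mono-≤ : ∀ {p q r s} → 0ℚ ≤ p → 0ℚ ≤ s → p ≤ q → r ≤ s → p * r ≤ q * s
  *-mono-≤ {p} {q} {r} {s} 0≤p 0≤s p≤q r≤s =
    ≤-trans (*-monoˡ-≤-nonNeg p {{nonNegative 0≤p}} r≤s)
            (*-monoʳ-≤-nonNeg s {{nonNegative 0≤s}} p≤q)

  diff⇒< : ∀ {p q r} → p - q < r → p < q + r
  diff⇒< {p} {q} {r} h = subst (_< q + r) eq (+-monoʳ-< q h)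
    where
    open +-*-Solver
    eq : q + (p - q) ≡ p
    eq = solve 2 (λ p q → q :+ (p :- q) := p) refl p q

  <⇒diff : ∀ {p q r} → p < q + r → p - q < r
  <⇒diff {p} {q} {r} h = subst (p - q <_) eq (+-monoˡ-< (- q) h)
    where
    open +-*-Solver
    eq : q + r - q ≡ r
    eq = solve 2 (λ q r → q :+ r :- q := r) refl q r

  abs-sym : ∀ p q → ∣ p - q ∣ ≡ ∣ q - p ∣
  abs-sym p q = trans (sym (∣-p∣≡∣p∣ (p - q))) (cong ∣_∣ eq)
    where
    open +-*-Solver
    eq : - (p - q) ≡ q - p
    eq = solve 2 (λ p q → :- (p :- q) := q :- p) refl p q

  p≤∣p∣ : ∀ p → p ≤ ∣ p ∣
  p≤∣p∣ p with ∣p∣≡p∨∣p∣≡-p p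
  ... | inj₁ eq = ≤-reflexive (sym eq)
  ... | inj₂ eq with ≤-total 0ℚ p
  ...   | inj₁ 0≤p = ≤-reflexive (sym (0≤p⇒∣p∣≡p 0≤p))
  ...   | inj₂ p≤0 = ≤-trans p≤0 (0≤∣p∣ p)

  abs-< : ∀ {p r} → p < r → - p < r → ∣ p ∣ < r
  abs-< {p} {r} h h′ with ∣p∣≡p∨∣p∣≡-p p
  ... | inj₁ eq = subst (_< r) (sym eq) h
  ... | inj₂ eq = subst (_< r) (sym eq) h′

  abs-diff-< : ∀ p q {r} → p - q < r → q - p < r → ∣ p - q ∣ < r
  abs-diff-< p q {r} h h′ = abs-< h (subst (_< r) eq h′)
    where
    open +-*-Solver
    eq : q - p ≡ - (p - q)
    eq = solve 2 (λ p q → q :- p := :- (p :- q)) refl p q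

  sum-bound : ∀ {ε} p q → ∣ p ∣ < ε * ½ → ∣ q ∣ < ε * ½ → ∣ p + q ∣ < ε
  sum-bound {ε} p q h h′ =
    ≤-<-trans (∣p+q∣≤∣p∣+∣q∣ p q) (subst (∣ p ∣ + ∣ q ∣ <_) (halves ε) (+-mono-< h h′))

  inv : ℚ → ℚ
  inv p with p ≟ 0ℚ
  ... | yes _   = 0ℚ
  ... | no  p≢0 = (1/ p) {{≢-nonZero p≢0}}

  inv-inverseʳ : ∀ {p} → 0ℚ < p → p * inv p ≡ 1ℚ
  inv-inverseʳ {p} 0<p with p ≟ 0ℚ
  ... | yes p≡0 = ⊥-elim (<-irrefl (sym p≡0) 0<p)
  ... | no  p≢0 = *-inverseʳ p {{≢-nonZero p≢0}}

  inv-pos : ∀ {p} → 0ℚ < p → 0ℚ < inv p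
  inv-pos {p} 0<p with inv p ≤? 0ℚ
  ... | no  h = ≰⇒> h
  ... | yes h = ⊥-elim (<-irrefl refl (<-≤-trans (positive⁻¹ 1ℚ)
                  (subst₂ _≤_ (inv-inverseʳ 0<p) (*-zeroʳ p)
                    (*-monoˡ-≤-nonNeg p {{nonNegative (<⇒≤ 0<p)}} h))))

  inv-bound : ∀ {δ p} → 0ℚ < δ → δ < p → δ * inv p ≤ 1ℚ
  inv-bound {δ} {p} 0<δ δ<p = subst (δ * inv p ≤_) (inv-inverseʳ 0<p)
    (*-monoʳ-≤-nonNeg (inv p) {{nonNegative (<⇒≤ (inv-pos 0<p))}} (<⇒≤ δ<p))
    where
    0<p : 0ℚ < p
    0<p = <-trans 0<δ δ<p

  inv-diff : ∀ {δ ε} p q → 0ℚ < δ → δ < p → δ < q →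
             ∣ p - q ∣ < ε * (δ * δ) → ∣ inv p - inv q ∣ < ε
  inv-diff {δ} {ε} p q 0<δ δ<p δ<q h =
    subst (_< ε) (sym eq₂) (<-≤-trans step₁ step₂)
    where
    0<p : 0ℚ < p
    0<p = <-trans 0<δ δ<p
    0<q : 0ℚ < q
    0<q = <-trans 0<δ δ<q
    u v : ℚ
    u = inv p
    v = inv q
    0<uv : 0ℚ < u * v
    0<uv = *-pos (inv-pos 0<p) (inv-pos 0<q)
    eq₁ : u - v ≡ (u * v) * (q - p)
    eq₁ = begin
      u - v                           ≡⟨ cong₂ _-_ (*-identityʳ u) (*-identityʳ v) ⟨
      u * 1ℚ - v * 1ℚ                 ≡⟨ cong₂ (λ s t → u * s - v * t) (inv-inverseʳ 0<q) (inv-inverseʳ 0<p) ⟨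
      u * (q * v) - v * (p * u)       ≡⟨ solve 4 (λ u v p q → u :* (q :* v) :- v :* (p :* u) := (u :* v) :* (q :- p)) refl u v p q ⟩
      (u * v) * (q - p)               ∎
      where
      open ≡-Reasoning
      open +-*-Solver
    eq₂ : ∣ u - v ∣ ≡ (u * v) * ∣ p - q ∣
    eq₂ = trans (cong ∣_∣ eq₁) (trans (∣p*q∣≡∣p∣*∣q∣ (u * v) (q - p))
            (cong₂ _*_ (0≤p⇒∣p∣≡p (<⇒≤ 0<uv)) (abs-sym q p)))
    step₁ : (u * v) * ∣ p - q ∣ < (u * v) * (ε * (δ * δ))
    step₁ = *-monoʳ-<-pos (u * v) {{positive 0<uv}} h
    0≤ε : 0ℚ ≤ ε
    0≤ε with ε ≤? 0ℚ
    ... | no  ε≰0 = <⇒≤ (≰⇒> ε≰0)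
    ... | yes ε≤0 = ⊥-elim (<-irrefl refl (<-≤-trans (≤-<-trans (0≤∣p∣ (p - q)) h)
                      (subst (ε * (δ * δ) ≤_) (*-zeroˡ (δ * δ))
                        (*-monoʳ-≤-nonNeg (δ * δ) {{nonNegative (<⇒≤ (*-pos 0<δ 0<δ))}} ε≤0))))
    step₂ : (u * v) * (ε * (δ * δ)) ≤ ε
    step₂ = subst₂ _≤_
      (solve 4 (λ u v ε δ → ε :* ((δ :* u) :* (δ :* v)) := (u :* v) :* (ε :* (δ :* δ))) refl u v ε δ)
      (*-identityʳ ε)
      (*-monoˡ-≤-nonNeg ε {{nonNegative 0≤ε}}
        (*-mono-≤ {δ * u} {1ℚ} {δ * v} {1ℚ}
          (<⇒≤ (*-pos 0<δ (inv-pos 0<p))) (<⇒≤ (positive⁻¹ 1ℚ))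
          (inv-bound 0<δ δ<p) (inv-bound 0<δ δ<q)))
      where open +-*-Solver

  -- The grid of mesh 1/(n+1).

  opaque
    grid : ℕ → ℕ → ℚ
    grid n k = + k / suc n

  opaque
    unfolding grid

    grid-zero : ∀ n → grid n 0 ≡ 0ℚ
    grid-zero n = toℚᵘ-injective (ℚᵘₚ.≃-trans (toℚᵘ-homo-/ 0) (ℚᵘ.*≡* refl))
      where
      toℚᵘ-homo-/ : ∀ k → toℚᵘ (grid n k) ℚᵘ.≃ ℚᵘ.mkℚᵘ (+ k) n
      toℚᵘ-homo-/ k = toℚᵘ-fromℚᵘ (ℚᵘ.mkℚᵘ (+ k) n)

    grid-suc : ∀ n k → grid n (suc k) ≡ grid n k + grid n 1
    grid-suc n k = sym (toℚᵘ-injective (begin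
      toℚᵘ (grid n k + grid n 1)                   ≈⟨ toℚᵘ-homo-+ (grid n k) (grid n 1) ⟩
      toℚᵘ (grid n k) ℚᵘ.+ toℚᵘ (grid n 1)          ≈⟨ ℚᵘₚ.+-cong (toℚᵘ-fromℚᵘ (ℚᵘ.mkℚᵘ (+ k) n)) (toℚᵘ-fromℚᵘ (ℚᵘ.mkℚᵘ (+ 1) n)) ⟩
      ℚᵘ.mkℚᵘ (+ k) n ℚᵘ.+ ℚᵘ.mkℚᵘ (+ 1) n          ≈⟨ ℚᵘ.*≡* eq ⟩
      ℚᵘ.mkℚᵘ (+ suc k) n                          ≈⟨ toℚᵘ-fromℚᵘ (ℚᵘ.mkℚᵘ (+ suc k) n) ⟨
      toℚᵘ (grid n (suc k))                        ∎))
      where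
      open ℚᵘₚ.≃-Reasoning
      d : ℤ.ℤ
      d = + suc n
      eq : (+ k ℤ.* d ℤ.+ + 1 ℤ.* d) ℤ.* d ≡ + suc k ℤ.* (+ (suc n ℕ.* suc n))
      eq = trans (cong (ℤ._* d) (sym (ℤₚ.*-distribʳ-+ d (+ k) (+ 1))))
          (trans (ℤₚ.*-assoc (+ k ℤ.+ + 1) d d)
            (cong₂ ℤ._*_ (cong +_ (ℕₚ.+-comm k 1)) (sym (ℤₚ.pos-* (suc n) (suc n)))))

    grid-step-pos : ∀ n → 0ℚ < grid n 1
    grid-step-pos n = positive⁻¹ (grid n 1) {{normalize-pos 1 (suc n)}}

    grid-nonneg : ∀ n k → 0ℚ ≤ grid n k
    grid-nonneg n k = nonNegative⁻¹ (grid n k) {{normalize-nonNeg k (suc n)}}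

    archimedean : ∀ {ε} → 0ℚ < ε → ∃[ N ] ∀ n → N ℕ.≤ n → grid n 1 < ε
    archimedean {ε@(mkℚ (+ suc k) d-1 _)} 0<ε = suc d-1 , λ n N≤n → toℚᵘ-cancel-<
      (ℚᵘₚ.<-respˡ-≃ (ℚᵘₚ.≃-sym (toℚᵘ-fromℚᵘ (ℚᵘ.mkℚᵘ (+ 1) n)))
        (ℚᵘ.*<* (subst₂ ℤ._<_ (ℤₚ.pos-* 1 (suc d-1)) (ℤₚ.pos-* (suc k) (suc n))
          (ℤ.+<+ (subst (ℕ._< suc k ℕ.* suc n) (sym (ℕₚ.*-identityˡ (suc d-1)))
            (ℕₚ.<-≤-trans (ℕ.s≤s N≤n) (ℕₚ.m≤m+n (suc n) (k ℕ.* suc n))))))))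
    archimedean {mkℚ (+ zero) _ _} (*<* (ℤ.+<+ ()))
    archimedean {mkℚ -[1+ _ ] _ _} (*<* ())

    grid-multiple : ∀ n m → grid n (m ℕ.* suc n) ≡ + m / 1
    grid-multiple n m = toℚᵘ-injective (begin
      toℚᵘ (grid n (m ℕ.* suc n))        ≈⟨ toℚᵘ-fromℚᵘ (ℚᵘ.mkℚᵘ (+ (m ℕ.* suc n)) n) ⟩
      ℚᵘ.mkℚᵘ (+ (m ℕ.* suc n)) n        ≈⟨ ℚᵘ.*≡* (trans (ℤₚ.*-identityʳ _) (ℤₚ.pos-* m (suc n))) ⟩
      ℚᵘ.mkℚᵘ (+ m) 0                    ≈⟨ toℚᵘ-fromℚᵘ (ℚᵘ.mkℚᵘ (+ m) 0) ⟨
      toℚᵘ (+ m / 1)                     ∎)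
      where open ℚᵘₚ.≃-Reasoning

  -- Greatest k ≤ B with (k/(n+1))² ≤ p, or 0 if there is none.

  floorSqrt : ℕ → ℚ → ℕ → ℕ
  floorSqrt n p zero    = 0
  floorSqrt n p (suc B) =
    if does (grid n (suc B) * grid n (suc B) ≤? p) then suc B else floorSqrt n p B

  sqrtBound : ℕ → ℚ → ℕ
  sqrtBound n p = ℤ.∣ ↥ p ∣ ℕ.* suc n

  -- Approximates √ max(p, 0) from below with error less than 1/(n+1).

  sqrtApprox : ℕ → ℚ → ℚ
  sqrtApprox n p = grid n (floorSqrt n p (sqrtBound n p))

  sqrtApprox-nonneg : ∀ n p → 0ℚ ≤ sqrtApprox n p
  sqrtApprox-nonneg n p = grid-nonneg n (floorSqrt n p (sqrtBound n p))

  sqrtApprox-lower : ∀ n p → sqrtApprox n p ≡ 0ℚ ⊎ sqrtApprox n p * sqrtApprox n p ≤ p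
  sqrtApprox-lower n p = go (sqrtBound n p)
    where
    P : ℕ → Set
    P k = grid n k ≡ 0ℚ ⊎ grid n k * grid n k ≤ p
    go : ∀ B → P (floorSqrt n p B)
    go zero    = inj₁ (grid-zero n)
    go (suc B) = step (grid n (suc B) * grid n (suc B) ≤? p)
      where
      step : (d : Dec (grid n (suc B) * grid n (suc B) ≤ p)) →
             P (if does d then suc B else floorSqrt n p B)
      step (yes h) = inj₂ h
      step (no  _) = go B

  p≤m : ∀ p → p ≤ + ℤ.∣ ↥ p ∣ / 1
  p≤m p@(mkℚ i d-1 _) = toℚᵘ-cancel-≤
    (ℚᵘₚ.≤-respʳ-≃ (ℚᵘₚ.≃-sym (toℚᵘ-fromℚᵘ (ℚᵘ.mkℚᵘ (+ ℤ.∣ i ∣) 0)))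
      (ℚᵘ.*≤* (subst (ℤ._≤ + ℤ.∣ i ∣ ℤ.* + suc d-1) (sym (ℤₚ.*-identityʳ i)) (bound i))))
    where
    bound : ∀ i → i ℤ.≤ + ℤ.∣ i ∣ ℤ.* + suc d-1
    bound (+ k)    = subst (+ k ℤ.≤_) (ℤₚ.pos-* k (suc d-1)) (ℤ.+≤+ (ℕₚ.m≤m*n k (suc d-1)))
    bound -[1+ k ] = subst (-[1+ k ] ℤ.≤_) (ℤₚ.pos-* (suc k) (suc d-1)) ℤ.-≤+

  m≤m² : ∀ m → + m / 1 ≤ (+ m / 1) * (+ m / 1)
  m≤m² m = toℚᵘ-cancel-≤
    (ℚᵘₚ.≤-respʳ-≃ (ℚᵘₚ.≃-sym (ℚᵘₚ.≃-trans (toℚᵘ-homo-* (+ m / 1) (+ m / 1))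
        (ℚᵘₚ.*-cong (toℚᵘ-fromℚᵘ x) (toℚᵘ-fromℚᵘ x))))
      (ℚᵘₚ.≤-respˡ-≃ (ℚᵘₚ.≃-sym (toℚᵘ-fromℚᵘ x))
        (ℚᵘ.*≤* (subst₂ ℤ._≤_ (sym (ℤₚ.*-identityʳ (+ m)))
          (trans (ℤₚ.pos-* m m) (sym (ℤₚ.*-identityʳ (+ m ℤ.* + m)))) (ℤ.+≤+ (sq m))))))
    where
    x : ℚᵘ.ℚᵘ
    x = ℚᵘ.mkℚᵘ (+ m) 0
    sq : ∀ m → m ℕ.≤ m ℕ.* m
    sq zero    = ℕ.z≤n
    sq (suc m) = ℕₚ.m≤m*n (suc m) (suc m)

  sqrtApprox-upper : ∀ n p → p < (sqrtApprox n p + grid n 1) * (sqrtApprox n p + grid n 1)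
  sqrtApprox-upper n p = subst (λ x → p < x * x) (grid-suc n (floorSqrt n p (sqrtBound n p)))
                           (go (sqrtBound n p) start)
    where
    next : ℕ → ℚ
    next k = grid n (suc k)
    P : ℕ → Set
    P k = p < next k * next k
    go : ∀ B → P B → P (floorSqrt n p B)
    go zero    h = h
    go (suc B) h = step (grid n (suc B) * grid n (suc B) ≤? p)
      where
      step : (d : Dec (grid n (suc B) * grid n (suc B) ≤ p)) →
             P (if does d then suc B else floorSqrt n p B)
      step (yes _)  = h
      step (no  ¬h) = go B (≰⇒> ¬h)
    m : ℕ
    m = ℤ.∣ ↥ p ∣
    M δ : ℚ
    M = + m / 1
    δ = grid n 1
    0≤M : 0ℚ ≤ M
    0≤M = nonNegative⁻¹ M {{normalize-nonNeg m 1}}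
    0<δ : 0ℚ < δ
    0<δ = grid-step-pos n
    start : p < next (sqrtBound n p) * next (sqrtBound n p)
    start = subst (λ x → p < x * x)
      (sym (trans (grid-suc n (sqrtBound n p)) (cong (_+ δ) (grid-multiple n m))))
      (≤-<-trans (≤-trans (p≤m p) (m≤m² m))
        (subst₂ _<_ (+-identityʳ (M * M))
          (solve 2 (λ M δ → M :* M :+ (M :* δ :+ M :* δ :+ δ :* δ) := (M :+ δ) :* (M :+ δ)) refl M δ)
          (+-monoʳ-< (M * M)
            (+-mono-≤-< (+-mono-≤ (*-nn 0≤M (<⇒≤ 0<δ)) (*-nn 0≤M (<⇒≤ 0<δ))) (*-pos 0<δ 0<δ)))))
      where open +-*-Solver

  sqrt-diff : ∀ {ε} m n p q → 0ℚ < ε → grid n 1 < ε * ½ →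
              p - q < (ε * ½) * (ε * ½) → sqrtApprox m p - sqrtApprox n q < ε
  sqrt-diff {ε} m n p q 0<ε δ<η p-q<η² = ≰⇒> (λ ε≤s-t → contra ε≤s-t (sqrtApprox-lower m p))
    where
    η s t δ : ℚ
    η = ε * ½
    s = sqrtApprox m p
    t = sqrtApprox n q
    δ = grid n 1
    0<η : 0ℚ < η
    0<η = half-pos 0<ε
    0≤t+δ : 0ℚ ≤ t + δ
    0≤t+δ = +-mono-≤ (sqrtApprox-nonneg n q) (<⇒≤ (grid-step-pos n))
    contra : ε ≤ s - t → s ≡ 0ℚ ⊎ s * s ≤ p → ⊥
    contra ε≤s-t = λ where
        (inj₁ s≡0)  → <-irrefl (sym s≡0) 0<s
        (inj₂ s²≤p) → <-irrefl refl (<-≤-trans p<s² s²≤p)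
      where
      t+ε≤s : t + ε ≤ s
      t+ε≤s = ≮⇒≥ (λ s<t+ε → <-irrefl refl (≤-<-trans ε≤s-t (<⇒diff s<t+ε)))
      u≤s : (t + δ) + η ≤ s
      u≤s = ≤-trans (subst ((t + δ) + η ≤_)
              (trans (+-assoc t η η) (cong (λ x → t + x) (halves ε)))
              (+-monoˡ-≤ η (+-monoʳ-≤ t (<⇒≤ δ<η)))) t+ε≤s
      0≤u : 0ℚ ≤ (t + δ) + η
      0≤u = +-mono-≤ 0≤t+δ (<⇒≤ 0<η)
      u²≥ : (t + δ) * (t + δ) + η * η ≤ ((t + δ) + η) * ((t + δ) + η)
      u²≥ = subst₂ _≤_ (+-identityʳ _)
        (solve 2 (λ w η → w :* w :+ η :* η :+ (w :* η :+ w :* η) := (w :+ η) :* (w :+ η)) refl (t + δ) η)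
        (+-monoʳ-≤ ((t + δ) * (t + δ) + η * η)
          (+-mono-≤ (*-nn 0≤t+δ (<⇒≤ 0<η)) (*-nn 0≤t+δ (<⇒≤ 0<η))))
        where open +-*-Solver
      p<s² : p < s * s
      p<s² = <-≤-trans (<-≤-trans
        (<-trans (diff⇒< p-q<η²) (+-monoˡ-< (η * η) (sqrtApprox-upper n q))) u²≥)
        (*-mono-≤ 0≤u (sqrtApprox-nonneg m p) u≤s u≤s)
      0<s : 0ℚ < s
      0<s = <-≤-trans (subst (_< t + δ + η) (+-identityʳ 0ℚ) (+-mono-≤-< 0≤t+δ 0<η)) u≤s

open Rational public using (inv; grid; floorSqrt; sqrtBound; sqrtApprox)

-- Real numbers: Cauchy sequences of rationals with a modulus of
-- convergence, up to the setoid equality _≃ᴿ_.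

IsCauchy : (ℕ → ℚ) → Set
IsCauchy s = ∀ ε → 0ℚ ℚ.< ε →
  ∃[ N ] ∀ m n → N ℕ.≤ m → N ℕ.≤ n → ℚ.∣ s m ℚ.- s n ∣ ℚ.< ε

record ℝ : Set where
  constructor mkℝ
  field
    seq      : ℕ → ℚ
    isCauchy : IsCauchy seq

open ℝ public

infix 4 _≃ᴿ_ _<ᴿ_

_≃ᴿ_ : ℝ → ℝ → Set
x ≃ᴿ y = ∀ ε → 0ℚ ℚ.< ε → ∃[ N ] ∀ n → N ℕ.≤ n → ℚ.∣ seq x n ℚ.- seq y n ∣ ℚ.< ε

_<ᴿ_ : ℝ → ℝ → Set
x <ᴿ y = ∃[ ε ] 0ℚ ℚ.< ε × ∃[ N ] ∀ n → N ℕ.≤ n → seq x n ℚ.+ ε ℚ.< seq y n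

fromℚ : ℚ → ℝ
fromℚ p = mkℝ (λ _ → p) (λ ε 0<ε → 0 , λ _ _ _ _ →
  subst (ℚ._< ε) (sym (cong ℚ.∣_∣ (ℚₚ.+-inverseʳ p))) 0<ε)

0ᴿ 1ᴿ : ℝ
0ᴿ = fromℚ 0ℚ
1ᴿ = fromℚ 1ℚ

module RealCauchy where
  open import Data.Rational.Base using (_<_; _≤_; _+_; _*_; _-_; -_; ∣_∣)
  open Rational

  infixl 5 _∨_
  _∨_ : ℕ → ℕ → ℕ
  _∨_ = ℕ._⊔_

  ∨-l : ∀ {M N n} → M ∨ N ℕ.≤ n → M ℕ.≤ n
  ∨-l {M} {N} h = ℕₚ.≤-trans (ℕₚ.m≤m⊔n M N) h

  ∨-r : ∀ {M N n} → M ∨ N ℕ.≤ n → N ℕ.≤ n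
  ∨-r {M} {N} h = ℕₚ.≤-trans (ℕₚ.m≤n⊔m M N) h

  +-cauchy : ∀ s t → IsCauchy s → IsCauchy t → IsCauchy (λ n → s n + t n)
  +-cauchy s t cs ct ε 0<ε =
    let M , hM = cs (ε * ½) (half-pos 0<ε)
        N , hN = ct (ε * ½) (half-pos 0<ε)
    in M ∨ N , λ m n m≥ n≥ → subst (λ x → ∣ x ∣ < ε)
         (solve 4 (λ a b c d → (a :- c) :+ (b :- d) := (a :+ b) :- (c :+ d)) refl (s m) (t m) (s n) (t n))
         (sum-bound (s m - s n) (t m - t n)
           (hM m n (∨-l {M} {N} m≥) (∨-l {M} {N} n≥)) (hN m n (∨-r {M} {N} m≥) (∨-r {M} {N} n≥)))
    where open +-*-Solver

  neg-cauchy : ∀ s → IsCauchy s → IsCauchy (λ n → - s n)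
  neg-cauchy s cs ε 0<ε =
    let M , hM = cs ε 0<ε
    in M , λ m n m≥ n≥ → subst (λ x → ∣ x ∣ < ε)
         (solve 2 (λ a b → b :- a := (:- a) :- (:- b)) refl (s m) (s n))
         (hM n m n≥ m≥)
    where open +-*-Solver

  bounded : ∀ s → IsCauchy s →
            ∃[ B ] 0ℚ < B × ∃[ N ] ∀ n → N ℕ.≤ n → ∣ s n ∣ < B
  bounded s cs =
    let N , h = cs 1ℚ (ℚₚ.positive⁻¹ 1ℚ)
    in ∣ s N ∣ + 1ℚ
     , ℚₚ.+-mono-≤-< (ℚₚ.0≤∣p∣ (s N)) (ℚₚ.positive⁻¹ 1ℚ)
     , N
     , λ n n≥ → subst (λ x → ∣ x ∣ < ∣ s N ∣ + 1ℚ)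
         (solve 2 (λ a b → b :+ (a :- b) := a) refl (s n) (s N))
         (ℚₚ.≤-<-trans (ℚₚ.∣p+q∣≤∣p∣+∣q∣ (s N) (s n - s N))
           (ℚₚ.+-monoʳ-< ∣ s N ∣ (h n N n≥ ℕₚ.≤-refl)))
    where open +-*-Solver

  prod-bound : ∀ {B ε} x y → 0ℚ < B → ∣ x ∣ < B → ∣ y ∣ < ε * inv B → ∣ x * y ∣ < ε
  prod-bound {B} {ε} x y 0<B x<B y<ε/B = subst₂ _<_ (sym (ℚₚ.∣p*q∣≡∣p∣*∣q∣ x y)) eq
    (ℚₚ.≤-<-trans
      (ℚₚ.*-monoʳ-≤-nonNeg ∣ y ∣ {{ℚₚ.∣-∣-nonNeg y}} (ℚₚ.<⇒≤ x<B))
      (ℚₚ.*-monoʳ-<-pos B {{ℚ.positive 0<B}} y<ε/B))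
    where
    open +-*-Solver
    eq : B * (ε * inv B) ≡ ε
    eq = trans (solve 3 (λ b e i → b :* (e :* i) := e :* (b :* i)) refl B ε (inv B))
           (trans (cong (ε *_) (inv-inverseʳ 0<B)) (ℚₚ.*-identityʳ ε))

  *-cauchy : ∀ s t → IsCauchy s → IsCauchy t → IsCauchy (λ n → s n * t n)
  *-cauchy s t cs ct ε 0<ε =
    let B , 0<B , K , hK = bounded s cs
        C , 0<C , L , hL = bounded t ct
        M , hM = cs ((ε * ½) * inv C) (*-pos (half-pos 0<ε) (inv-pos 0<C))
        N , hN = ct ((ε * ½) * inv B) (*-pos (half-pos 0<ε) (inv-pos 0<B))
    in (K ∨ L) ∨ (M ∨ N) , λ m n m≥ n≥ → subst (λ x → ∣ x ∣ < ε)
         (solve 4 (λ a b c d → a :* (b :- d) :+ d :* (a :- c) := a :* b :- c :* d) refl (s m) (t m) (s n) (t n))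
         (sum-bound (s m * (t m - t n)) (t n * (s m - s n))
           (prod-bound (s m) (t m - t n) 0<B
             (hK m (∨-l {K} {L} (∨-l {K ∨ L} {M ∨ N} m≥)))
             (hN m n (∨-r {M} {N} (∨-r {K ∨ L} {M ∨ N} m≥)) (∨-r {M} {N} (∨-r {K ∨ L} {M ∨ N} n≥))))
           (prod-bound (t n) (s m - s n) 0<C
             (hL n (∨-r {K} {L} (∨-l {K ∨ L} {M ∨ N} n≥)))
             (hM m n (∨-l {M} {N} (∨-r {K ∨ L} {M ∨ N} m≥)) (∨-l {M} {N} (∨-r {K ∨ L} {M ∨ N} n≥)))))
    where open +-*-Solver

  inv-cauchy : ∀ s → IsCauchy s →
               ∃[ δ ] 0ℚ < δ × ∃[ N ] (∀ n → N ℕ.≤ n → 0ℚ + δ < s n) →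
               IsCauchy (λ n → inv (s n))
  inv-cauchy s cs (δ , 0<δ , N , hN) ε 0<ε =
    let M , hM = cs (ε * (δ * δ)) (*-pos 0<ε (*-pos 0<δ 0<δ))
        δ<s : ∀ n → N ℕ.≤ n → δ < s n
        δ<s n n≥ = subst (_< s n) (ℚₚ.+-identityˡ δ) (hN n n≥)
    in M ∨ N , λ m n m≥ n≥ →
         inv-diff (s m) (s n) 0<δ (δ<s m (∨-r {M} {N} m≥)) (δ<s n (∨-r {M} {N} n≥))
           (hM m n (∨-l {M} {N} m≥) (∨-l {M} {N} n≥))

  sqrt-cauchy : ∀ s → IsCauchy s → IsCauchy (λ n → sqrtApprox n (s n))
  sqrt-cauchy s cs ε 0<ε =
    let η       = ε * ½
        0<η     = half-pos 0<ε
        M , hM  = cs (η * η) (*-pos 0<η 0<η)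
        N , hN  = archimedean 0<η
        close : ∀ m n → M ∨ N ℕ.≤ m → M ∨ N ℕ.≤ n → sqrtApprox m (s m) - sqrtApprox n (s n) < ε
        close m n m≥ n≥ = sqrt-diff m n (s m) (s n) 0<ε (hN n (∨-r {M} {N} n≥))
          (ℚₚ.≤-<-trans (p≤∣p∣ (s m - s n)) (hM m n (∨-l {M} {N} m≥) (∨-l {M} {N} n≥)))
    in M ∨ N , λ m n m≥ n≥ → abs-diff-< (sqrtApprox m (s m)) (sqrtApprox n (s n)) (close m n m≥ n≥) (close n m n≥ m≥)

infixl 6 _+ᴿ_
infixl 7 _*ᴿ_
infix  8 -ᴿ_ √_

_+ᴿ_ : ℝ → ℝ → ℝ
x +ᴿ y = mkℝ (λ n → seq x n ℚ.+ seq y n) (RealCauchy.+-cauchy (seq x) (seq y) (isCauchy x) (isCauchy y))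

-ᴿ_ : ℝ → ℝ
-ᴿ x = mkℝ (λ n → ℚ.- seq x n) (RealCauchy.neg-cauchy (seq x) (isCauchy x))

_*ᴿ_ : ℝ → ℝ → ℝ
x *ᴿ y = mkℝ (λ n → seq x n ℚ.* seq y n) (RealCauchy.*-cauchy (seq x) (seq y) (isCauchy x) (isCauchy y))

recip : (x : ℝ) → 0ᴿ <ᴿ x → ℝ
recip x 0<x = mkℝ (λ n → inv (seq x n)) (RealCauchy.inv-cauchy (seq x) (isCauchy x) 0<x)

-- The square root of max(x, 0).

√_ : ℝ → ℝ
√ x = mkℝ (λ n → sqrtApprox n (seq x n)) (RealCauchy.sqrt-cauchy (seq x) (isCauchy x))

record ℂ : Set where
  constructor _+i_
  field
    re im : ℝ

open ℂ public

infix  4 _≃_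
infixl 6 _+_ _-_
infixl 7 _*_
infix  8 -_

_≃_ : ℂ → ℂ → Set
z ≃ w = re z ≃ᴿ re w × im z ≃ᴿ im w

0ℂ 1ℂ : ℂ
0ℂ = 0ᴿ +i 0ᴿ
1ℂ = 1ᴿ +i 0ᴿ

-_ : ℂ → ℂ
- z = (-ᴿ re z) +i (-ᴿ im z)

_+_ _-_ _*_ : ℂ → ℂ → ℂ
z + w = (re z +ᴿ re w) +i (im z +ᴿ im w)
z - w = z + (- w)
z * w = (re z *ᴿ re w +ᴿ -ᴿ (im z *ᴿ im w)) +i (re z *ᴿ im w +ᴿ im z *ᴿ re w)

ℂ-rawRing : RawRing 0ℓ 0ℓ
ℂ-rawRing = record
  { Carrier = ℂ
  ; _≈_     = _≃_
  ; _+_     = _+_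
  ; _*_     = _*_
  ; -_      = -_
  ; 0#      = 0ℂ
  ; 1#      = 1ℂ
  }

open RawSemiringDefinitions (RawRing.rawSemiring ℂ-rawRing) public using (_^_)

∣_∣ : ℂ → ℝ
∣ z ∣ = √ (re z *ᴿ re z +ᴿ im z *ᴿ im z)

-- Apartness from zero. Classically this is the same as ¬ (z ≃ 0ℂ);
-- constructively it is what division by z requires.

infix 4 _≢0
_≢0 : ℂ → Set
z ≢0 = 0ᴿ <ᴿ ∣ z ∣

-- 1/w is the conjugate of w divided by ∣w∣².

_/_[_] : ℂ → (w : ℂ) → w ≢0 → ℂ
z / w [ w≢0 ] = z * ((re w *ᴿ r *ᴿ r) +i (-ᴿ im w *ᴿ r *ᴿ r))
  where
  r : ℝ
  r = recip ∣ w ∣ w≢0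

infix 4 _⟶_
_⟶_ : (ℕ → ℂ) → ℂ → Set
s ⟶ L = ∀ ε → 0ᴿ <ᴿ ε → ∃[ N ] ∀ n → N ℕ.≤ n → ∣ s n - L ∣ <ᴿ ε

-- Sum and product over 0 ≤ j < n.

∑< ∏< : ℕ → (ℕ → ℂ) → ℂ
∑< zero    f = 0ℂ
∑< (suc n) f = ∑< n f + f n
∏< zero    f = 1ℂ
∏< (suc n) f = ∏< n f * f n

∑∞_≔_ ∏∞_≔_ : (ℕ → ℂ) → ℂ → Set
∑∞ f ≔ S = (λ n → ∑< n f) ⟶ S
∏∞ f ≔ P = (λ n → ∏< n f) ⟶ P

-- The finite q-Pochhammer symbol (x;q)_n.

poch : ℂ → ℂ → ℕ → ℂ
poch x q n = ∏< n (λ j → 1ℂ - x * q ^ j)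

-- "The product (x;q)_∞ converges and its value is P."

poch∞_,_≔_ : ℂ → ℂ → ℂ → Set
poch∞ x , q ≔ P = ∏∞ (λ j → 1ℂ - x * q ^ j) ≔ P

-- (q;q)_n (-cq;q)_n

denominator : ℂ → ℂ → ℕ → ℂ
denominator c q n = poch q q n * poch (- (c * q)) q n

-- a^n q^{n(n+1)/2} / ((q;q)_n (-cq;q)_n)

term : (a c q : ℂ) → (∀ n → denominator c q n ≢0) → ℕ → ℂ
term a c q d≢0 n = (a ^ n * q ^ (n ℕ.* (n ℕ.+ 1) ℕ./ 2)) / denominator c q n [ d≢0 n ]

{-# OPTIONS --safe #-}
module Submission where

-- Put P_b = (-bq;q)_∞ and S_{a,b} = Σ a^n q^{n(n+1)/2} / ((q;q)_n (-bq;q)_n).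
-- The polynomials A_N(a,b) with A_0 = 1 and
--   A_{N+1}(a,b) = (1 + b q^{N+1}) A_N(a,b) + a q^{N+1} A_N(a,bq)
-- are symmetric in a and b: the symmetry is carried along an induction by the relation
--   b A_N(a,b) + a A_N(a,bq) = a A_N(a,b) + b A_N(aq,b).
-- On the other hand A_N(a,b) is (q;q)_N (-bq;q)_N times the convolution over n + k = N of
-- the n-th term of S_{a,b} with 1/(q;q)_k. The terms decay geometrically and 1/(q;q)_k converges
-- geometrically, so A_N(a,b)/(q;q)_N tends to P_b S_{a,b} / (q;q)_∞, and the symmetry of A_N
-- passes to the limit. The estimates only use submultiplicativity of the modulus,
-- so they are carried out in a complete normed commutative ring.

-- The weight 1/(q;q)_k is what makes a finite symmetric version possible. Since (-bq;q)_N /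
-- (-bq;q)_n = (-bq^{n+1};q)_k for k = N - n, the q-binomial theorem gives the coefficient of a^n
-- b^m in (-bq;q)_N times the series truncated at N: it is q^{(n+m)(n+m+1)/2} / ((q;q)_n (q;q)_m)
-- times (q;q)_k / (q;q)_{k-m}, and only the numerator (q;q)_k spoils the symmetry in n and m.
-- Dividing the n-th term by (q;q)_k removes it. In the limit the weight becomes the constant
-- 1/(q;q)_∞, which cancels. Euler's expansion of (-bq^{n+1};q)_∞ and rearrangements of double
-- series are thereby avoided: one limit of one convolution remains. Division in ℂ takes a proof of
-- apartness and the modulus is a real number, so the argument is phrased with inverses given by
-- equations and with strict rational bounds on the modulus.

open import Level using (0ℓ)
open import Defs hiding (_+_; _*_; _-_; -_; _^_; ∣_∣)
open import Algebra.Bundles using (CommutativeRing; RawMonoid)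
import Algebra.Definitions.RawMonoid as RawMonoidDefinitions
import Algebra.Properties.Ring
import Algebra.Properties.Semiring.Exp
import Algebra.Properties.Semiring.Mult.TCOptimised
import Algebra.Solver.Ring
open import Algebra.Solver.Ring.AlmostCommutativeRing using (fromCommutativeRing; _-Raw-AlmostCommutative⟶_)
open import Data.Empty using (⊥-elim)
open import Data.Integer.Base as ℤ using (ℤ; +_; -[1+_]; _⊖_)
import Data.Integer.Properties as ℤₚ
open import Data.Maybe.Base using (Maybe; just; nothing)
open import Data.Nat.Base as ℕ using (ℕ; zero; suc) renaming (_≤_ to _≤ℕ_)
import Data.Nat.Divisibility as ℕ
import Data.Nat.DivMod as ℕ
import Data.Nat.Properties as ℕₚ
open import Data.Nat.Solver using () renaming (module +-*-Solver to ℕ-Solver)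
open import Data.Product using (Σ-syntax; ∃-syntax; _×_; _,_; proj₁; proj₂)
open import Data.Rational.Base as ℚ using (ℚ; 0ℚ; 1ℚ; ½)
import Data.Rational.Properties as ℚₚ
open import Data.Rational.Solver using (module +-*-Solver)
open import Data.Sum.Base using (inj₁; inj₂)
import Relation.Binary.PropositionalEquality as ≡
open ≡ using (_≡_)
import Relation.Binary.Reasoning.Setoid
open import Relation.Nullary using (¬_; yes; no)

-- Ring solver with integer coefficients for an arbitrary commutative ring.

module IntegerSolver (R : CommutativeRing 0ℓ 0ℓ) where
  open CommutativeRing R
  open Algebra.Properties.Ring ring
  open Algebra.Properties.Semiring.Mult.TCOptimised semiring renaming (_×_ to infixl 8 _·_)
  open Relation.Binary.Reasoning.Setoid setoid

  ⟦_⟧ᶻ : ℤ → Carrier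
  ⟦ + n ⟧ᶻ      = n · 1#
  ⟦ -[1+ n ] ⟧ᶻ = - (suc n · 1#)

  cancel-1 : ∀ x y → (1# + x) - (1# + y) ≈ x - y
  cancel-1 x y = begin
    (1# + x) - (1# + y)      ≈⟨ +-congˡ (-‿+-comm 1# y) ⟨
    (1# + x) + (- 1# + - y)  ≈⟨ +-congʳ (+-comm 1# x) ⟩
    (x + 1#) + (- 1# + - y)  ≈⟨ +-assoc x 1# _ ⟩
    x + (1# + (- 1# + - y))  ≈⟨ +-congˡ (+-assoc 1# (- 1#) (- y)) ⟨
    x + ((1# + - 1#) + - y)  ≈⟨ +-congˡ (+-congʳ (-‿inverseʳ 1#)) ⟩
    x + (0# + - y)           ≈⟨ +-congˡ (+-identityˡ (- y)) ⟩
    x - y                    ∎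

  ⟦⊖⟧ : ∀ m n → ⟦ m ⊖ n ⟧ᶻ ≈ m · 1# - n · 1#
  ⟦⊖⟧ m       zero    = sym (trans (+-congˡ -0#≈0#) (+-identityʳ (m · 1#)))
  ⟦⊖⟧ zero    (suc n) = sym (+-identityˡ _)
  ⟦⊖⟧ (suc m) (suc n) = begin
    ⟦ suc m ⊖ suc n ⟧ᶻ               ≡⟨ ≡.cong ⟦_⟧ᶻ (ℤₚ.[1+m]⊖[1+n]≡m⊖n m n) ⟩
    ⟦ m ⊖ n ⟧ᶻ                       ≈⟨ ⟦⊖⟧ m n ⟩
    m · 1# - n · 1#                  ≈⟨ cancel-1 (m · 1#) (n · 1#) ⟨
    (1# + m · 1#) - (1# + n · 1#)    ≈⟨ +-cong (1+× m 1#) (-‿cong (1+× n 1#)) ⟨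
    suc m · 1# - suc n · 1#          ∎

  ⟦+⟧ : ∀ i j → ⟦ i ℤ.+ j ⟧ᶻ ≈ ⟦ i ⟧ᶻ + ⟦ j ⟧ᶻ
  ⟦+⟧ (+ m)    (+ n)    = ×-homo-+ 1# m n
  ⟦+⟧ (+ m)    -[1+ n ] = ⟦⊖⟧ m (suc n)
  ⟦+⟧ -[1+ m ] (+ n)    = trans (⟦⊖⟧ n (suc m)) (+-comm _ _)
  ⟦+⟧ -[1+ m ] -[1+ n ] = begin
    - (suc (suc (m ℕ.+ n)) · 1#)            ≡⟨ ≡.cong (λ k → - (suc k · 1#)) (ℕₚ.+-suc m n) ⟨
    - ((suc m ℕ.+ suc n) · 1#)              ≈⟨ -‿cong (×-homo-+ 1# (suc m) (suc n)) ⟩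
    - (suc m · 1# + suc n · 1#)             ≈⟨ -‿+-comm _ _ ⟨
    - (suc m · 1#) + - (suc n · 1#)         ∎

  ⟦-⟧ : ∀ i → ⟦ ℤ.- i ⟧ᶻ ≈ - ⟦ i ⟧ᶻ
  ⟦-⟧ (+ zero)  = sym -0#≈0#
  ⟦-⟧ (+ suc n) = refl
  ⟦-⟧ -[1+ n ]  = sym (-‿involutive _)

  ⟦+*⟧ : ∀ m j → ⟦ + m ℤ.* j ⟧ᶻ ≈ m · 1# * ⟦ j ⟧ᶻ
  ⟦+*⟧ m (+ n)    = trans (reflexive (≡.cong ⟦_⟧ᶻ (≡.sym (ℤₚ.pos-* m n)))) (×1-homo-* m n)
  ⟦+*⟧ m -[1+ n ] = begin
    ⟦ + m ℤ.* -[1+ n ] ⟧ᶻ       ≡⟨ ≡.cong ⟦_⟧ᶻ (ℤₚ.neg-distribʳ-* (+ m) (+ suc n)) ⟨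
    ⟦ ℤ.- (+ m ℤ.* + suc n) ⟧ᶻ  ≈⟨ ⟦-⟧ (+ m ℤ.* + suc n) ⟩
    - ⟦ + m ℤ.* + suc n ⟧ᶻ      ≈⟨ -‿cong (⟦+*⟧ m (+ suc n)) ⟩
    - (m · 1# * (suc n · 1#))   ≈⟨ -‿distribʳ-* _ _ ⟩
    m · 1# * - (suc n · 1#)     ∎

  ⟦*⟧ : ∀ i j → ⟦ i ℤ.* j ⟧ᶻ ≈ ⟦ i ⟧ᶻ * ⟦ j ⟧ᶻ
  ⟦*⟧ (+ m)    j = ⟦+*⟧ m j
  ⟦*⟧ -[1+ m ] j = begin
    ⟦ -[1+ m ] ℤ.* j ⟧ᶻ         ≡⟨ ≡.cong ⟦_⟧ᶻ (ℤₚ.neg-distribˡ-* (+ suc m) j) ⟨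
    ⟦ ℤ.- (+ suc m ℤ.* j) ⟧ᶻ    ≈⟨ ⟦-⟧ (+ suc m ℤ.* j) ⟩
    - ⟦ + suc m ℤ.* j ⟧ᶻ        ≈⟨ -‿cong (⟦+*⟧ (suc m) j) ⟩
    - (suc m · 1# * ⟦ j ⟧ᶻ)     ≈⟨ -‿distribˡ-* _ _ ⟩
    - (suc m · 1#) * ⟦ j ⟧ᶻ     ∎

  -- Cancellation in the solver relies on deciding equality of coefficients. Equality in ℂ is
  -- undecidable, so the coefficients are integers and enter the ring through the canonical map.
  morphism : ℤ.+-*-rawRing -Raw-AlmostCommutative⟶ fromCommutativeRing R
  morphism = record
    { ⟦_⟧    = ⟦_⟧ᶻ
    ; +-homo = ⟦+⟧
    ; *-homo = ⟦*⟧
    ; -‿homo = ⟦-⟧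
    ; 0-homo = refl
    ; 1-homo = refl
    }

  _≟ᶻ_ : ∀ i j → Maybe (⟦ i ⟧ᶻ ≈ ⟦ j ⟧ᶻ)
  i ≟ᶻ j with i ℤₚ.≟ j
  ... | yes i≡j = just (reflexive (≡.cong ⟦_⟧ᶻ i≡j))
  ... | no  _   = nothing

  open Algebra.Solver.Ring ℤ.+-*-rawRing (fromCommutativeRing R) morphism _≟ᶻ_ public

-- Finite q-identities and the symmetric polynomials.

module Identities (R : CommutativeRing 0ℓ 0ℓ) where
  open CommutativeRing R
  open Algebra.Properties.Semiring.Exp semiring using (_^_; ^-homo-*)
  open Relation.Binary.Reasoning.Setoid setoid
  open IntegerSolver R

  𝟙 : ∀ {n} → Polynomial n
  𝟙 = con (+ 1)

  ∑ ∏ : ℕ → (ℕ → Carrier) → Carrier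
  ∑ zero    f = 0#
  ∑ (suc n) f = ∑ n f + f n
  ∏ zero    f = 1#
  ∏ (suc n) f = ∏ n f * f n

  -- Peeling off n = 0 and shifting `f` keeps the truncated subtraction N - n out of every index.
  conv : (ℕ → ℕ → Carrier) → ℕ → Carrier
  conv f zero    = f 0 0
  conv f (suc N) = f 0 (suc N) + conv (λ n k → f (suc n) k) N

  -- The equation `n + k ≡ N` lets a coefficient in `N` be traded for one in `n` and `k`, and back.
  conv-cong : ∀ {f g} N → (∀ n k → n ℕ.+ k ≡.≡ N → f n k ≈ g n k) → conv f N ≈ conv g N
  conv-cong zero    h = h 0 0 ≡.refl
  conv-cong (suc N) h = +-cong (h 0 (suc N) ≡.refl)
    (conv-cong N (λ n k n+k≡N → h (suc n) k (≡.cong suc n+k≡N)))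

  conv-+ : ∀ f g N → conv (λ n k → f n k + g n k) N ≈ conv f N + conv g N
  conv-+ f g zero    = refl
  conv-+ f g (suc N) = trans (+-congˡ (conv-+ (λ n → f (suc n)) (λ n → g (suc n)) N))
    (solve 4 (λ a b c d → (a :+ b) :+ (c :+ d) := (a :+ c) :+ (b :+ d)) refl _ _ _ _)

  conv-*ˡ : ∀ c f N → conv (λ n k → c * f n k) N ≈ c * conv f N
  conv-*ˡ c f zero    = refl
  conv-*ˡ c f (suc N) = trans (+-congˡ (conv-*ˡ c (λ n → f (suc n)) N)) (sym (distribˡ c _ _))

  conv-last : ∀ f N → conv f (suc N) ≈ conv (λ n k → f n (suc k)) N + f (suc N) 0
  conv-last f zero    = refl
  conv-last f (suc N) = trans (+-congˡ (conv-last (λ n → f (suc n)) N)) (sym (+-assoc _ _ _))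

  conv-∑ : ∀ f c N → conv (λ n _ → f n * c) N ≈ ∑ (suc N) f * c
  conv-∑ f c zero    = *-congʳ (sym (+-identityˡ _))
  conv-∑ f c (suc N) = trans (conv-last (λ n _ → f n * c) N)
    (trans (+-congʳ (conv-∑ f c N)) (sym (distribʳ c _ _)))

  module QSeries (q : Carrier) where

    pochhammer : Carrier → ℕ → Carrier
    pochhammer x n = ∏ n (λ j → 1# - x * q ^ j)

    pochhammer-cong : ∀ {x y} → x ≈ y → ∀ n → pochhammer x n ≈ pochhammer y n
    pochhammer-cong x≈y zero    = refl
    pochhammer-cong x≈y (suc n) = *-cong (pochhammer-cong x≈y n) (+-congˡ (-‿cong (*-congʳ x≈y)))

    pochhammer-+ : ∀ x n k → pochhammer x (n ℕ.+ k) ≈ pochhammer x n * pochhammer (x * q ^ n) k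
    pochhammer-+ x n zero rewrite ℕₚ.+-identityʳ n = sym (*-identityʳ _)
    pochhammer-+ x n (suc k) rewrite ℕₚ.+-suc n k = trans
      (*-cong (pochhammer-+ x n k) (+-congˡ (-‿cong (trans (*-congˡ (^-homo-* q n k)) (sym (*-assoc x _ _))))))
      (*-assoc _ _ _)

    P : Carrier → ℕ → Carrier
    P b = pochhammer (- (b * q))

    P-suc : ∀ b n → P b (suc n) ≈ P b n * (1# + b * q ^ suc n)
    P-suc b n = solve 4 (λ p b q x → p :* (𝟙 :- (:- (b :* q)) :* x) := p :* (𝟙 :+ b :* (q :* x))) refl (P b n) b q (q ^ n)

    P-cong : ∀ {b c} → b ≈ c → ∀ n → P b n ≈ P c n
    P-cong b≈c = pochhammer-cong (-‿cong (*-congʳ b≈c))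

    P-+ : ∀ b n k → P b (n ℕ.+ k) ≈ P b n * P (b * q ^ n) k
    P-+ b n k = trans (pochhammer-+ (- (b * q)) n k) (*-congˡ (pochhammer-cong
      (solve 3 (λ b q x → :- (b :* q) :* x := :- (b :* x :* q)) refl b q (q ^ n)) k))

    -- The sum over n + m + k = N of
    -- a^n b^m q^{(n+m)(n+m+1)/2} (q;q)_N / ((q;q)_n (q;q)_m (q;q)_k).
    A : ℕ → Carrier → Carrier → Carrier
    A zero    a b = 1#
    A (suc N) a b = (1# + b * q ^ suc N) * A N a b + a * q ^ suc N * A N a (b * q)

    -- Each side, as a function of a and b, satisfies the recursion that defines `A`, namely
    -- F_{N+1}(a,b) = F_N(a,b) + q^{N+1} (b F_N(a,b) + a F_N(a,bq)), and the two agree at N = 0.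
    -- Hence the induction hypothesis is used at b and at bq.
    A-exchange : ∀ N a b → b * A N a b + a * A N a (b * q) ≈ a * A N a b + b * A N (a * q) b
    A-exchange zero    a b = solve 2 (λ a b → b :* 𝟙 :+ a :* 𝟙 := a :* 𝟙 :+ b :* 𝟙) refl a b
    A-exchange (suc N) a b = begin
      b * A (suc N) a b + a * A (suc N) a (b * q)
        ≈⟨ solve 7 (λ a b q Q x y z →
             b :* ((𝟙 :+ b :* Q) :* x :+ a :* Q :* y) :+ a :* ((𝟙 :+ b :* q :* Q) :* y :+ a :* Q :* z)
             := (b :* x :+ a :* y) :+ Q :* (b :* (b :* x :+ a :* y) :+ a :* (b :* q :* y :+ a :* z)))
             refl a b q (q ^ suc N) x y z ⟩
      (b * x + a * y) + q ^ suc N * (b * (b * x + a * y) + a * (b * q * y + a * z))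
        ≈⟨ +-cong (A-exchange N a b)
             (*-congˡ (+-cong (*-congˡ (A-exchange N a b)) (*-congˡ (A-exchange N a (b * q))))) ⟩
      (a * x + b * v) + q ^ suc N * (b * (a * x + b * v) + a * (a * y + b * q * w))
        ≈⟨ solve 8 (λ a b q Q x y v w →
             a :* ((𝟙 :+ b :* Q) :* x :+ a :* Q :* y) :+ b :* ((𝟙 :+ b :* Q) :* v :+ a :* q :* Q :* w)
             := (a :* x :+ b :* v) :+ Q :* (b :* (a :* x :+ b :* v) :+ a :* (a :* y :+ b :* q :* w)))
             refl a b q (q ^ suc N) x y v w ⟨
      a * A (suc N) a b + b * A (suc N) (a * q) b ∎
      where
      x y z v w : Carrier
      x = A N a b
      y = A N a (b * q)
      z = A N a (b * q * q)
      v = A N (a * q) b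
      w = A N (a * q) (b * q)

    -- A step of the recursion adds q^{N+1} times the left side of `A-exchange` to A_N(a,b). The
    -- right side is, by symmetry at N, what the same step adds (up to q^{N+1}) to A_N(b,a).
    A-sym : ∀ N a b → A N a b ≈ A N b a
    A-sym zero    a b = refl
    A-sym (suc N) a b = begin
      A (suc N) a b
        ≈⟨ solve 5 (λ a b Q x y → (𝟙 :+ b :* Q) :* x :+ a :* Q :* y := x :+ Q :* (b :* x :+ a :* y))
             refl a b (q ^ suc N) (A N a b) (A N a (b * q)) ⟩
      A N a b + q ^ suc N * (b * A N a b + a * A N a (b * q))
        ≈⟨ +-congˡ (*-congˡ (A-exchange N a b)) ⟩
      A N a b + q ^ suc N * (a * A N a b + b * A N (a * q) b)
        ≈⟨ solve 5 (λ a b Q x y → x :+ Q :* (a :* x :+ b :* y) := (𝟙 :+ a :* Q) :* x :+ b :* Q :* y)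
             refl a b (q ^ suc N) (A N a b) (A N (a * q) b) ⟩
      (1# + a * q ^ suc N) * A N a b + b * q ^ suc N * A N (a * q) b
        ≈⟨ +-cong (*-congˡ (A-sym N a b)) (*-congˡ (A-sym N (a * q) b)) ⟩
      A (suc N) b a ∎

    -- `u n` is 1/(q;q)_n, given by its inverse equation because a ring has no division.
    module _ (u : ℕ → Carrier) (poch*u : ∀ n → pochhammer q n * u n ≈ 1#) where

      p : ℕ → Carrier
      p n = 1# - q ^ n

      u-suc : ∀ k → p (suc k) * u (suc k) ≈ u k
      u-suc k = begin
        p (suc k) * u (suc k)                                  ≈⟨ *-identityˡ _ ⟨
        1# * (p (suc k) * u (suc k))                           ≈⟨ *-congʳ (poch*u k) ⟨
        (pochhammer q k * u k) * (p (suc k) * u (suc k))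
          ≈⟨ solve 4 (λ Q u p v → (Q :* u) :* (p :* v) := u :* (Q :* p :* v)) refl (pochhammer q k) (u k) (p (suc k)) (u (suc k)) ⟩
        u k * (pochhammer q (suc k) * u (suc k))               ≈⟨ *-congˡ (poch*u (suc k)) ⟩
        u k * 1#                                               ≈⟨ *-identityʳ _ ⟩
        u k                                                    ∎

      -- This splitting of 1 - q^N for N = n + k is the source of a Pascal-type recursion: one part
      -- lowers k, the other lowers n.
      p-+ : ∀ n k → p (n ℕ.+ k) ≈ p k + q ^ k * p n
      p-+ n k = trans (+-congˡ (-‿cong (^-homo-* q n k)))
        (solve 2 (λ x y → 𝟙 :- x :* y := (𝟙 :- y) :+ y :* (𝟙 :- x)) refl (q ^ n) (q ^ k))

      -- `c n` is a^n q^{n(n+1)/2}, described by its first value and its ratio, which keeps the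
      -- halved exponent out of the algebra.
      module _ (a : Carrier) (c : ℕ → Carrier) (c-zero : c 0 ≈ 1#)
               (c-suc : ∀ n → c (suc n) ≈ c n * (a * q ^ suc n)) where

        -- The n-th term of the series times (-bq;q)_{n+k} / (q;q)_k, with (-bq;q)_n already
        -- cancelled, so that only (q;q)_n and (q;q)_k are inverted.
        entry : Carrier → ℕ → ℕ → Carrier
        entry b n k = c n * u n * u k * P (b * q ^ n) k

        -- The factor 1 - q^{k+1} turns 1/(q;q)_{k+1} into 1/(q;q)_k, and the last factor of
        -- (-bq^{n+1};q)_{k+1} splits off. That factor depends on n + k alone, so it can leave the
        -- convolution.
        entry-sucʳ : ∀ b n k → p (suc k) * entry b n (suc k) ≈ (1# + b * q ^ suc (n ℕ.+ k)) * entry b n k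
        entry-sucʳ b n k = begin
          p (suc k) * (c n * u n * u (suc k) * P (b * q ^ n) (suc k))
            ≈⟨ *-congˡ (*-congˡ (P-suc (b * q ^ n) k)) ⟩
          p (suc k) * (c n * u n * u (suc k) * (P (b * q ^ n) k * (1# + b * q ^ n * q ^ suc k)))
            ≈⟨ solve 9 (λ b c u v p P x y q →
                 p :* (c :* u :* v :* (P :* (𝟙 :+ b :* x :* (q :* y))))
                 := (𝟙 :+ b :* (q :* (x :* y))) :* (c :* u :* (p :* v) :* P))
                 refl b (c n) (u n) (u (suc k)) (p (suc k)) (P (b * q ^ n) k) (q ^ n) (q ^ k) q ⟩
          (1# + b * (q * (q ^ n * q ^ k))) * (c n * u n * (p (suc k) * u (suc k)) * P (b * q ^ n) k)
            ≈⟨ *-cong (+-congˡ (*-congˡ (*-congˡ (sym (^-homo-* q n k))))) (*-congʳ (*-congˡ (u-suc k))) ⟩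
          (1# + b * q ^ suc (n ℕ.+ k)) * entry b n k ∎

        -- The ratio a q^{n+1} of `c` meets the weight q^k and gives a q^{n+k+1}, again constant
        -- along the convolution. The shift of n becomes the substitution of bq for b.
        entry-sucˡ : ∀ b n k → q ^ k * p (suc n) * entry b (suc n) k ≈ a * q ^ suc (n ℕ.+ k) * entry (b * q) n k
        entry-sucˡ b n k = begin
          q ^ k * p (suc n) * (c (suc n) * u (suc n) * u k * P (b * q ^ suc n) k)
            ≈⟨ *-congˡ (*-cong (*-congʳ (*-congʳ (c-suc n))) (P-cong (sym (*-assoc b q (q ^ n))) k)) ⟩
          q ^ k * p (suc n) * (c n * (a * q ^ suc n) * u (suc n) * u k * P (b * q * q ^ n) k)
            ≈⟨ solve 9 (λ a c u v p P x y q →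
                 y :* p :* (c :* (a :* (q :* x)) :* v :* u :* P)
                 := a :* (q :* (x :* y)) :* (c :* (p :* v) :* u :* P))
                 refl a (c n) (u k) (u (suc n)) (p (suc n)) (P (b * q * q ^ n) k) (q ^ n) (q ^ k) q ⟩
          a * (q * (q ^ n * q ^ k)) * (c n * (p (suc n) * u (suc n)) * u k * P (b * q * q ^ n) k)
            ≈⟨ *-cong (*-congˡ (*-congˡ (sym (^-homo-* q n k)))) (*-congʳ (*-congʳ (*-congˡ (u-suc n)))) ⟩
          a * q ^ suc (n ℕ.+ k) * entry (b * q) n k ∎

        conv-entry-suc : ∀ b N → p (suc N) * conv (entry b) (suc N) ≈
                     (1# + b * q ^ suc N) * conv (entry b) N + a * q ^ suc N * conv (entry (b * q)) N
        conv-entry-suc b N = begin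
          p (suc N) * conv (entry b) (suc N)
            ≈⟨ conv-*ˡ (p (suc N)) (entry b) (suc N) ⟨
          conv (λ n k → p (suc N) * entry b n k) (suc N)
            ≈⟨ conv-cong (suc N) (λ n k n+k≡1+N → trans
                 (*-congʳ (trans (reflexive (≡.cong p (≡.sym n+k≡1+N))) (p-+ n k))) (distribʳ (entry b n k) _ _)) ⟩
          conv (λ n k → p k * entry b n k + q ^ k * p n * entry b n k) (suc N)
            ≈⟨ conv-+ (λ n k → p k * entry b n k) (λ n k → q ^ k * p n * entry b n k) (suc N) ⟩
          conv (λ n k → p k * entry b n k) (suc N) + conv (λ n k → q ^ k * p n * entry b n k) (suc N)
            ≈⟨ +-congʳ (conv-last (λ n k → p k * entry b n k) N) ⟩
          (conv (λ n k → p (suc k) * entry b n (suc k)) N + p 0 * entry b (suc N) 0)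
            + (q ^ suc N * p 0 * entry b 0 (suc N) + conv (λ n k → q ^ k * p (suc n) * entry b (suc n) k) N)
            -- The boundary terms at k = 0 and n = 0 carry the factor `p 0`, which is 1 - 1.
            ≈⟨ solve 5 (λ s t x y z →
                 (s :+ (𝟙 :- 𝟙) :* x) :+ (z :* (𝟙 :- 𝟙) :* y :+ t) := s :+ t)
                 refl (conv (λ n k → p (suc k) * entry b n (suc k)) N)
                 (conv (λ n k → q ^ k * p (suc n) * entry b (suc n) k) N)
                 (entry b (suc N) 0) (entry b 0 (suc N)) (q ^ suc N) ⟩
          conv (λ n k → p (suc k) * entry b n (suc k)) N + conv (λ n k → q ^ k * p (suc n) * entry b (suc n) k) N
            ≈⟨ +-cong (conv-cong N (λ { n k ≡.refl → entry-sucʳ b n k })) (conv-cong N (λ { n k ≡.refl → entry-sucˡ b n k })) ⟩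
          conv (λ n k → (1# + b * q ^ suc N) * entry b n k) N + conv (λ n k → a * q ^ suc N * entry (b * q) n k) N
            ≈⟨ +-cong (conv-*ˡ _ (entry b) N) (conv-*ˡ _ (entry (b * q)) N) ⟩
          (1# + b * q ^ suc N) * conv (entry b) N + a * q ^ suc N * conv (entry (b * q)) N ∎

        -- By `conv-entry-suc`, the right side obeys the recursion that defines `A`.
        A-conv : ∀ N b → A N a b ≈ pochhammer q N * conv (entry b) N
        A-conv zero    b = sym (begin
          1# * (c 0 * u 0 * u 0 * 1#)  ≈⟨ *-congˡ (*-congʳ (*-cong (*-cong c-zero u0≈1) u0≈1)) ⟩
          1# * (1# * 1# * 1# * 1#)     ≈⟨ solve 0 (𝟙 :* (𝟙 :* 𝟙 :* 𝟙 :* 𝟙) := 𝟙) refl ⟩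
          1#                           ∎)
          where
          u0≈1 : u 0 ≈ 1#
          u0≈1 = trans (sym (*-identityˡ (u 0))) (poch*u 0)
        A-conv (suc N) b = begin
          (1# + b * q ^ suc N) * A N a b + a * q ^ suc N * A N a (b * q)
            ≈⟨ +-cong (*-congˡ (A-conv N b)) (*-congˡ (A-conv N (b * q))) ⟩
          (1# + b * q ^ suc N) * (Q * conv (entry b) N) + a * q ^ suc N * (Q * conv (entry (b * q)) N)
            ≈⟨ solve 5 (λ s t Q x y → s :* (Q :* x) :+ t :* (Q :* y) := Q :* (s :* x :+ t :* y))
                 refl (1# + b * q ^ suc N) (a * q ^ suc N) Q (conv (entry b) N) (conv (entry (b * q)) N) ⟩
          Q * ((1# + b * q ^ suc N) * conv (entry b) N + a * q ^ suc N * conv (entry (b * q)) N)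
            ≈⟨ *-congˡ (conv-entry-suc b N) ⟨
          Q * (p (suc N) * conv (entry b) (suc N))
            ≈⟨ *-assoc Q _ _ ⟨
          pochhammer q (suc N) * conv (entry b) (suc N) ∎
          where
          Q : Carrier
          Q = pochhammer q N

        entry-term : ∀ {b d} n k → pochhammer q n * P b n * d ≈ 1# →
                 entry b n k ≈ P b (n ℕ.+ k) * (c n * d * u k)
        entry-term {b} {d} n k h = begin
          c n * u n * u k * P (b * q ^ n) k
            ≈⟨ *-identityʳ _ ⟨
          c n * u n * u k * P (b * q ^ n) k * 1#
            ≈⟨ *-congˡ h ⟨
          c n * u n * u k * P (b * q ^ n) k * (pochhammer q n * P b n * d)
            ≈⟨ solve 7 (λ c u v R Q S d → c :* u :* v :* R :* (Q :* S :* d) := (Q :* u) :* (S :* R :* (c :* d :* v)))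
                 refl (c n) (u n) (u k) (P (b * q ^ n) k) (pochhammer q n) (P b n) d ⟩
          pochhammer q n * u n * (P b n * P (b * q ^ n) k * (c n * d * u k))
            ≈⟨ trans (*-congʳ (poch*u n)) (*-identityˡ _) ⟩
          P b n * P (b * q ^ n) k * (c n * d * u k)
            ≈⟨ *-congʳ (P-+ b n k) ⟨
          P b (n ℕ.+ k) * (c n * d * u k) ∎

        -- The left side is the form in which N tends to infinity; the right side is the form in
        -- which the symmetry is available.
        conv-term : ∀ b (d : ℕ → Carrier) → (∀ n → pochhammer q n * P b n * d n ≈ 1#) → ∀ N →
                    P b N * conv (λ n k → c n * d n * u k) N ≈ u N * A N a b
        conv-term b d h N = begin
          P b N * conv (λ n k → c n * d n * u k) N
            ≈⟨ conv-*ˡ (P b N) _ N ⟨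
          conv (λ n k → P b N * (c n * d n * u k)) N
            ≈⟨ conv-cong N (λ { n k ≡.refl → entry-term n k (h n) }) ⟨
          conv (entry b) N
            ≈⟨ *-identityˡ _ ⟨
          1# * conv (entry b) N
            ≈⟨ *-congʳ (poch*u N) ⟨
          pochhammer q N * u N * conv (entry b) N
            ≈⟨ solve 3 (λ Q u x → Q :* u :* x := u :* (Q :* x)) refl (pochhammer q N) (u N) (conv (entry b) N) ⟩
          u N * (pochhammer q N * conv (entry b) N)
            ≈⟨ *-congˡ (A-conv N b) ⟨
          u N * A N a b ∎

-- Powers of rationals and the constants of the estimates.

module RationalPowers where
  open import Data.Rational.Base
  open ℚₚ
  open ≡
  open Rational using (*-pos; *-nn; +-pos; inv-pos; inv-inverseʳ;
                       archimedean; grid-zero; grid-suc; grid-step-pos; grid-multiple; half-pos)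
  open +-*-Solver

  infixr 8 _^ℚ_
  _^ℚ_ : ℚ → ℕ → ℚ
  p ^ℚ zero  = 1ℚ
  p ^ℚ suc n = p * p ^ℚ n

  0<1 : 0ℚ < 1ℚ
  0<1 = positive⁻¹ 1ℚ

  ^ℚ-pos : ∀ {p} n → 0ℚ < p → 0ℚ < p ^ℚ n
  ^ℚ-pos zero    0<p = 0<1
  ^ℚ-pos (suc n) 0<p = *-pos 0<p (^ℚ-pos n 0<p)

  ≤-gap : ∀ {p q} d → 0ℚ ≤ d → p + d ≡ q → p ≤ q
  ≤-gap {p} d 0≤d refl = subst (_≤ p + d) (+-identityʳ p) (+-monoʳ-≤ p 0≤d)

  <-gap : ∀ {p q} d → 0ℚ < d → p + d ≡ q → p < q
  <-gap {p} d 0<d refl = subst (_< p + d) (+-identityʳ p) (+-monoʳ-< p 0<d)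

  0<q-p : ∀ {p q} → p < q → 0ℚ < q - p
  0<q-p {p} {q} p<q = subst (_< q - p) (+-inverseʳ p) (+-monoˡ-< (- p) p<q)

  0≤q-p : ∀ {p q} → p ≤ q → 0ℚ ≤ q - p
  0≤q-p {p} {q} p≤q = subst (_≤ q - p) (+-inverseʳ p) (+-monoˡ-≤ (- p) p≤q)

  ^ℚ-≤1 : ∀ {p} n → 0ℚ < p → p < 1ℚ → p ^ℚ n ≤ 1ℚ
  ^ℚ-≤1 zero    0<p p<1 = ≤-refl
  ^ℚ-≤1 (suc n) 0<p p<1 = Rational.*-mono-≤ (<⇒≤ 0<p) (<⇒≤ 0<1) (<⇒≤ p<1) (^ℚ-≤1 n 0<p p<1)

  fromℕ : ℕ → ℚ
  fromℕ zero    = 0ℚ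
  fromℕ (suc n) = 1ℚ + fromℕ n

  fromℕ-nonneg : ∀ n → 0ℚ ≤ fromℕ n
  fromℕ-nonneg zero    = ≤-refl
  fromℕ-nonneg (suc n) = +-mono-≤ (<⇒≤ 0<1) (fromℕ-nonneg n)

  grid-fromℕ : ∀ n k → grid n k ≡ fromℕ k * grid n 1
  grid-fromℕ n zero    = trans (grid-zero n) (sym (*-zeroˡ (grid n 1)))
  grid-fromℕ n (suc k) = trans (grid-suc n k) (trans (cong (_+ grid n 1) (grid-fromℕ n k))
    (solve 2 (λ k g → k :* g :+ g := (con 1ℚ :+ k) :* g) refl (fromℕ k) (grid n 1)))

  suc*grid : ∀ n → fromℕ (suc n) * grid n 1 ≡ 1ℚ
  suc*grid n = trans (sym (grid-fromℕ n (suc n)))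
    (trans (cong (grid n) (sym (ℕₚ.*-identityˡ (suc n)))) (grid-multiple n 1))

  -- Bernoulli's inequality for 1 / p, multiplied by p ^ n.
  bernoulli : ∀ {p} n → 0ℚ < p → p < 1ℚ → p ^ℚ n * (1ℚ + fromℕ n * (1ℚ - p)) ≤ 1ℚ
  bernoulli {p} zero    0<p p<1 = ≤-reflexive
    (solve 1 (λ p → con 1ℚ :* (con 1ℚ :+ con 0ℚ :* (con 1ℚ :- p)) := con 1ℚ) refl p)
  bernoulli {p} (suc n) 0<p p<1 = ≤-trans
    (≤-gap (p ^ℚ n * (fromℕ (suc n) * ((1ℚ - p) * (1ℚ - p))))
      (*-nn (<⇒≤ (^ℚ-pos n 0<p)) (*-nn (fromℕ-nonneg (suc n)) (*-nn 0≤1-p 0≤1-p)))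
      (solve 3 (λ p x k →
          p :* x :* (con 1ℚ :+ (con 1ℚ :+ k) :* (con 1ℚ :- p))
          :+ x :* ((con 1ℚ :+ k) :* ((con 1ℚ :- p) :* (con 1ℚ :- p)))
          := x :* (con 1ℚ :+ k :* (con 1ℚ :- p)))
        refl p (p ^ℚ n) (fromℕ n)))
    (bernoulli n 0<p p<1)
    where
    0≤1-p : 0ℚ ≤ 1ℚ - p
    0≤1-p = <⇒≤ (0<q-p p<1)

  -- (n+1)(1 - p) = 1 + n(1 - p) - p, so Bernoulli's inequality gives p^n (n+1)(1 - p) ≤ 1, and
  -- `grid n 1` is 1/(n+1).
  ^ℚ-bound : ∀ {p} n → 0ℚ < p → p < 1ℚ → p ^ℚ n * (1ℚ - p) ≤ grid n 1
  ^ℚ-bound {p} n 0<p p<1 = subst₂ _≤_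
    (trans (solve 4 (λ x h g k → g :* (x :* ((con 1ℚ :+ k) :* h)) := x :* h :* ((con 1ℚ :+ k) :* g)) refl x h g (fromℕ n))
      (trans (cong (x * h *_) (suc*grid n)) (*-identityʳ (x * h))))
    (*-identityʳ g)
    (*-monoˡ-≤-nonNeg g {{nonNegative (<⇒≤ (grid-step-pos n))}}
      (≤-trans (≤-gap (x * p) (*-nn (<⇒≤ (^ℚ-pos n 0<p)) (<⇒≤ 0<p))
        (solve 3 (λ x k p → x :* ((con 1ℚ :+ k) :* (con 1ℚ :- p)) :+ x :* p := x :* (con 1ℚ :+ k :* (con 1ℚ :- p))) refl x (fromℕ n) p))
        (bernoulli n 0<p p<1)))
    where
    x h g : ℚ
    x = p ^ℚ n
    h = 1ℚ - p
    g = grid n 1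

  *-cancel-inv : ∀ {p} q → 0ℚ < p → q * inv p * p ≡ q
  *-cancel-inv {p} q 0<p = trans (solve 3 (λ q i p → q :* i :* p := q :* (p :* i)) refl q (inv p) p)
    (trans (cong (q *_) (inv-inverseʳ 0<p)) (*-identityʳ q))

  *-inv-< : ∀ {p q r} → 0ℚ < r → p < q * inv r → p * r < q
  *-inv-< {p} {q} {r} 0<r h = subst (p * r <_) (*-cancel-inv q 0<r) (*-monoˡ-<-pos r {{positive 0<r}} h)

  ^ℚ-null : ∀ {p C ε} → 0ℚ < p → p < 1ℚ → 0ℚ < C → 0ℚ < ε →
            ∃[ N ] ∀ n → N ℕ.≤ n → C * p ^ℚ n < ε
  ^ℚ-null {p} {C} {ε} 0<p p<1 0<C 0<ε =
    let 0<h = 0<q-p p<1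
        N , hN = archimedean (*-pos (*-pos 0<ε (inv-pos 0<C)) 0<h)
    in N , λ n N≤n → subst (_< ε) (*-comm (p ^ℚ n) C) (*-inv-< {p ^ℚ n} 0<C
         (*-cancelʳ-<-nonNeg (1ℚ - p) {{nonNegative (<⇒≤ 0<h)}}
           (≤-<-trans (^ℚ-bound n 0<p p<1) (hN n N≤n))))

  -- `C * inv p` absorbs a shift by one index, and `M` makes room for the term that `ratio-test`
  -- prepends.
  shift-bound : ∀ {p C M} x → 0ℚ < p → 0ℚ ≤ M → 0ℚ ≤ x → C * x ≤ (C * inv p + M) * (p * x)
  shift-bound {p} {C} {M} x 0<p 0≤M 0≤x = ≤-gap (M * (p * x)) (*-nn 0≤M (*-nn (<⇒≤ 0<p) 0≤x))
    (trans (cong (λ c → c * x + M * (p * x)) (sym (*-cancel-inv C 0<p)))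
      (solve 5 (λ C i p M x → C :* i :* p :* x :+ M :* (p :* x) := (C :* i :+ M) :* (p :* x)) refl C (inv p) p M x))

  -- Since B(1 - p) = C, adding C z turns -B z into -B p z: this is the telescoping of a geometric
  -- sum.
  partial-sum-step : ∀ {p C} x z → p < 1ℚ → let B = C * inv (1ℚ - p) in
                     (B * (x + x) - B * z) + C * z ≡ B * (x + x) - B * (p * z)
  partial-sum-step {p} {C} x z p<1 = trans
    (cong (λ c → (B * (x + x) - B * z) + c * z) (sym (*-cancel-inv C (0<q-p p<1))))
    (solve 4 (λ B x z p → (B :* (x :+ x) :- B :* z) :+ B :* (con 1ℚ :- p) :* z := B :* (x :+ x) :- B :* (p :* z)) refl B x z p)
    where
    B : ℚ
    B = C * inv (1ℚ - p)

  partial-sum-start : ∀ {B x} → 0ℚ < B → 0ℚ < x → 0ℚ < B * (x + x) - B * x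
  partial-sum-start {B} {x} 0<B 0<x = subst (0ℚ <_)
    (solve 2 (λ B x → B :* x := B :* (x :+ x) :- B :* x) refl B x) (*-pos 0<B 0<x)

  p-q≤p : ∀ {p q} → 0ℚ ≤ q → p - q ≤ p
  p-q≤p {p} {q} 0≤q = ≤-gap q 0≤q (solve 2 (λ p q → p :- q :+ q := p) refl p q)

  module ContractionRate {p : ℚ} (0<p : 0ℚ < p) (p<1 : p < 1ℚ) where

    -- The ratios estimated later have the form q w with w near 1 and |w| below 1 + 4 `margin` at
    -- worst. With `rate` the midpoint of p and 1 and `margin` = (1 - p)/8, the product p (1 + 4
    -- `margin`) falls short of `rate` by (1 - p)²/2.
    rate margin : ℚ
    rate   = (1ℚ + p) * ½
    margin = (1ℚ - p) * (½ * (½ * ½))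

    rate-pos : 0ℚ < rate
    rate-pos = half-pos (+-pos 0<1 0<p)

    rate<1 : rate < 1ℚ
    rate<1 = <-gap ((1ℚ - p) * ½) (half-pos (0<q-p p<1))
      (solve 1 (λ p → (con 1ℚ :+ p) :* con ½ :+ (con 1ℚ :- p) :* con ½ := con 1ℚ) refl p)

    margin-pos : 0ℚ < margin
    margin-pos = *-pos (0<q-p p<1) (positive⁻¹ (½ * (½ * ½)))

    margin≤½ : margin ≤ ½
    margin≤½ = ≤-gap (½ * ½ + ½ * (½ * ½) + p * (½ * (½ * ½)))
      (+-mono-≤ (nonNegative⁻¹ (½ * ½ + ½ * (½ * ½))) (*-nn (<⇒≤ 0<p) (nonNegative⁻¹ (½ * (½ * ½)))))
      (solve 1 (λ p → (con 1ℚ :- p) :* con (½ * (½ * ½)) :+ (con (½ * ½ + ½ * (½ * ½)) :+ p :* con (½ * (½ * ½))) := con ½) refl p)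

    p*[1+4*margin]≤rate : p * (1ℚ + margin + margin * (+ 3 / 1)) ≤ rate
    p*[1+4*margin]≤rate = ≤-gap ((1ℚ - p) * (1ℚ - p) * ½)
      (*-nn (*-nn (<⇒≤ (0<q-p p<1)) (<⇒≤ (0<q-p p<1))) (<⇒≤ Rational.0<½))
      (solve 1 (λ p → let m = (con 1ℚ :- p) :* con (½ * (½ * ½)) in
        p :* (con 1ℚ :+ m :+ m :* con (+ 3 / 1)) :+ (con 1ℚ :- p) :* (con 1ℚ :- p) :* con ½
        := (con 1ℚ :+ p) :* con ½) refl p)

    p*[1+2*margin]≤rate : p * (1ℚ + margin + margin) ≤ rate
    p*[1+2*margin]≤rate = ≤-trans
      (≤-gap (p * (margin + margin)) (*-nn (<⇒≤ 0<p) (<⇒≤ (+-pos margin-pos margin-pos)))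
        (solve 2 (λ p m → p :* (con 1ℚ :+ m :+ m) :+ p :* (m :+ m) := p :* (con 1ℚ :+ m :+ m :* con (+ 3 / 1))) refl p margin))
      p*[1+4*margin]≤rate

  -- 5/2 is the fixed point of x ↦ 5/4 + x/2, where 5/4 serves as a strict bound for 1.
  halving-step : ∀ m → (+ 5 / 4) + ½ * ((+ 5 / 2) + m) ≡ (+ 5 / 2) + ½ * m
  halving-step m = solve 1 (λ m → con (+ 5 / 4) :+ con ½ :* (con (+ 5 / 2) :+ m) := con (+ 5 / 2) :+ con ½ :* m) refl m

  convolution-step : ∀ K p x → K * 1ℚ * (p * x) + (K * (p * ½) + K * (p * ½)) * x ≡ (K + K) * (p * x)
  convolution-step K p x = solve 3 (λ K p x →
    K :* con 1ℚ :* (p :* x) :+ (K :* (p :* con ½) :+ K :* (p :* con ½)) :* x := (K :+ K) :* (p :* x)) refl K p x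

  *-thirds : ∀ p → p * (+ 1 / 3) * (+ 3 / 1) ≡ p
  *-thirds = solve 1 (λ p → p :* con (+ 1 / 3) :* con (+ 3 / 1) := p) refl

  *-regroup : ∀ C D x y → (C * x) * (D * y) ≡ C * D * x * y
  *-regroup = solve 4 (λ C D x y → (C :* x) :* (D :* y) := C :* D :* x :* y) refl

  -- At most six errors of this size are added in one estimate.
  eighth : ℚ → ℚ
  eighth p = p * (½ * (½ * ½))

  eighth-pos : ∀ {p} → 0ℚ < p → 0ℚ < eighth p
  eighth-pos 0<p = *-pos 0<p (positive⁻¹ (½ * (½ * ½)))

  6*eighth≤ : ∀ {p} → 0ℚ < p → let e = eighth p in (e + e + e) + (e + e + e) ≤ p
  6*eighth≤ {p} 0<p = ≤-gap (eighth p + eighth p) (<⇒≤ (+-pos (eighth-pos 0<p) (eighth-pos 0<p)))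
    (solve 1 (λ p → let e = p :* con (½ * (½ * ½)) in (e :+ e :+ e) :+ (e :+ e :+ e) :+ (e :+ e) := p) refl p)

  3*eighth≤ : ∀ {p} → 0ℚ < p → let e = eighth p in e + e + e ≤ p
  3*eighth≤ {p} 0<p = ≤-trans
    (≤-gap _ (<⇒≤ (+-pos (+-pos (eighth-pos 0<p) (eighth-pos 0<p)) (eighth-pos 0<p))) refl) (6*eighth≤ 0<p)

  2*eighth< : ∀ {p} → 0ℚ < p → let e = eighth p in e + e < p
  2*eighth< {p} 0<p = <-≤-trans (<-gap (eighth p) (eighth-pos 0<p) refl) (3*eighth≤ 0<p)

-- x ≺ r stands for ∣x∣ < r.
record CompleteNormedRing : Set₁ where
  field
    commutativeRing : CommutativeRing 0ℓ 0ℓ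
  open CommutativeRing commutativeRing public
  infix 4 _≺_
  field
    _≺_       : Carrier → ℚ → Set
    ≺-resp-≈  : ∀ {x y r} → x ≈ y → x ≺ r → y ≺ r
    ≺-mono    : ∀ {x r s} → x ≺ r → r ℚ.≤ s → x ≺ s
    ≺-pos     : ∀ {x r} → x ≺ r → 0ℚ ℚ.< r
    ≺-0       : ∀ {r} → 0ℚ ℚ.< r → 0# ≺ r
    ≺-1       : ∀ {r} → 1ℚ ℚ.< r → 1# ≺ r
    ≺-neg     : ∀ {x r} → x ≺ r → - x ≺ r
    ≺-+       : ∀ {x y r s} → x ≺ r → y ≺ s → x + y ≺ r ℚ.+ s
    ≺-*       : ∀ {x y r s} → x ≺ r → y ≺ s → x * y ≺ r ℚ.* s
    bounded   : ∀ x → ∃[ r ] x ≺ r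
    separated : ∀ {x} → (∀ ε → 0ℚ ℚ.< ε → x ≺ ε) → x ≈ 0#
    complete  : ∀ (s : ℕ → Carrier) (β : ℕ → ℚ) →
                (∀ ε → 0ℚ ℚ.< ε → ∃[ N ] ∀ n → N ℕ.≤ n → β n ℚ.< ε) →
                (∀ j n → s (j ℕ.+ n) - s n ≺ β n) →
                ∃[ L ] ∀ ε → 0ℚ ℚ.< ε → ∃[ N ] ∀ n → N ℕ.≤ n → s n - L ≺ ε

-- Null sequences and geometric convergence in a complete normed ring.

module NormedRingProperties (R : CompleteNormedRing) where
  open CompleteNormedRing R
  open Relation.Binary.Reasoning.Setoid setoid
  open IntegerSolver commutativeRing
  open Identities commutativeRing using (𝟙)
  open RationalPowers
  open Rational using (*-pos; half-pos; inv-pos; halves)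

  Null : (ℕ → Carrier) → Set
  Null s = ∀ ε → 0ℚ ℚ.< ε → ∃[ N ] ∀ n → N ℕ.≤ n → s n ≺ ε

  infix 4 _⇝_
  _⇝_ : (ℕ → Carrier) → Carrier → Set
  s ⇝ L = Null (λ n → s n - L)

  ≺-resp-≡ : ∀ {x r s} → r ≡.≡ s → x ≺ r → x ≺ s
  ≺-resp-≡ ≡.refl x≺r = x≺r

  ≺-- : ∀ {x y r s} → x ≺ r → y ≺ s → x - y ≺ r ℚ.+ s
  ≺-- x≺r y≺s = ≺-+ x≺r (≺-neg y≺s)

  Null-resp-≈ : ∀ {s t} → (∀ n → s n ≈ t n) → Null s → Null t
  Null-resp-≈ s≈t hs ε 0<ε = let N , h = hs ε 0<ε in N , λ n N≤n → ≺-resp-≈ (s≈t n) (h n N≤n)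

  Null-+ : ∀ {s t} → Null s → Null t → Null (λ n → s n + t n)
  Null-+ {s} {t} hs ht ε 0<ε =
    let M , hM = hs (ε ℚ.* ½) (half-pos 0<ε)
        N , hN = ht (ε ℚ.* ½) (half-pos 0<ε)
    in M ℕ.⊔ N , λ n M⊔N≤n → ≺-resp-≡ (halves ε)
         (≺-+ (hM n (ℕₚ.≤-trans (ℕₚ.m≤m⊔n M N) M⊔N≤n)) (hN n (ℕₚ.≤-trans (ℕₚ.m≤n⊔m M N) M⊔N≤n)))

  Null-*ˡ : ∀ {s} c → Null s → Null (λ n → c * s n)
  Null-*ˡ {s} c hs ε 0<ε =
    let C , c≺C = bounded c
        0<C     = ≺-pos c≺C
        N , h   = hs (ε ℚ.* inv C) (*-pos 0<ε (inv-pos 0<C))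
    in N , λ n N≤n → ≺-resp-≡
         (≡.trans (ℚₚ.*-comm C _) (*-cancel-inv ε 0<C)) (≺-* c≺C (h n N≤n))

  Null-* : ∀ {s t} → Null s → Null t → Null (λ n → s n * t n)
  Null-* {s} {t} hs ht ε 0<ε =
    let M , hM = hs 1ℚ 0<1
        N , hN = ht ε 0<ε
    in M ℕ.⊔ N , λ n M⊔N≤n → ≺-resp-≡ (ℚₚ.*-identityˡ ε)
         (≺-* (hM n (ℕₚ.≤-trans (ℕₚ.m≤m⊔n M N) M⊔N≤n)) (hN n (ℕₚ.≤-trans (ℕₚ.m≤n⊔m M N) M⊔N≤n)))

  Null-suc : ∀ {s} → Null s → Null (λ n → s (suc n))
  Null-suc hs ε 0<ε = let N , h = hs ε 0<ε in N , λ n N≤n → h (suc n) (ℕₚ.m≤n⇒m≤1+n N≤n)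

  ⇝-resp-≈ : ∀ {s t L} → (∀ n → s n ≈ t n) → s ⇝ L → t ⇝ L
  ⇝-resp-≈ s≈t = Null-resp-≈ (λ n → +-congʳ (s≈t n))

  ⇝-unique : ∀ {s L M} → s ⇝ L → s ⇝ M → L ≈ M
  ⇝-unique {s} {L} {M} s⇝L s⇝M = x-y≈0⇒x≈y (separated λ ε 0<ε →
    let N , h = null ε 0<ε in h N ℕₚ.≤-refl)
    where
    null : Null (λ _ → L - M)
    null = Null-resp-≈
      (λ n → solve 3 (λ L M x → :- 𝟙 :* (x :- L) :+ (x :- M) := L :- M) refl L M (s n))
      (Null-+ (Null-*ˡ (- 1#) s⇝L) s⇝M)
    x-y≈0⇒x≈y : ∀ {x y} → x - y ≈ 0# → x ≈ y
    x-y≈0⇒x≈y {x} {y} h = begin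
      x            ≈⟨ solve 2 (λ x y → x := (x :- y) :+ y) refl x y ⟩
      (x - y) + y  ≈⟨ +-congʳ h ⟩
      0# + y       ≈⟨ +-identityˡ y ⟩
      y            ∎

  ⇝-* : ∀ {s t L M} → s ⇝ L → t ⇝ M → (λ n → s n * t n) ⇝ L * M
  ⇝-* {s} {t} {L} {M} s⇝L t⇝M = Null-resp-≈
    (λ n → solve 4 (λ x y L M → (x :- L) :* (y :- M) :+ (M :* (x :- L) :+ L :* (y :- M)) := x :* y :- L :* M)
      refl (s n) (t n) L M)
    (Null-+ (Null-* s⇝L t⇝M) (Null-+ (Null-*ˡ M s⇝L) (Null-*ˡ L t⇝M)))

  ⇝-const : ∀ c → (λ _ → c) ⇝ c
  ⇝-const c ε 0<ε = 0 , λ _ _ → ≺-resp-≈ (sym (-‿inverseʳ c)) (≺-0 0<ε)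

  ⇝-+Null : ∀ {s t L} → s ⇝ L → Null t → (λ n → s n + t n) ⇝ L
  ⇝-+Null {s} {t} {L} hs ht = Null-resp-≈
    (λ n → solve 3 (λ x y L → (x :- L) :+ y := (x :+ y) :- L) refl (s n) (t n) L) (Null-+ hs ht)

  -- A rate is recorded, and not only a limit, because `conv-⇝` plays the rates of its two factors
  -- against each other.
  Geometric : ℚ → (ℕ → Carrier) → Set
  Geometric σ d = ∃[ C ] 0ℚ ℚ.< C × ∀ n → d n ≺ C ℚ.* σ ^ℚ n

  geometric-null : ∀ {σ d} → 0ℚ ℚ.< σ → σ ℚ.< 1ℚ → Geometric σ d → Null d
  geometric-null 0<σ σ<1 (C , 0<C , h) ε 0<ε =
    let N , hN = ^ℚ-null 0<σ σ<1 0<C 0<ε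
    in N , λ n N≤n → ≺-mono (h n) (ℚₚ.<⇒≤ (hN n N≤n))

  -- Induction on the index from which the ratio bound holds: each earlier term is prepended at the
  -- price of the larger constant C/σ + M.
  ratio-test : ∀ {σ d} N → 0ℚ ℚ.< σ →
               (∀ n → N ℕ.≤ n → ∃[ r ] d (suc n) ≈ d n * r × r ≺ σ) → Geometric σ d
  ratio-test {σ} {d} zero 0<σ h =
    let C , d₀≺C = bounded (d 0)
    in C , ≺-pos d₀≺C , all C d₀≺C
    where
    all : ∀ C → d 0 ≺ C → ∀ n → d n ≺ C ℚ.* σ ^ℚ n
    all C d₀≺C zero    = ≺-resp-≡ (≡.sym (ℚₚ.*-identityʳ C)) d₀≺C
    all C d₀≺C (suc n) = let r , eq , r≺σ = h n ℕ.z≤n in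
      ≺-resp-≈ (sym eq) (≺-resp-≡
        (≡.trans (ℚₚ.*-assoc C _ σ) (≡.cong (C ℚ.*_) (ℚₚ.*-comm _ σ))) (≺-* (all C d₀≺C n) r≺σ))
  ratio-test {σ} {d} (suc N) 0<σ h =
    let C , 0<C , hC = ratio-test {σ} {λ n → d (suc n)} N 0<σ (λ n N≤n → h (suc n) (ℕ.s≤s N≤n))
        M , d₀≺M     = bounded (d 0)
        0<M          = ≺-pos d₀≺M
        0<C/σ        = *-pos 0<C (inv-pos 0<σ)
    in C ℚ.* inv σ ℚ.+ M , Rational.+-pos 0<C/σ 0<M , λ where
         zero    → ≺-mono d₀≺M (≤-gap _ (ℚₚ.<⇒≤ 0<C/σ)
                     (≡.trans (ℚₚ.+-comm M _) (≡.sym (ℚₚ.*-identityʳ _))))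
         (suc n) → ≺-mono (hC n) (shift-bound {C = C} (σ ^ℚ n) 0<σ (ℚₚ.<⇒≤ 0<M) (ℚₚ.<⇒≤ (^ℚ-pos n 0<σ)))

  -- The sequence is given through its increments, so that partial products and the reciprocals
  -- 1/(q;q)_n are covered as well as partial sums.
  series : ∀ {σ s d} → 0ℚ ℚ.< σ → σ ℚ.< 1ℚ → (∀ n → s (suc n) ≈ s n + d n) → Geometric σ d →
           ∃[ L ] Geometric σ (λ n → s n - L)
  series {σ} {s} {d} 0<σ σ<1 s-suc (C , 0<C , d≺) =
    L , (B ℚ.+ B) ℚ.+ (B ℚ.+ B) , Rational.+-pos (Rational.+-pos 0<B 0<B) (Rational.+-pos 0<B 0<B) , tail
    where
    B : ℚ
    B = C ℚ.* inv (1ℚ ℚ.- σ)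
    0<B : 0ℚ ℚ.< B
    0<B = *-pos 0<C (inv-pos (0<q-p σ<1))
    -- A geometric sum gives B (σ^n - σ^{j+n}), which is 0 at j = 0. Doubling σ^n keeps the bound
    -- positive there, as a strict bound requires.
    partial : ∀ j n → s (j ℕ.+ n) - s n ≺ B ℚ.* (σ ^ℚ n ℚ.+ σ ^ℚ n) ℚ.- B ℚ.* σ ^ℚ (j ℕ.+ n)
    partial zero    n = ≺-resp-≈ (sym (-‿inverseʳ (s n))) (≺-0 (partial-sum-start 0<B (^ℚ-pos n 0<σ)))
    partial (suc j) n = ≺-resp-≈
      (trans (solve 3 (λ x y z → (x :- y) :+ z := (x :+ z) :- y) refl (s (j ℕ.+ n)) (s n) (d (j ℕ.+ n)))
        (+-congʳ (sym (s-suc (j ℕ.+ n)))))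
      (≺-resp-≡
        (partial-sum-step {C = C} (σ ^ℚ n) (σ ^ℚ (j ℕ.+ n)) σ<1) (≺-+ (partial j n) (d≺ (j ℕ.+ n))))
    β : ℕ → ℚ
    β n = (B ℚ.+ B) ℚ.* σ ^ℚ n
    β-bound : ∀ j n → s (j ℕ.+ n) - s n ≺ β n
    β-bound j n = ≺-resp-≡
      (≡.trans (ℚₚ.*-distribˡ-+ B _ _) (≡.sym (ℚₚ.*-distribʳ-+ (σ ^ℚ n) B B)))
      (≺-mono (partial j n) (p-q≤p (ℚₚ.<⇒≤ (*-pos 0<B (^ℚ-pos (j ℕ.+ n) 0<σ)))))
    limit : ∃[ L ] s ⇝ L
    limit = complete s β (λ ε → ^ℚ-null 0<σ σ<1 (Rational.+-pos 0<B 0<B)) β-bound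
    L : Carrier
    L = proj₁ limit
    tail : ∀ n → s n - L ≺ ((B ℚ.+ B) ℚ.+ (B ℚ.+ B)) ℚ.* σ ^ℚ n
    tail n =
      -- The index N + n is late enough for `s (N + n)` to lie within `β n` of the limit. The Cauchy
      -- bound adds another `β n`, whence the constant 4B.
      let N , h = proj₂ limit (β n) (*-pos (Rational.+-pos 0<B 0<B) (^ℚ-pos n 0<σ))
      in ≺-resp-≈ (solve 3 (λ x y z → :- (y :- x) :+ (y :- z) := x :- z) refl (s n) (s (N ℕ.+ n)) L)
           (≺-resp-≡ (≡.sym (ℚₚ.*-distribʳ-+ (σ ^ℚ n) (B ℚ.+ B) (B ℚ.+ B)))
             (≺-+ (≺-neg (β-bound N n)) (h (N ℕ.+ n) (ℕₚ.m≤m+n N n))))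

-- Inverses near 1 and limits of convolutions.

module Convergence (R : CompleteNormedRing) where
  open CompleteNormedRing R
  open Algebra.Properties.Semiring.Exp semiring using (_^_; ^-homo-*)
  open Relation.Binary.Reasoning.Setoid setoid
  open IntegerSolver commutativeRing
  open Identities commutativeRing
  open NormedRingProperties R
  open RationalPowers
  open Rational using (*-pos; half-pos; halves)

  inverse-fixpoint : ∀ {y v} → (1# - y) * v ≈ 1# → 1# + y * v ≈ v
  inverse-fixpoint {y} {v} h = trans (+-congʳ (sym h))
    (solve 2 (λ y v → (𝟙 :- y) :* v :+ y :* v := v) refl y v)

  -- Iterating ∣v∣ ≤ 1 + ∣y∣∣v∣ halves the excess of an initial bound for v over 5/2.
  inverse-bound : ∀ {y v} → y ≺ ½ → (1# - y) * v ≈ 1# → v ≺ + 3 ℚ./ 1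
  inverse-bound {y} {v} y≺½ h =
    let N , hN = ^ℚ-null Rational.0<½ (<-gap ½ Rational.0<½ ≡.refl) (≺-pos v≺M) Rational.0<½
    in ≺-mono (iterate N) (ℚₚ.+-monoʳ-≤ (+ 5 ℚ./ 2) (ℚₚ.<⇒≤ (hN N ℕₚ.≤-refl)))
    where
    M : ℚ
    M = proj₁ (bounded v)
    v≺M : v ≺ M
    v≺M = proj₂ (bounded v)
    iterate : ∀ k → v ≺ (+ 5 ℚ./ 2) ℚ.+ M ℚ.* ½ ^ℚ k
    iterate zero    = ≺-mono v≺M (≤-gap (+ 5 ℚ./ 2) (ℚₚ.nonNegative⁻¹ (+ 5 ℚ./ 2))
      (≡.trans (ℚₚ.+-comm M _) (≡.cong ((+ 5 ℚ./ 2) ℚ.+_) (≡.sym (ℚₚ.*-identityʳ M)))))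
    iterate (suc k) = ≺-resp-≈ (inverse-fixpoint h) (≺-resp-≡
      (≡.trans (halving-step (M ℚ.* ½ ^ℚ k)) (≡.cong ((+ 5 ℚ./ 2) ℚ.+_)
        (≡.trans (≡.sym (ℚₚ.*-assoc ½ M _)) (≡.trans (≡.cong (ℚ._* ½ ^ℚ k) (ℚₚ.*-comm ½ M)) (ℚₚ.*-assoc M ½ _)))))
      (≺-+ (≺-1 {+ 5 ℚ./ 4} (<-gap (+ 1 ℚ./ 4) (ℚₚ.positive⁻¹ (+ 1 ℚ./ 4)) ≡.refl)) (≺-* y≺½ (iterate k))))

  -- The crude bound 3 is fed once more into v = 1 + y v. The lone summand `s` makes the bound on 1
  -- strict.
  inverse-near-1 : ∀ {y v s} → y ≺ s → s ℚ.≤ ½ → (1# - y) * v ≈ 1# → v ≺ 1ℚ ℚ.+ s ℚ.+ s ℚ.* (+ 3 ℚ./ 1)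
  inverse-near-1 {s = s} y≺s s≤½ h = ≺-resp-≈ (inverse-fixpoint h)
    (≺-+ (≺-1 (<-gap s (≺-pos y≺s) ≡.refl)) (≺-* y≺s (inverse-bound (≺-mono y≺s s≤½) h)))

  ^-geometric : ∀ {y s} → y ≺ s → Geometric s (y ^_)
  ^-geometric {y} y≺s = ratio-test 0 (≺-pos y≺s) (λ n _ → y , *-comm y (y ^ n) , y≺s)

  -- The inverse is the Neumann series, the sum of all powers of `y`, which exists by completeness.
  1-y-invertible : ∀ {y s} → y ≺ s → s ℚ.< 1ℚ → ∃[ v ] (1# - y) * v ≈ 1#
  1-y-invertible {y} {s} y≺s s<1 = L , ⇝-unique
    (⇝-* (⇝-const (1# - y)) (geometric-null 0<s s<1 (proj₂ limit)))
    (⇝-resp-≈ (λ n → sym (geometric-sum n)) (⇝-+Null (⇝-const 1#)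
      (Null-resp-≈ (λ n → solve 1 (λ x → :- 𝟙 :* x := :- x) refl (y ^ n))
        (Null-*ˡ (- 1#) (geometric-null 0<s s<1 (^-geometric y≺s))))))
    where
    0<s : 0ℚ ℚ.< s
    0<s = ≺-pos y≺s
    limit : ∃[ L ] Geometric s (λ n → ∑ n (y ^_) - L)
    limit = series 0<s s<1 (λ n → refl) (^-geometric y≺s)
    L : Carrier
    L = proj₁ limit
    geometric-sum : ∀ n → (1# - y) * ∑ n (y ^_) ≈ 1# - y ^ n
    geometric-sum zero    = solve 1 (λ y → (𝟙 :- y) :* con (+ 0) := 𝟙 :- 𝟙) refl y
    geometric-sum (suc n) = trans (distribˡ _ _ _) (trans (+-congʳ (geometric-sum n))
      (solve 2 (λ y x → (𝟙 :- x) :+ (𝟙 :- y) :* x := 𝟙 :- y :* x) refl y (y ^ n)))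

  -- As one factor decays at half the rate of the other, the n-th summand is at most K σ^N / 2^n.
  -- The sum stays below 2K σ^N, without the factor N + 1 that equal rates would cause.
  conv-geometric : ∀ {σ f} K N → (∀ n k → f n k ≺ K ℚ.* (σ ℚ.* ½) ^ℚ n ℚ.* σ ^ℚ k) → conv f N ≺ (K ℚ.+ K) ℚ.* σ ^ℚ N
  conv-geometric {σ} {f} K zero    h = ≺-mono (h 0 0) (≤-gap K
    (ℚₚ.<⇒≤ (≡.subst (0ℚ ℚ.<_) K*1*1≡K (≺-pos (h 0 0))))
    (≡.trans (≡.cong (ℚ._+ K) K*1*1≡K) (≡.sym (ℚₚ.*-identityʳ (K ℚ.+ K)))))
    where
    K*1*1≡K : K ℚ.* 1ℚ ℚ.* 1ℚ ≡.≡ K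
    K*1*1≡K = ≡.trans (ℚₚ.*-identityʳ (K ℚ.* 1ℚ)) (ℚₚ.*-identityʳ K)
  conv-geometric {σ} {f} K (suc N) h = ≺-resp-≡ (convolution-step K σ (σ ^ℚ N))
    (≺-+ (h 0 (suc N)) (conv-geometric {σ} (K ℚ.* (σ ℚ.* ½)) N (λ n k →
      ≺-resp-≡ (≡.cong (ℚ._* σ ^ℚ k) (≡.sym (ℚₚ.*-assoc K (σ ℚ.* ½) ((σ ℚ.* ½) ^ℚ n)))) (h (suc n) k))))

  -- Writing `u k` as `U + (u k - U)` splits the convolution into a partial sum of `t` times `U` and
  -- a remainder to which `conv-geometric` applies.
  conv-⇝ : ∀ {σ S U} {t u : ℕ → Carrier} → 0ℚ ℚ.< σ → σ ℚ.< 1ℚ → Geometric (σ ℚ.* ½) t → (λ n → ∑ n t) ⇝ S →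
           Geometric σ (λ k → u k - U) → conv (λ n k → t n * u k) ⇝ S * U
  conv-⇝ {σ} {S} {U} {t} {u} 0<σ σ<1 (C , 0<C , t≺) ∑t⇝S (D , 0<D , u≺) = ⇝-resp-≈ split
    (⇝-+Null (⇝-* (Null-suc ∑t⇝S) (⇝-const U))
      (geometric-null 0<σ σ<1 (_ , Rational.+-pos (*-pos 0<C 0<D) (*-pos 0<C 0<D) , λ N →
        conv-geometric (C ℚ.* D) N (λ n k → ≺-resp-≡ (*-regroup C D _ _) (≺-* (t≺ n) (u≺ k))))))
    where
    split : ∀ N → ∑ (suc N) t * U + conv (λ n k → t n * (u k - U)) N ≈ conv (λ n k → t n * u k) N
    split N = begin
      ∑ (suc N) t * U + conv (λ n k → t n * (u k - U)) N
        ≈⟨ +-congʳ (conv-∑ t U N) ⟨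
      conv (λ n k → t n * U) N + conv (λ n k → t n * (u k - U)) N
        ≈⟨ conv-+ (λ n k → t n * U) (λ n k → t n * (u k - U)) N ⟨
      conv (λ n k → t n * U + t n * (u k - U)) N
        ≈⟨ conv-cong N (λ n k _ → solve 3 (λ t u U → t :* U :+ t :* (u :- U) := t :* u) refl (t n) (u k) U) ⟩
      conv (λ n k → t n * u k) N ∎

  -- Convergence of the q-products and q-series, and the limit of the symmetry.

  module QSeriesLimits {q : Carrier} {ρ : ℚ} (q≺ρ : q ≺ ρ) (ρ<1 : ρ ℚ.< 1ℚ) where
    open QSeries q

    0<ρ : 0ℚ ℚ.< ρ
    0<ρ = ≺-pos q≺ρ

    open ContractionRate 0<ρ ρ<1

    q^-null : Null (q ^_)
    q^-null = geometric-null 0<ρ ρ<1 (^-geometric q≺ρ)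

    q^suc≺ρ : ∀ n → q ^ suc n ≺ ρ
    q^suc≺ρ zero    = ≺-resp-≈ (sym (*-identityʳ q)) q≺ρ
    q^suc≺ρ (suc n) = ≺-mono (≺-* q≺ρ (q^suc≺ρ n))
      (ℚₚ.≤-trans (Rational.*-mono-≤ (ℚₚ.<⇒≤ 0<ρ) (ℚₚ.<⇒≤ 0<ρ) (ℚₚ.<⇒≤ ρ<1) ℚₚ.≤-refl) (ℚₚ.≤-reflexive (ℚₚ.*-identityˡ ρ)))

    -- The increments -x q^n (x;q)_n have ratio q (1 - x q^n). Of the two margins in the bound, one
    -- is for x q^n and the other makes the bound on 1 strict.
    pochhammer-converges : ∀ x → ∃[ L ] Geometric rate (λ n → pochhammer x n - L)
    pochhammer-converges x = series rate-pos rate<1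
      (λ n → solve 3 (λ p x y → p :* (𝟙 :- x :* y) := p :+ p :* :- (x :* y)) refl (pochhammer x n) x (q ^ n))
      (let N , h = Null-*ˡ x q^-null margin margin-pos
       in ratio-test N rate-pos (λ n N≤n →
            q * (1# - x * q ^ n)
          , solve 4 (λ p x y q → p :* (𝟙 :- x :* y) :* :- (x :* (q :* y)) := p :* :- (x :* y) :* (q :* (𝟙 :- x :* y)))
              refl (pochhammer x n) x (q ^ n) q
          , ≺-mono (≺-* q≺ρ (≺-- (≺-1 (<-gap margin margin-pos ≡.refl)) (h n N≤n))) p*[1+2*margin]≤rate))

    module _ (u : ℕ → Carrier) (poch*u : ∀ n → pochhammer q n * u n ≈ 1#) where

      -- The increment 1/(q;q)_{n+1} - 1/(q;q)_n equals q^{n+1}/(q;q)_{n+1}, so consecutive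
      -- increments have ratio q/(1 - q^{n+2}), that is, q times `w n`.
      u-converges : ∃[ L ] Geometric rate (λ n → u n - L)
      u-converges = series rate-pos rate<1
        (λ n → trans
          (solve 2 (λ x v → v := (𝟙 :- x) :* v :+ x :* v) refl (q ^ suc n) (u (suc n)))
          (+-congʳ (u-suc u poch*u n)))
        (let N , h = q^-null margin margin-pos
         in ratio-test N rate-pos (λ n N≤n →
              q * w n , ratio n
            , ≺-mono (≺-* q≺ρ (inverse-near-1 (h (suc (suc n)) (ℕₚ.m≤n⇒m≤1+n (ℕₚ.m≤n⇒m≤1+n N≤n))) margin≤½ (w-inverse n)))
                p*[1+4*margin]≤rate))
        where
        w : ℕ → Carrier
        w n = pochhammer q (suc n) * u (suc (suc n))
        w-inverse : ∀ n → (1# - q ^ suc (suc n)) * w n ≈ 1#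
        w-inverse n = trans
          (solve 3 (λ y p v → (𝟙 :- y) :* (p :* v) := p :* (𝟙 :- y) :* v) refl (q ^ suc (suc n)) (pochhammer q (suc n)) (u (suc (suc n))))
          (poch*u (suc (suc n)))
        ratio : ∀ n → q ^ suc (suc n) * u (suc (suc n)) ≈ q ^ suc n * u (suc n) * (q * w n)
        ratio n = begin
          q ^ suc (suc n) * u (suc (suc n))
            ≈⟨ *-identityʳ _ ⟨
          q ^ suc (suc n) * u (suc (suc n)) * 1#
            ≈⟨ *-congˡ (poch*u (suc n)) ⟨
          q ^ suc (suc n) * u (suc (suc n)) * (pochhammer q (suc n) * u (suc n))
            ≈⟨ solve 5 (λ q y v Q u → q :* y :* v :* (Q :* u) := y :* u :* (q :* (Q :* v)))
                 refl q (q ^ suc n) (u (suc (suc n))) (pochhammer q (suc n)) (u (suc n)) ⟩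
          q ^ suc n * u (suc n) * (q * w n) ∎

    -- Consecutive terms have ratio a q^{n+1} times `w n` = 1/((1 - q^{n+1})(1 + b q^{n+1})). This
    -- tends to 0, so any rate can be reached; half of `rate` is what `conv-⇝` asks for. The
    -- division of `τ` by 3 pays for the bound 3 on `w n`.
    term-geometric : ∀ {a b} (c d : ℕ → Carrier) → (∀ n → c (suc n) ≈ c n * (a * q ^ suc n)) →
                     (∀ n → pochhammer q n * P b n * d n ≈ 1#) → Geometric (rate ℚ.* ½) (λ n → c n * d n)
    term-geometric {a} {b} c d c-suc d-inverse =
      let M , hM = null-y ½ Rational.0<½
          N , hN = Null-*ˡ a (Null-suc q^-null) (τ ℚ.* (+ 1 ℚ./ 3)) (*-pos 0<τ (ℚₚ.positive⁻¹ (+ 1 ℚ./ 3)))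
      in ratio-test (M ℕ.⊔ N) 0<τ (λ n M⊔N≤n →
           a * q ^ suc n * w n , ratio n
         , ≺-resp-≡ (*-thirds τ) (≺-* (hN n (ℕₚ.≤-trans (ℕₚ.m≤n⊔m M N) M⊔N≤n))
             (inverse-bound (hM n (ℕₚ.≤-trans (ℕₚ.m≤m⊔n M N) M⊔N≤n)) (w-inverse n))))
      where
      τ : ℚ
      τ = rate ℚ.* ½
      0<τ : 0ℚ ℚ.< τ
      0<τ = half-pos rate-pos
      x : Carrier
      x = - (b * q)
      y w : ℕ → Carrier
      -- Chosen so that 1 - `y n` is the product of the two new factors of the denominator.
      y n = (q + x) * q ^ n + - x * (q ^ suc n * q ^ n)
      w n = pochhammer q n * P b n * d (suc n)
      null-y : Null y
      null-y = Null-+ (Null-*ˡ (q + x) q^-null) (Null-*ˡ (- x) (Null-* (Null-suc q^-null) q^-null))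
      w-inverse : ∀ n → (1# - y n) * w n ≈ 1#
      w-inverse n = trans
        (solve 6 (λ q x z Q S d →
          (𝟙 :- ((q :+ x) :* z :+ :- x :* (q :* z :* z))) :* (Q :* S :* d)
          := Q :* (𝟙 :- q :* z) :* (S :* (𝟙 :- x :* z)) :* d)
          refl q x (q ^ n) (pochhammer q n) (P b n) (d (suc n)))
        (d-inverse (suc n))
      ratio : ∀ n → c (suc n) * d (suc n) ≈ c n * d n * (a * q ^ suc n * w n)
      ratio n = begin
        c (suc n) * d (suc n)
          ≈⟨ trans (*-congʳ (c-suc n)) (sym (*-identityʳ _)) ⟩
        c n * (a * q ^ suc n) * d (suc n) * 1#
          ≈⟨ *-congˡ (d-inverse n) ⟨
        c n * (a * q ^ suc n) * d (suc n) * (pochhammer q n * P b n * d n)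
          ≈⟨ solve 5 (λ c z d r e → c :* z :* d :* (r :* e) := c :* e :* (z :* (r :* d)))
               refl (c n) (a * q ^ suc n) (d (suc n)) (pochhammer q n * P b n) (d n) ⟩
        c n * d n * (a * q ^ suc n * w n) ∎

    pochhammer-inverse : ∀ x (v : ℕ → Carrier) → (∀ n → (1# - x * q ^ n) * v n ≈ 1#) →
                         ∀ n → pochhammer x n * ∏ n v ≈ 1#
    pochhammer-inverse x v h zero    = *-identityˡ 1#
    pochhammer-inverse x v h (suc n) = begin
      pochhammer x n * (1# - x * q ^ n) * (∏ n v * v n)
        ≈⟨ solve 4 (λ p z w v → p :* z :* (w :* v) := p :* w :* (z :* v)) refl (pochhammer x n) (1# - x * q ^ n) (∏ n v) (v n) ⟩
      pochhammer x n * ∏ n v * ((1# - x * q ^ n) * v n)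
        ≈⟨ *-cong (pochhammer-inverse x v h n) (h n) ⟩
      1# * 1#
        ≈⟨ *-identityˡ 1# ⟩
      1# ∎

    pochhammer-q-invertible : ∃[ u ] (∀ n → pochhammer q n * u n ≈ 1#)
    pochhammer-q-invertible = (λ n → ∏ n (λ j → proj₁ (v j))) , pochhammer-inverse q _ (λ n → proj₂ (v n))
      where
      v : ∀ n → ∃[ w ] (1# - q ^ suc n) * w ≈ 1#
      v n = 1-y-invertible (q^suc≺ρ n) ρ<1

    -- `e n` stands for n(n+1)/2; its recursion confines the division by 2 to one arithmetic lemma.
    module _ (e : ℕ → ℕ) (e-zero : e 0 ≡.≡ 0) (e-suc : ∀ n → e (suc n) ≡.≡ e n ℕ.+ suc n) where

      numerator : Carrier → ℕ → Carrier
      numerator a n = a ^ n * q ^ e n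

      numerator-zero : ∀ a → numerator a 0 ≈ 1#
      numerator-zero a rewrite e-zero = *-identityˡ 1#

      numerator-suc : ∀ a n → numerator a (suc n) ≈ numerator a n * (a * q ^ suc n)
      numerator-suc a n rewrite e-suc n = trans (*-congˡ (^-homo-* q (e n) (suc n)))
        (solve 4 (λ a x y z → a :* x :* (y :* z) := x :* y :* (a :* z)) refl a (a ^ n) (q ^ e n) (q ^ suc n))

      sum-converges : ∀ a b d → (∀ n → pochhammer q n * P b n * d n ≈ 1#) →
                      ∃[ S ] (λ N → ∑ N (λ n → numerator a n * d n)) ⇝ S
      sum-converges a b d d-inverse =
        let 0<τ     = half-pos rate-pos
            τ<1     = ℚₚ.<-trans (<-gap (rate ℚ.* ½) 0<τ (halves rate)) rate<1
            S , geo = series 0<τ τ<1 (λ n → refl) (term-geometric (numerator a) d (numerator-suc a) d-inverse)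
        in S , geometric-null 0<τ τ<1 geo

      product-converges : ∀ b → ∃[ L ] P b ⇝ L
      product-converges b =
        let L , geo = pochhammer-converges (- (b * q)) in L , geometric-null rate-pos rate<1 geo

      P*S-sym : ∀ {a b} dᵇ dᵃ {Pᵇ Sᵃ Pᵃ Sᵇ} →
                (∀ n → pochhammer q n * P b n * dᵇ n ≈ 1#) →
                (∀ n → pochhammer q n * P a n * dᵃ n ≈ 1#) →
                P b ⇝ Pᵇ → (λ N → ∑ N (λ n → numerator a n * dᵇ n)) ⇝ Sᵃ →
                P a ⇝ Pᵃ → (λ N → ∑ N (λ n → numerator b n * dᵃ n)) ⇝ Sᵇ →
                Pᵇ * Sᵃ ≈ Pᵃ * Sᵇ
      P*S-sym {a} {b} dᵇ dᵃ {Pᵇ} {Sᵃ} {Pᵃ} {Sᵇ} hᵇ hᵃ P⇝Pᵇ ∑⇝Sᵃ P⇝Pᵃ ∑⇝Sᵇ = begin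
        Pᵇ * Sᵃ            ≈⟨ cancel (Pᵇ * Sᵃ) ⟨
        Pᵇ * Sᵃ * U * Q    ≈⟨ *-congʳ (*-assoc Pᵇ Sᵃ U) ⟩
        Pᵇ * (Sᵃ * U) * Q  ≈⟨ *-congʳ (⇝-unique (limit a b dᵇ hᵇ P⇝Pᵇ ∑⇝Sᵃ)
                                (⇝-resp-≈ (λ N → *-congˡ (A-sym N b a)) (limit b a dᵃ hᵃ P⇝Pᵃ ∑⇝Sᵇ))) ⟩
        Pᵃ * (Sᵇ * U) * Q  ≈⟨ *-congʳ (*-assoc Pᵃ Sᵇ U) ⟨
        Pᵃ * Sᵇ * U * Q    ≈⟨ cancel (Pᵃ * Sᵇ) ⟩
        Pᵃ * Sᵇ            ∎
        where
        u : ℕ → Carrier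
        u = proj₁ pochhammer-q-invertible
        poch*u : ∀ n → pochhammer q n * u n ≈ 1#
        poch*u = proj₂ pochhammer-q-invertible
        U Q : Carrier
        U = proj₁ (u-converges u poch*u)
        Q = proj₁ (pochhammer-converges q)
        limit : ∀ a b d {P∞ S} → (∀ n → pochhammer q n * P b n * d n ≈ 1#) →
                P b ⇝ P∞ → (λ N → ∑ N (λ n → numerator a n * d n)) ⇝ S →
                (λ N → u N * A N a b) ⇝ P∞ * (S * U)
        limit a b d h P⇝ ∑⇝ = ⇝-resp-≈
          (conv-term u poch*u a (numerator a) (numerator-zero a) (numerator-suc a) b d h)
          (⇝-* P⇝ (conv-⇝ {u = u} rate-pos rate<1 (term-geometric (numerator a) d (numerator-suc a) h) ∑⇝
            (proj₂ (u-converges u poch*u))))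
        -- The product of (q;q)_n and its reciprocal is constantly 1, so the limits are inverse to
        -- each other and U can be cancelled.
        Q*U≈1 : Q * U ≈ 1#
        Q*U≈1 = ⇝-unique
          (⇝-* (geometric-null rate-pos rate<1 (proj₂ (pochhammer-converges q)))
               (geometric-null rate-pos rate<1 (proj₂ (u-converges u poch*u))))
          (⇝-resp-≈ (λ n → sym (poch*u n)) (⇝-const 1#))
        cancel : ∀ x → x * U * Q ≈ x
        cancel x = trans (*-assoc x U Q) (trans (*-congˡ (trans (*-comm U Q) Q*U≈1)) (*-identityʳ x))

    denominator-invertible : ∀ b → (∀ n → ∃[ v ] (1# + b * q ^ suc n) * v ≈ 1#) →
                             ∀ n → ∃[ w ] pochhammer q n * P b n * w ≈ 1#
    denominator-invertible b inverse n = u n * ∏ n v , (begin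
      pochhammer q n * P b n * (u n * ∏ n v)
        ≈⟨ solve 4 (λ p r u v → p :* r :* (u :* v) := (p :* u) :* (r :* v)) refl (pochhammer q n) (P b n) (u n) (∏ n v) ⟩
      pochhammer q n * u n * (P b n * ∏ n v)
        ≈⟨ *-cong (proj₂ pochhammer-q-invertible n) (pochhammer-inverse (- (b * q)) v v-inverse n) ⟩
      1# * 1#
        ≈⟨ *-identityˡ 1# ⟩
      1# ∎)
      where
      u v : ℕ → Carrier
      u = proj₁ pochhammer-q-invertible
      v k = proj₁ (inverse k)
      v-inverse : ∀ k → (1# - - (b * q) * q ^ k) * v k ≈ 1#
      v-inverse k = trans (*-congʳ
        (solve 3 (λ b q x → 𝟙 :- :- (b :* q) :* x := 𝟙 :+ b :* (q :* x)) refl b q (q ^ k))) (proj₂ (inverse k))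

-- The modulus of Gaussian rationals, without square roots.

module RationalDisks where
  open import Data.Rational.Base
  open ℚₚ
  open ≡
  open +-*-Solver
  open RationalPowers
  open Rational using (*-nn)

  square-nonneg : ∀ p → 0ℚ ≤ p * p
  square-nonneg p with ≤-total 0ℚ p
  ... | inj₁ 0≤p = *-nn 0≤p 0≤p
  ... | inj₂ p≤0 = subst (0ℚ ≤_) (solve 1 (λ p → (:- p) :* (:- p) := p :* p) refl p)
                     (*-nn (neg-antimono-≤ p≤0) (neg-antimono-≤ p≤0))

  square-cancel-< : ∀ {p q} → 0ℚ ≤ q → p * p < q * q → p < q
  square-cancel-< {p} {q} 0≤q h with p <? q
  ... | yes p<q = p<q
  ... | no  p≮q = ⊥-elim (<-irrefl refl (<-≤-trans h
        (Rational.*-mono-≤ 0≤q (≤-trans 0≤q (≮⇒≥ p≮q)) (≮⇒≥ p≮q) (≮⇒≥ p≮q))))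

  square-cancel-≤ : ∀ {p q} → 0ℚ ≤ q → p * p ≤ q * q → p ≤ q
  square-cancel-≤ {p} {q} 0≤q h with p ≤? q
  ... | yes p≤q = p≤q
  ... | no  p≰q = ⊥-elim (<-irrefl refl (≤-<-trans h
        (≤-<-trans (*-monoˡ-≤-nonNeg q {{nonNegative 0≤q}} (<⇒≤ (≰⇒> p≰q)))
          (*-monoˡ-<-pos p {{positive (≤-<-trans 0≤q (≰⇒> p≰q))}} (≰⇒> p≰q)))))

  ∣p∣²≡p² : ∀ p → ∣ p ∣ * ∣ p ∣ ≡ p * p
  ∣p∣²≡p² p = trans (sym (∣p*q∣≡∣p∣*∣q∣ p p)) (0≤p⇒∣p∣≡p (square-nonneg p))

  record Disk (x y r : ℚ) : Set where
    constructor disk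
    field
      radius-nonneg : 0ℚ ≤ r
      norm≤         : x * x + y * y ≤ r * r
  open Disk public

  -- Lagrange's identity: (xu + yv)² + (xv - yu)² = (x² + y²)(u² + v²).
  cauchy-schwarz : ∀ {x y u v r s} → Disk x y r → Disk u v s → x * u + y * v ≤ r * s
  cauchy-schwarz {x} {y} {u} {v} {r} {s} (disk 0≤r h) (disk 0≤s h′) = square-cancel-≤ (*-nn 0≤r 0≤s)
    (≤-trans
      (≤-gap ((x * v - y * u) * (x * v - y * u)) (square-nonneg (x * v - y * u))
        (solve 4 (λ x y u v → (x :* u :+ y :* v) :* (x :* u :+ y :* v) :+ (x :* v :- y :* u) :* (x :* v :- y :* u)
          := (x :* x :+ y :* y) :* (u :* u :+ v :* v)) refl x y u v))
      (subst ((x * x + y * y) * (u * u + v * v) ≤_)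
        (solve 2 (λ r s → (r :* r) :* (s :* s) := (r :* s) :* (r :* s)) refl r s)
        (Rational.*-mono-≤ (+-mono-≤ (square-nonneg x) (square-nonneg y)) (square-nonneg s) h h′)))

  disk-+ : ∀ {x y u v r s} → Disk x y r → Disk u v s → Disk (x + u) (y + v) (r + s)
  disk-+ {x} {y} {u} {v} {r} {s} d@(disk 0≤r h) d′@(disk 0≤s h′) = disk (+-mono-≤ 0≤r 0≤s)
    (≤-gap ((a + a) + (r * r - (x * x + y * y)) + (s * s - (u * u + v * v)))
      (+-mono-≤ (+-mono-≤ (+-mono-≤ 0≤a 0≤a) (0≤q-p h)) (0≤q-p h′))
      (solve 6 (λ x y u v r s → let a = r :* s :- (x :* u :+ y :* v) in
        (x :+ u) :* (x :+ u) :+ (y :+ v) :* (y :+ v)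
          :+ ((a :+ a) :+ (r :* r :- (x :* x :+ y :* y)) :+ (s :* s :- (u :* u :+ v :* v)))
        := (r :+ s) :* (r :+ s)) refl x y u v r s))
    where
    a : ℚ
    a = r * s - (x * u + y * v)
    0≤a : 0ℚ ≤ a
    0≤a = 0≤q-p (cauchy-schwarz d d′)

  -- The two-squares identity: the norm of a product is the product of the norms.
  disk-* : ∀ {x y u v r s} → Disk x y r → Disk u v s → Disk (x * u + - (y * v)) (x * v + y * u) (r * s)
  disk-* {x} {y} {u} {v} {r} {s} (disk 0≤r h) (disk 0≤s h′) = disk (*-nn 0≤r 0≤s)
    (subst₂ _≤_
      (solve 4 (λ x y u v → (x :* x :+ y :* y) :* (u :* u :+ v :* v)
        := (x :* u :+ :- (y :* v)) :* (x :* u :+ :- (y :* v)) :+ (x :* v :+ y :* u) :* (x :* v :+ y :* u)) refl x y u v)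
      (solve 2 (λ r s → (r :* r) :* (s :* s) := (r :* s) :* (r :* s)) refl r s)
      (Rational.*-mono-≤ (+-mono-≤ (square-nonneg x) (square-nonneg y)) (square-nonneg s) h h′))

  disk-neg : ∀ {x y r} → Disk x y r → Disk (- x) (- y) r
  disk-neg {x} {y} {r} (disk 0≤r h) = disk 0≤r (subst (_≤ r * r)
    (solve 2 (λ x y → x :* x :+ y :* y := (:- x) :* (:- x) :+ (:- y) :* (:- y)) refl x y) h)

  disk-mono : ∀ {x y r s} → r ≤ s → Disk x y r → Disk x y s
  disk-mono r≤s (disk 0≤r h) = disk (≤-trans 0≤r r≤s)
    (≤-trans h (Rational.*-mono-≤ 0≤r (≤-trans 0≤r r≤s) r≤s r≤s))

  disk⇒∣x∣≤ : ∀ {x y r} → Disk x y r → ∣ x ∣ ≤ r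
  disk⇒∣x∣≤ {x} {y} {r} (disk 0≤r h) = square-cancel-≤ 0≤r (subst (_≤ r * r) (sym (∣p∣²≡p² x))
    (≤-trans (≤-gap (y * y) (square-nonneg y) refl) h))

  disk⇒∣y∣≤ : ∀ {x y r} → Disk x y r → ∣ y ∣ ≤ r
  disk⇒∣y∣≤ {x} {y} {r} (disk 0≤r h) = square-cancel-≤ 0≤r (subst (_≤ r * r) (sym (∣p∣²≡p² y))
    (≤-trans (≤-gap (x * x) (square-nonneg x) (+-comm (y * y) (x * x))) h))

  square-≤ : ∀ {x r} → ∣ x ∣ ≤ r → x * x ≤ r * r
  square-≤ {x} {r} h = subst (_≤ r * r) (∣p∣²≡p² x)
    (Rational.*-mono-≤ (0≤∣p∣ x) (≤-trans (0≤∣p∣ x) h) h h)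

  -- r + s in place of the square root of r² + s² keeps the radius rational.
  box⇒disk : ∀ {x y r s} → ∣ x ∣ ≤ r → ∣ y ∣ ≤ s → Disk x y (r + s)
  box⇒disk {x} {y} {r} {s} hx hy = disk (+-mono-≤ 0≤r 0≤s)
    (≤-trans (+-mono-≤ (square-≤ {x} hx) (square-≤ {y} hy))
      (≤-gap (r * s + r * s) (+-mono-≤ (*-nn 0≤r 0≤s) (*-nn 0≤r 0≤s))
        (solve 2 (λ r s → r :* r :+ s :* s :+ (r :* s :+ r :* s) := (r :+ s) :* (r :+ s)) refl r s)))
    where
    0≤r : 0ℚ ≤ r
    0≤r = ≤-trans (0≤∣p∣ x) hx
    0≤s : 0ℚ ≤ s
    0≤s = ≤-trans (0≤∣p∣ y) hy

-- Congruence of the real operations.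

module RealRing where
  open import Data.Rational.Base using (_<_; _+_; _*_; _-_; -_; ∣_∣)
  open ≡
  open +-*-Solver
  open Rational using (half-pos; sum-bound; abs-sym; *-pos; inv-pos)

  -- `x ≃ᴿ y` unfolds to this property of the termwise difference, so closure properties of null
  -- sequences prove the congruences directly.
  Nullℚ : (ℕ → ℚ) → Set
  Nullℚ f = ∀ ε → 0ℚ < ε → ∃[ N ] ∀ n → N ℕ.≤ n → ∣ f n ∣ < ε

  null-cong : ∀ {f g} → (∀ n → f n ≡ g n) → Nullℚ f → Nullℚ g
  null-cong f≗g hf ε 0<ε = let N , h = hf ε 0<ε in
    N , λ n N≤n → subst (λ p → ∣ p ∣ < ε) (f≗g n) (h n N≤n)

  null-+ : ∀ {f g} → Nullℚ f → Nullℚ g → Nullℚ (λ n → f n + g n)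
  null-+ {f} {g} hf hg ε 0<ε =
    let M , hM = hf (ε * ½) (half-pos 0<ε)
        N , hN = hg (ε * ½) (half-pos 0<ε)
    in M ℕ.⊔ N , λ n M⊔N≤n → sum-bound (f n) (g n)
         (hM n (ℕₚ.≤-trans (ℕₚ.m≤m⊔n M N) M⊔N≤n)) (hN n (ℕₚ.≤-trans (ℕₚ.m≤n⊔m M N) M⊔N≤n))

  null-neg : ∀ {f} → Nullℚ f → Nullℚ (λ n → - f n)
  null-neg {f} hf ε 0<ε = let N , h = hf ε 0<ε in
    N , λ n N≤n → subst (_< ε) (sym (ℚₚ.∣-p∣≡∣p∣ (f n))) (h n N≤n)

  null-*ˡ : ∀ (x : ℝ) {f} → Nullℚ f → Nullℚ (λ n → seq x n * f n)
  null-*ˡ x {f} hf ε 0<ε =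
    let B , 0<B , M , hM = RealCauchy.bounded (seq x) (isCauchy x)
        N , hN           = hf (ε * inv B) (*-pos 0<ε (inv-pos 0<B))
    in M ℕ.⊔ N , λ n M⊔N≤n → RealCauchy.prod-bound (seq x n) (f n) 0<B
         (hM n (ℕₚ.≤-trans (ℕₚ.m≤m⊔n M N) M⊔N≤n)) (hN n (ℕₚ.≤-trans (ℕₚ.m≤n⊔m M N) M⊔N≤n))

  pointwise : ∀ (s t : ℕ → ℚ) → (∀ n → s n ≡ t n) → Nullℚ (λ n → s n - t n)
  pointwise s t s≗t ε 0<ε = 0 , λ n _ → subst (_< ε)
    (cong ∣_∣ (sym (trans (cong (_- t n) (s≗t n)) (ℚₚ.+-inverseʳ (t n))))) 0<ε

  ≃ᴿ-sym : ∀ x y → x ≃ᴿ y → y ≃ᴿ x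
  ≃ᴿ-sym x y h ε 0<ε = let N , hN = h ε 0<ε in
    N , λ n N≤n → subst (_< ε) (abs-sym (seq x n) (seq y n)) (hN n N≤n)

  ≃ᴿ-trans : ∀ x y z → x ≃ᴿ y → y ≃ᴿ z → x ≃ᴿ z
  ≃ᴿ-trans x y z x≃y y≃z = null-cong
    (λ n → solve 3 (λ x y z → (x :- y) :+ (y :- z) := x :- z) refl (seq x n) (seq y n) (seq z n))
    (null-+ x≃y y≃z)

  +ᴿ-cong : ∀ x y u v → x ≃ᴿ y → u ≃ᴿ v → x +ᴿ u ≃ᴿ y +ᴿ v
  +ᴿ-cong x y u v x≃y u≃v = null-cong
    (λ n → solve 4 (λ x y u v → (x :- y) :+ (u :- v) := (x :+ u) :- (y :+ v)) refl (seq x n) (seq y n) (seq u n) (seq v n))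
    (null-+ x≃y u≃v)

  -ᴿ-cong : ∀ x y → x ≃ᴿ y → -ᴿ x ≃ᴿ -ᴿ y
  -ᴿ-cong x y x≃y = null-cong
    (λ n → solve 2 (λ x y → :- (x :- y) := (:- x) :- (:- y)) refl (seq x n) (seq y n)) (null-neg x≃y)

  *ᴿ-cong : ∀ x y u v → x ≃ᴿ y → u ≃ᴿ v → x *ᴿ u ≃ᴿ y *ᴿ v
  *ᴿ-cong x y u v x≃y u≃v = null-cong
    (λ n → solve 4 (λ x y u v → x :* (u :- v) :+ v :* (x :- y) := (x :* u) :- (y :* v)) refl (seq x n) (seq y n) (seq u n) (seq v n))
    (null-+ (null-*ˡ x u≃v) (null-*ˡ v x≃y))

  pointwise-≃ : ∀ (z w : ℂ) → (∀ n → seq (re z) n ≡ seq (re w) n) → (∀ n → seq (im z) n ≡ seq (im w) n) → z ≃ w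
  pointwise-≃ z w hr hi = pointwise (seq (re z)) (seq (re w)) hr , pointwise (seq (im z)) (seq (im w)) hi

open RealRing using (pointwise-≃; ≃ᴿ-sym; ≃ᴿ-trans; +ᴿ-cong; -ᴿ-cong; *ᴿ-cong)

-- Opaque copies of the operations of ℂ, so that conversion checking never
-- descends into the Cauchy proofs carried by real numbers.

infixl 6 _⊕_
infixl 7 _⊗_
infix  8 ⊝_

opaque
  𝟘 𝟏 : ℂ
  𝟘 = 0ℂ
  𝟏 = 1ℂ

  ⊝_ : ℂ → ℂ
  ⊝_ = Defs.-_

  _⊕_ _⊗_ : ℂ → ℂ → ℂ
  _⊕_ = Defs._+_
  _⊗_ = Defs._*_

opaque
  unfolding 𝟘 𝟏 ⊝_ _⊕_ _⊗_

  𝟘-def : 𝟘 ≡ 0ℂ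
  𝟘-def = ≡.refl

  𝟏-def : 𝟏 ≡ 1ℂ
  𝟏-def = ≡.refl

  ⊝-def : ∀ x → ⊝ x ≡ Defs.- x
  ⊝-def x = ≡.refl

  ⊕-def : ∀ x y → x ⊕ y ≡ x Defs.+ y
  ⊕-def x y = ≡.refl

  ⊗-def : ∀ x y → x ⊗ y ≡ x Defs.* y
  ⊗-def x y = ≡.refl

-- The commutative ring of complex numbers, with its laws checked termwise.

module ComplexRing where
  open ≡ using (refl)
  open +-*-Solver

  opaque
    unfolding 𝟘 𝟏 ⊝_ _⊕_ _⊗_

    ⊕-cong : ∀ {x y u v} → x ≃ y → u ≃ v → x ⊕ u ≃ y ⊕ v
    ⊕-cong {x} {y} {u} {v} (h , h′) (k , k′) =
      +ᴿ-cong (re x) (re y) (re u) (re v) h k , +ᴿ-cong (im x) (im y) (im u) (im v) h′ k′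

    ⊝-cong : ∀ {x y} → x ≃ y → ⊝ x ≃ ⊝ y
    ⊝-cong {x} {y} (h , h′) = -ᴿ-cong (re x) (re y) h , -ᴿ-cong (im x) (im y) h′

    ⊗-cong : ∀ {x y u v} → x ≃ y → u ≃ v → x ⊗ u ≃ y ⊗ v
    ⊗-cong {x} {y} {u} {v} (h , h′) (k , k′) =
        +ᴿ-cong (re x *ᴿ re u) (re y *ᴿ re v) (-ᴿ (im x *ᴿ im u)) (-ᴿ (im y *ᴿ im v))
          (*ᴿ-cong (re x) (re y) (re u) (re v) h k)
          (-ᴿ-cong (im x *ᴿ im u) (im y *ᴿ im v) (*ᴿ-cong (im x) (im y) (im u) (im v) h′ k′))
      , +ᴿ-cong (re x *ᴿ im u) (re y *ᴿ im v) (im x *ᴿ re u) (im y *ᴿ re v)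
          (*ᴿ-cong (re x) (re y) (im u) (im v) h k′)
          (*ᴿ-cong (im x) (im y) (re u) (re v) h′ k)

    ⊕-assoc : ∀ x y z → (x ⊕ y) ⊕ z ≃ x ⊕ (y ⊕ z)
    ⊕-assoc x y z = pointwise-≃ ((x ⊕ y) ⊕ z) (x ⊕ (y ⊕ z))
      (λ n → ℚₚ.+-assoc (seq (re x) n) (seq (re y) n) (seq (re z) n))
      (λ n → ℚₚ.+-assoc (seq (im x) n) (seq (im y) n) (seq (im z) n))

    ⊕-identityˡ : ∀ x → 𝟘 ⊕ x ≃ x
    ⊕-identityˡ x = pointwise-≃ (𝟘 ⊕ x) x (λ n → ℚₚ.+-identityˡ _) (λ n → ℚₚ.+-identityˡ _)

    ⊕-identityʳ : ∀ x → x ⊕ 𝟘 ≃ x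
    ⊕-identityʳ x = pointwise-≃ (x ⊕ 𝟘) x (λ n → ℚₚ.+-identityʳ _) (λ n → ℚₚ.+-identityʳ _)

    ⊕-inverseˡ : ∀ x → ⊝ x ⊕ x ≃ 𝟘
    ⊕-inverseˡ x = pointwise-≃ (⊝ x ⊕ x) 𝟘
      (λ n → ℚₚ.+-inverseˡ (seq (re x) n)) (λ n → ℚₚ.+-inverseˡ (seq (im x) n))

    ⊕-inverseʳ : ∀ x → x ⊕ ⊝ x ≃ 𝟘
    ⊕-inverseʳ x = pointwise-≃ (x ⊕ ⊝ x) 𝟘
      (λ n → ℚₚ.+-inverseʳ (seq (re x) n)) (λ n → ℚₚ.+-inverseʳ (seq (im x) n))

    ⊕-comm : ∀ x y → x ⊕ y ≃ y ⊕ x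
    ⊕-comm x y = pointwise-≃ (x ⊕ y) (y ⊕ x)
      (λ n → ℚₚ.+-comm (seq (re x) n) (seq (re y) n)) (λ n → ℚₚ.+-comm (seq (im x) n) (seq (im y) n))

    ⊗-assoc : ∀ x y z → (x ⊗ y) ⊗ z ≃ x ⊗ (y ⊗ z)
    ⊗-assoc x y z = pointwise-≃ ((x ⊗ y) ⊗ z) (x ⊗ (y ⊗ z))
      (λ n → solve 6 (λ a b c d e f →
         (a :* c :+ :- (b :* d)) :* e :+ :- ((a :* d :+ b :* c) :* f)
         := a :* (c :* e :+ :- (d :* f)) :+ :- (b :* (c :* f :+ d :* e))) refl
         (seq (re x) n) (seq (im x) n) (seq (re y) n) (seq (im y) n) (seq (re z) n) (seq (im z) n))
      (λ n → solve 6 (λ a b c d e f →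
         (a :* c :+ :- (b :* d)) :* f :+ (a :* d :+ b :* c) :* e
         := a :* (c :* f :+ d :* e) :+ b :* (c :* e :+ :- (d :* f))) refl
         (seq (re x) n) (seq (im x) n) (seq (re y) n) (seq (im y) n) (seq (re z) n) (seq (im z) n))

    ⊗-identityˡ : ∀ x → 𝟏 ⊗ x ≃ x
    ⊗-identityˡ x = pointwise-≃ (𝟏 ⊗ x) x
      (λ n → solve 2 (λ a b → con 1ℚ :* a :+ :- (con 0ℚ :* b) := a) refl (seq (re x) n) (seq (im x) n))
      (λ n → solve 2 (λ a b → con 1ℚ :* b :+ con 0ℚ :* a := b) refl (seq (re x) n) (seq (im x) n))

    ⊗-identityʳ : ∀ x → x ⊗ 𝟏 ≃ x
    ⊗-identityʳ x = pointwise-≃ (x ⊗ 𝟏) x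
      (λ n → solve 2 (λ a b → a :* con 1ℚ :+ :- (b :* con 0ℚ) := a) refl (seq (re x) n) (seq (im x) n))
      (λ n → solve 2 (λ a b → a :* con 0ℚ :+ b :* con 1ℚ := b) refl (seq (re x) n) (seq (im x) n))

    ⊗-distribˡ-⊕ : ∀ x y z → x ⊗ (y ⊕ z) ≃ x ⊗ y ⊕ x ⊗ z
    ⊗-distribˡ-⊕ x y z = pointwise-≃ (x ⊗ (y ⊕ z)) (x ⊗ y ⊕ x ⊗ z)
      (λ n → solve 6 (λ a b c d e f →
         a :* (c :+ e) :+ :- (b :* (d :+ f)) := (a :* c :+ :- (b :* d)) :+ (a :* e :+ :- (b :* f))) refl
         (seq (re x) n) (seq (im x) n) (seq (re y) n) (seq (im y) n) (seq (re z) n) (seq (im z) n))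
      (λ n → solve 6 (λ a b c d e f →
         a :* (d :+ f) :+ b :* (c :+ e) := (a :* d :+ b :* c) :+ (a :* f :+ b :* e)) refl
         (seq (re x) n) (seq (im x) n) (seq (re y) n) (seq (im y) n) (seq (re z) n) (seq (im z) n))

    ⊗-distribʳ-⊕ : ∀ x y z → (y ⊕ z) ⊗ x ≃ y ⊗ x ⊕ z ⊗ x
    ⊗-distribʳ-⊕ x y z = pointwise-≃ ((y ⊕ z) ⊗ x) (y ⊗ x ⊕ z ⊗ x)
      (λ n → solve 6 (λ a b c d e f →
         (c :+ e) :* a :+ :- ((d :+ f) :* b) := (c :* a :+ :- (d :* b)) :+ (e :* a :+ :- (f :* b))) refl
         (seq (re x) n) (seq (im x) n) (seq (re y) n) (seq (im y) n) (seq (re z) n) (seq (im z) n))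
      (λ n → solve 6 (λ a b c d e f →
         (c :+ e) :* b :+ (d :+ f) :* a := (c :* b :+ d :* a) :+ (e :* b :+ f :* a)) refl
         (seq (re x) n) (seq (im x) n) (seq (re y) n) (seq (im y) n) (seq (re z) n) (seq (im z) n))

    ⊗-comm : ∀ x y → x ⊗ y ≃ y ⊗ x
    ⊗-comm x y = pointwise-≃ (x ⊗ y) (y ⊗ x)
      (λ n → solve 4 (λ a b c d → a :* c :+ :- (b :* d) := c :* a :+ :- (d :* b)) refl
        (seq (re x) n) (seq (im x) n) (seq (re y) n) (seq (im y) n))
      (λ n → solve 4 (λ a b c d → a :* d :+ b :* c := c :* b :+ d :* a) refl
        (seq (re x) n) (seq (im x) n) (seq (re y) n) (seq (im y) n))

ℂ-commutativeRing : CommutativeRing 0ℓ 0ℓ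
ℂ-commutativeRing = record
  { Carrier = ℂ
  ; _≈_ = _≃_
  ; _+_ = _⊕_
  ; _*_ = _⊗_
  ; -_  = ⊝_
  ; 0#  = 𝟘
  ; 1#  = 𝟏
  ; isCommutativeRing = record
    { isRing = record
      { +-isAbelianGroup = record
        { isGroup = record
          { isMonoid = record
            { isSemigroup = record
              { isMagma = record
                { isEquivalence = record
                  { refl  = λ {z} → pointwise-≃ z z (λ _ → ≡.refl) (λ _ → ≡.refl)
                  ; sym   = λ {x} {y} (h , h′) → ≃ᴿ-sym (re x) (re y) h , ≃ᴿ-sym (im x) (im y) h′
                  ; trans = λ {x} {y} {z} (h , h′) (k , k′) →
                      ≃ᴿ-trans (re x) (re y) (re z) h k , ≃ᴿ-trans (im x) (im y) (im z) h′ k′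
                  }
                ; ∙-cong = λ {x} {y} {u} {v} → ⊕-cong {x} {y} {u} {v}
                }
              ; assoc = ⊕-assoc
              }
            ; identity = ⊕-identityˡ , ⊕-identityʳ
            }
          ; inverse = ⊕-inverseˡ , ⊕-inverseʳ
          ; ⁻¹-cong = λ {x} {y} → ⊝-cong {x} {y}
          }
        ; comm = ⊕-comm
        }
      ; *-cong = λ {x} {y} {u} {v} → ⊗-cong {x} {y} {u} {v}
      ; *-assoc = ⊗-assoc
      ; *-identity = ⊗-identityˡ , ⊗-identityʳ
      ; distrib = ⊗-distribˡ-⊕ , ⊗-distribʳ-⊕
      }
    ; *-comm = ⊗-comm
    }
  }
  where open ComplexRing

-- Completeness of the reals by a diagonal sequence.

module RealCompleteness where
  open import Data.Rational.Base using (_<_; _+_; _-_; ∣_∣)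
  open ≡
  open +-*-Solver
  open RationalPowers
  open Rational using (abs-sym; archimedean; grid-step-pos)

  triangle : ∀ p q r {ε δ} → ∣ p - q ∣ < ε → ∣ q - r ∣ < δ → ∣ p - r ∣ < ε + δ
  triangle p q r {ε} {δ} h h′ = subst (λ x → ∣ x ∣ < ε + δ)
    (solve 3 (λ p q r → (p :- q) :+ (q :- r) := p :- r) refl p q r)
    (ℚₚ.≤-<-trans (ℚₚ.∣p+q∣≤∣p∣+∣q∣ (p - q) (q - r)) (ℚₚ.+-mono-< h h′))

  abs-sym-< : ∀ p q {ε} → ∣ p - q ∣ < ε → ∣ q - p ∣ < ε
  abs-sym-< p q {ε} = subst (_< ε) (abs-sym p q)

  module _ (x : ℕ → ℝ) (β : ℕ → ℚ)
           (β-null : ∀ ε → 0ℚ < ε → ∃[ N ] ∀ n → N ℕ.≤ n → β n < ε)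
           (x-cauchy : ∀ j n → ∃[ N ] ∀ i → N ℕ.≤ i → ∣ seq (x (j ℕ.+ n)) i - seq (x n) i ∣ < β n) where

    -- From this position on, `x k` varies by less than 1/(k+1), so one rational from there can
    -- represent it on the diagonal.
    modulus : ℕ → ℕ
    modulus k = proj₁ (isCauchy (x k) (grid k 1) (grid-step-pos k))

    diagonal : ℕ → ℚ
    diagonal k = seq (x k) (modulus k)

    diagonal-near : ∀ k i → modulus k ℕ.≤ i → ∣ diagonal k - seq (x k) i ∣ < grid k 1
    diagonal-near k i h = proj₂ (isCauchy (x k) (grid k 1) (grid-step-pos k)) (modulus k) i ℕₚ.≤-refl h

    threshold : ∀ e → 0ℚ < e → ∃[ K ] ∀ k → K ℕ.≤ k → grid k 1 < e × β k < e
    threshold e 0<e =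
      let M , hM = archimedean 0<e
          N , hN = β-null e 0<e
      in M ℕ.⊔ N , λ k M⊔N≤k →
           hM k (ℕₚ.≤-trans (ℕₚ.m≤m⊔n M N) M⊔N≤k) , hN k (ℕₚ.≤-trans (ℕₚ.m≤n⊔m M N) M⊔N≤k)

    x-cauchy′ : ∀ k n → k ℕ.≤ n → ∃[ N ] ∀ i → N ℕ.≤ i → ∣ seq (x n) i - seq (x k) i ∣ < β k
    x-cauchy′ k n k≤n = subst (λ m → ∃[ N ] ∀ i → N ℕ.≤ i → ∣ seq (x m) i - seq (x k) i ∣ < β k)
      (ℕₚ.m∸n+n≡m k≤n) (x-cauchy (n ℕ.∸ k) k)

    diagonal-cauchy : IsCauchy diagonal
    diagonal-cauchy ε 0<ε = K , λ m n K≤m K≤n → ℚₚ.<-≤-trans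
      (triangle (diagonal m) (diagonal K) (diagonal n) (near m K≤m) (abs-sym-< (diagonal n) (diagonal K) (near n K≤n)))
      (6*eighth≤ 0<ε)
      where
      e : ℚ
      e = eighth ε
      K : ℕ
      K = proj₁ (threshold e (eighth-pos 0<ε))
      small : ∀ k → K ℕ.≤ k → grid k 1 < e × β k < e
      small = proj₂ (threshold e (eighth-pos 0<ε))
      -- Everything is compared with the single index `K`, because `β K` bounds all later
      -- differences from `x K`. The comparison is made at a position behind both moduli.
      near : ∀ m → K ℕ.≤ m → ∣ diagonal m - diagonal K ∣ < e + e + e
      near m K≤m =
        let N , h = x-cauchy′ K m K≤m
            i     = modulus m ℕ.⊔ modulus K ℕ.⊔ N
            m≤i   = ℕₚ.≤-trans (ℕₚ.m≤m⊔n (modulus m) (modulus K)) (ℕₚ.m≤m⊔n (modulus m ℕ.⊔ modulus K) N)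
            K≤i   = ℕₚ.≤-trans (ℕₚ.m≤n⊔m (modulus m) (modulus K)) (ℕₚ.m≤m⊔n (modulus m ℕ.⊔ modulus K) N)
            N≤i   = ℕₚ.m≤n⊔m (modulus m ℕ.⊔ modulus K) N
        in triangle (diagonal m) (seq (x K) i) (diagonal K)
             (triangle (diagonal m) (seq (x m) i) (seq (x K) i)
               (ℚₚ.<-trans (diagonal-near m i m≤i) (proj₁ (small m K≤m)))
               (ℚₚ.<-trans (h i N≤i) (proj₂ (small K ℕₚ.≤-refl))))
             (abs-sym-< (diagonal K) (seq (x K) i)
               (ℚₚ.<-trans (diagonal-near K i K≤i) (proj₁ (small K ℕₚ.≤-refl))))

    limit : ℝ
    limit = mkℝ diagonal diagonal-cauchy

    -- At position i the limit holds a value of `x i`, not of `x k`. The two sequences are therefore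
    -- compared at a later position `l`, behind `modulus i`, where they differ by less than `β k`.
    limit-converges : ∀ ε → 0ℚ < ε → ∃[ K ] ∀ k → K ℕ.≤ k →
                      ∃[ N ] ∀ i → N ℕ.≤ i → ∣ seq (x k) i - diagonal i ∣ < ε
    limit-converges ε 0<ε =
      let e         = eighth ε
          0<e       = eighth-pos 0<ε
          K , small = threshold e 0<e
      in K , λ k K≤k →
        let M , hM = isCauchy (x k) e 0<e
        in k ℕ.⊔ M , λ i k⊔M≤i →
          let k≤i   = ℕₚ.≤-trans (ℕₚ.m≤m⊔n k M) k⊔M≤i
              M≤i   = ℕₚ.≤-trans (ℕₚ.m≤n⊔m k M) k⊔M≤i
              N , h = x-cauchy′ k i k≤i
              l     = modulus i ℕ.⊔ M ℕ.⊔ N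
              i≤l   = ℕₚ.≤-trans (ℕₚ.m≤m⊔n (modulus i) M) (ℕₚ.m≤m⊔n (modulus i ℕ.⊔ M) N)
              M≤l   = ℕₚ.≤-trans (ℕₚ.m≤n⊔m (modulus i) M) (ℕₚ.m≤m⊔n (modulus i ℕ.⊔ M) N)
              N≤l   = ℕₚ.m≤n⊔m (modulus i ℕ.⊔ M) N
          in ℚₚ.<-≤-trans
               (triangle (seq (x k) i) (seq (x i) l) (diagonal i)
                 (triangle (seq (x k) i) (seq (x k) l) (seq (x i) l)
                   (hM i l M≤i M≤l)
                   (abs-sym-< (seq (x i) l) (seq (x k) l) (ℚₚ.<-trans (h l N≤l) (proj₂ (small k K≤k)))))
                 (abs-sym-< (diagonal i) (seq (x i) l)
                   (ℚₚ.<-trans (diagonal-near i l i≤l) (proj₁ (small i (ℕₚ.≤-trans K≤k k≤i))))))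
               (3*eighth≤ 0<ε)

-- Rational bounds on the complex modulus, and completeness of ℂ.

module ComplexNorm where
  open RationalDisks
  open RationalPowers
  open +-*-Solver

  infix 4 _≺_
  -- The bound holds eventually and with a radius strictly below `r`. The gap makes the relation
  -- respect `_≃_`, and the disk avoids the approximate square root.
  record _≺_ (z : ℂ) (r : ℚ) : Set where
    constructor bound
    field
      radius     : ℚ
      radius<    : radius ℚ.< r
      start      : ℕ
      eventually : ∀ n → start ℕ.≤ n → Disk (seq (re z) n) (seq (im z) n) radius
  open _≺_ public

  ≺-nonneg-radius : ∀ {z r} (h : z ≺ r) → 0ℚ ℚ.≤ radius h
  ≺-nonneg-radius h = radius-nonneg (eventually h (start h) ℕₚ.≤-refl)

  ≺-pos : ∀ {z r} → z ≺ r → 0ℚ ℚ.< r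
  ≺-pos h = ℚₚ.≤-<-trans (≺-nonneg-radius h) (radius< h)

  ≺-mono : ∀ {z r s} → z ≺ r → r ℚ.≤ s → z ≺ s
  ≺-mono (bound r′ r′<r N h) r≤s = bound r′ (ℚₚ.<-≤-trans r′<r r≤s) N h

  opaque
    unfolding 𝟘 𝟏 ⊝_ _⊕_ _⊗_

    ≺-neg : ∀ {z r} → z ≺ r → ⊝ z ≺ r
    ≺-neg (bound r′ r′<r N h) = bound r′ r′<r N (λ n N≤n → disk-neg (h n N≤n))

  opaque
    unfolding 𝟘 𝟏 ⊝_ _⊕_ _⊗_

    ≺-+ : ∀ {z w r s} → z ≺ r → w ≺ s → z ⊕ w ≺ r ℚ.+ s
    ≺-+ (bound r′ r′<r M hM) (bound s′ s′<s N hN) =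
      bound (r′ ℚ.+ s′) (ℚₚ.+-mono-< r′<r s′<s) (M ℕ.⊔ N) (λ n M⊔N≤n →
        disk-+ (hM n (ℕₚ.≤-trans (ℕₚ.m≤m⊔n M N) M⊔N≤n)) (hN n (ℕₚ.≤-trans (ℕₚ.m≤n⊔m M N) M⊔N≤n)))

  opaque
    unfolding 𝟘 𝟏 ⊝_ _⊕_ _⊗_

    ≺-* : ∀ {z w r s} → z ≺ r → w ≺ s → z ⊗ w ≺ r ℚ.* s
    ≺-* {r = r} {s} z≺r@(bound r′ r′<r M hM) w≺s@(bound s′ s′<s N hN) =
      bound (r′ ℚ.* s′)
        (ℚₚ.≤-<-trans (ℚₚ.*-monoˡ-≤-nonNeg r′ {{ℚ.nonNegative (≺-nonneg-radius z≺r)}} (ℚₚ.<⇒≤ s′<s))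
          (ℚₚ.*-monoˡ-<-pos s {{ℚ.positive (≺-pos w≺s)}} r′<r))
        (M ℕ.⊔ N) (λ n M⊔N≤n →
          disk-* (hM n (ℕₚ.≤-trans (ℕₚ.m≤m⊔n M N) M⊔N≤n)) (hN n (ℕₚ.≤-trans (ℕₚ.m≤n⊔m M N) M⊔N≤n)))

  opaque
    unfolding 𝟘 𝟏 ⊝_ _⊕_ _⊗_

    ≃⇒≺ : ∀ z w → z ≃ w → ∀ {ε} → 0ℚ ℚ.< ε → z ⊕ ⊝ w ≺ ε
    ≃⇒≺ z w (h , h′) {ε} 0<ε =
      let M , hM = h (eighth ε) (eighth-pos 0<ε)
          N , hN = h′ (eighth ε) (eighth-pos 0<ε)
      in bound (eighth ε ℚ.+ eighth ε) (2*eighth< 0<ε) (M ℕ.⊔ N) (λ n M⊔N≤n →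
           box⇒disk (ℚₚ.<⇒≤ (hM n (ℕₚ.≤-trans (ℕₚ.m≤m⊔n M N) M⊔N≤n)))
                    (ℚₚ.<⇒≤ (hN n (ℕₚ.≤-trans (ℕₚ.m≤n⊔m M N) M⊔N≤n))))

  opaque
    unfolding 𝟘 𝟏 ⊝_ _⊕_ _⊗_

    -- w = z - (z - w), and the gap between the radius and `r` absorbs the null sequence z - w.
    ≺-resp-≃ : ∀ z w {r} → z ≃ w → z ≺ r → w ≺ r
    ≺-resp-≃ z w {r} z≃w (bound r′ r′<r M hM) =
      let d@(bound δ δ<r-r′ N hN) = ≃⇒≺ z w z≃w (0<q-p r′<r)
      in bound (r′ ℚ.+ δ)
           (≡.subst (r′ ℚ.+ δ ℚ.<_) (solve 2 (λ r s → s :+ (r :- s) := r) ≡.refl r r′) (ℚₚ.+-monoʳ-< r′ δ<r-r′))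
           (M ℕ.⊔ N) (λ n M⊔N≤n → ≡.subst₂ (λ x y → Disk x y (r′ ℚ.+ δ))
             (cancel (seq (re z) n) (seq (re w) n)) (cancel (seq (im z) n) (seq (im w) n))
             (disk-+ (hM n (ℕₚ.≤-trans (ℕₚ.m≤m⊔n M N) M⊔N≤n))
               (disk-neg (hN n (ℕₚ.≤-trans (ℕₚ.m≤n⊔m M N) M⊔N≤n)))))
      where
      cancel : ∀ x y → x ℚ.+ ℚ.- (x ℚ.+ ℚ.- y) ≡ y
      cancel = solve 2 (λ x y → x :+ :- (x :+ :- y) := y) ≡.refl

  opaque
    unfolding 𝟘 𝟏 ⊝_ _⊕_ _⊗_

    ≺-0 : ∀ {r} → 0ℚ ℚ.< r → 𝟘 ≺ r
    ≺-0 0<r = bound 0ℚ 0<r 0 (λ _ _ → disk ℚₚ.≤-refl ℚₚ.≤-refl)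

  opaque
    unfolding 𝟘 𝟏 ⊝_ _⊕_ _⊗_

    ≺-1 : ∀ {r} → 1ℚ ℚ.< r → 𝟏 ≺ r
    ≺-1 1<r = bound 1ℚ 1<r 0 (λ _ _ → disk (ℚₚ.<⇒≤ 0<1) ℚₚ.≤-refl)

  ≺-bounded : ∀ z → ∃[ r ] z ≺ r
  ≺-bounded z =
    let B , _ , M , hM = RealCauchy.bounded (seq (re z)) (isCauchy (re z))
        C , _ , N , hN = RealCauchy.bounded (seq (im z)) (isCauchy (im z))
    in B ℚ.+ C ℚ.+ 1ℚ , bound (B ℚ.+ C) (<-gap 1ℚ 0<1 ≡.refl) (M ℕ.⊔ N) (λ n M⊔N≤n →
         box⇒disk (ℚₚ.<⇒≤ (hM n (ℕₚ.≤-trans (ℕₚ.m≤m⊔n M N) M⊔N≤n)))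
                  (ℚₚ.<⇒≤ (hN n (ℕₚ.≤-trans (ℕₚ.m≤n⊔m M N) M⊔N≤n))))

  ≺⇒∣re∣< : ∀ z {r} (h : z ≺ r) n → start h ℕ.≤ n → ℚ.∣ seq (re z) n ∣ ℚ.< r
  ≺⇒∣re∣< z h n N≤n = ℚₚ.≤-<-trans (disk⇒∣x∣≤ (eventually h n N≤n)) (radius< h)

  ≺⇒∣im∣< : ∀ z {r} (h : z ≺ r) n → start h ℕ.≤ n → ℚ.∣ seq (im z) n ∣ ℚ.< r
  ≺⇒∣im∣< z h n N≤n = ℚₚ.≤-<-trans (disk⇒∣y∣≤ (eventually h n N≤n)) (radius< h)

  opaque
    unfolding 𝟘 𝟏 ⊝_ _⊕_ _⊗_

    ≺-separated : ∀ z → (∀ ε → 0ℚ ℚ.< ε → z ≺ ε) → z ≃ 𝟘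
    ≺-separated z h =
        (λ ε 0<ε → start (h ε 0<ε) , λ n N≤n → ≡.subst (λ x → ℚ.∣ x ∣ ℚ.< ε)
          (≡.sym (ℚₚ.+-identityʳ (seq (re z) n))) (≺⇒∣re∣< z (h ε 0<ε) n N≤n))
      , (λ ε 0<ε → start (h ε 0<ε) , λ n N≤n → ≡.subst (λ x → ℚ.∣ x ∣ ℚ.< ε)
          (≡.sym (ℚₚ.+-identityʳ (seq (im z) n))) (≺⇒∣im∣< z (h ε 0<ε) n N≤n))

  opaque
    unfolding 𝟘 𝟏 ⊝_ _⊕_ _⊗_

    ≺-complete : ∀ (s : ℕ → ℂ) (β : ℕ → ℚ) →
                 (∀ ε → 0ℚ ℚ.< ε → ∃[ N ] ∀ n → N ℕ.≤ n → β n ℚ.< ε) →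
                 (∀ j n → s (j ℕ.+ n) ⊕ ⊝ s n ≺ β n) →
                 ∃[ L ] ∀ ε → 0ℚ ℚ.< ε → ∃[ N ] ∀ n → N ℕ.≤ n → s n ⊕ ⊝ L ≺ ε
    ≺-complete s β β-null s-cauchy = L , converges
      where
      open RealCompleteness
      re-cauchy : ∀ j n → ∃[ N ] ∀ i → N ℕ.≤ i → ℚ.∣ seq (re (s (j ℕ.+ n))) i ℚ.- seq (re (s n)) i ∣ ℚ.< β n
      re-cauchy j n = start (s-cauchy j n) , ≺⇒∣re∣< (s (j ℕ.+ n) ⊕ ⊝ s n) (s-cauchy j n)
      im-cauchy : ∀ j n → ∃[ N ] ∀ i → N ℕ.≤ i → ℚ.∣ seq (im (s (j ℕ.+ n))) i ℚ.- seq (im (s n)) i ∣ ℚ.< β n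
      im-cauchy j n = start (s-cauchy j n) , ≺⇒∣im∣< (s (j ℕ.+ n) ⊕ ⊝ s n) (s-cauchy j n)
      L : ℂ
      L = limit (λ n → re (s n)) β β-null re-cauchy +i limit (λ n → im (s n)) β β-null im-cauchy
      converges : ∀ ε → 0ℚ ℚ.< ε → ∃[ N ] ∀ n → N ℕ.≤ n → s n ⊕ ⊝ L ≺ ε
      converges ε 0<ε =
        let J , hJ = limit-converges (λ n → re (s n)) β β-null re-cauchy (eighth ε) (eighth-pos 0<ε)
            K , hK = limit-converges (λ n → im (s n)) β β-null im-cauchy (eighth ε) (eighth-pos 0<ε)
        in J ℕ.⊔ K , λ n J⊔K≤n →
          let M , hM = hJ n (ℕₚ.≤-trans (ℕₚ.m≤m⊔n J K) J⊔K≤n)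
              N , hN = hK n (ℕₚ.≤-trans (ℕₚ.m≤n⊔m J K) J⊔K≤n)
          in bound (eighth ε ℚ.+ eighth ε) (2*eighth< 0<ε) (M ℕ.⊔ N) (λ i M⊔N≤i →
               box⇒disk (ℚₚ.<⇒≤ (hM i (ℕₚ.≤-trans (ℕₚ.m≤m⊔n M N) M⊔N≤i)))
                        (ℚₚ.<⇒≤ (hN i (ℕₚ.≤-trans (ℕₚ.m≤n⊔m M N) M⊔N≤i))))

ℂ-completeNormedRing : CompleteNormedRing
ℂ-completeNormedRing = record
  { commutativeRing = ℂ-commutativeRing
  ; _≺_       = _≺_
  ; ≺-resp-≈  = λ {z} {w} → ≺-resp-≃ z w
  ; ≺-mono    = λ {z} → ≺-mono {z}
  ; ≺-pos     = λ {z} → ≺-pos {z}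
  ; ≺-0       = ≺-0
  ; ≺-1       = ≺-1
  ; ≺-neg     = λ {z} → ≺-neg {z}
  ; ≺-+       = λ {z} {w} → ≺-+ {z} {w}
  ; ≺-*       = λ {z} {w} → ≺-* {z} {w}
  ; bounded   = ≺-bounded
  ; separated = λ {z} → ≺-separated z
  ; complete  = ≺-complete
  }
  where open ComplexNorm

-- Accuracy of the approximate square root.

module RationalEstimates where
  open import Data.Rational.Base
  open ℚₚ
  open ≡
  open +-*-Solver
  open RationalPowers
  open RationalDisks
  open Rational using (*-nn; inv-pos; inv-bound; inv-inverseʳ; grid-nonneg; sqrtApprox-nonneg; sqrtApprox-lower; sqrtApprox-upper)

  sqrtApprox² : ∀ n {p} → 0ℚ ≤ p → sqrtApprox n p * sqrtApprox n p ≤ p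
  sqrtApprox² n {p} 0≤p with sqrtApprox-lower n p
  -- The default value 0 also has a square below p, because p is nonnegative.
  ... | inj₁ s≡0 = subst (λ s → s * s ≤ p) (sym s≡0) 0≤p
  ... | inj₂ s²≤p = s²≤p

  sqrtApprox-≤ : ∀ n {p r} → 0ℚ ≤ p → 0ℚ ≤ r → p ≤ r * r → sqrtApprox n p ≤ r
  sqrtApprox-≤ n 0≤p 0≤r p≤r² = square-cancel-≤ 0≤r (≤-trans (sqrtApprox² n 0≤p) p≤r²)

  sqrtApprox+grid-nonneg : ∀ n p → 0ℚ ≤ sqrtApprox n p + grid n 1
  sqrtApprox+grid-nonneg n p = +-mono-≤ (sqrtApprox-nonneg n p) (grid-nonneg n 1)

  sqrtApprox-> : ∀ n {p δ} → grid n 1 < δ * ½ → δ * δ ≤ p → δ * ½ < sqrtApprox n p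
  sqrtApprox-> n {p} {δ} g<δ/2 δ²≤p = ≰⇒> λ s≤δ/2 → <-irrefl refl
    (<-trans δ<s+g (subst (sqrtApprox n p + grid n 1 <_) (Rational.halves δ) (+-mono-≤-< s≤δ/2 g<δ/2)))
    where
    δ<s+g : δ < sqrtApprox n p + grid n 1
    δ<s+g = square-cancel-< (sqrtApprox+grid-nonneg n p) (≤-<-trans δ²≤p (sqrtApprox-upper n p))

  -- (1 + h)² - 1 = 2h + h², which is at most 3h.
  small-square : ∀ {ε h} → 0ℚ ≤ h → h < 1ℚ → h < ε * (+ 1 / 3) → (1ℚ + h) * (1ℚ + h) - 1ℚ < ε
  small-square {ε} {h} 0≤h h<1 h<ε/3 = ≤-<-trans
    (≤-gap (h * (1ℚ - h)) (*-nn 0≤h (<⇒≤ (0<q-p h<1)))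
      (solve 1 (λ h → (con 1ℚ :+ h) :* (con 1ℚ :+ h) :- con 1ℚ :+ h :* (con 1ℚ :- h) := h :* con (+ 3 / 1)) refl h))
    (subst (h * (+ 3 / 1) <_) (*-thirds ε) (*-monoˡ-<-pos (+ 3 / 1) h<ε/3))

  -- With s the approximation and g the mesh, s² ≤ p < (s + g)². Dividing by s² gives 1 ≤ p r² ≤ (1
  -- + h)², where h = g r is the relative error; the lower bound δ on s makes it small.
  sqrtApprox-relative : ∀ n {p δ ε} → 0ℚ < δ → δ < sqrtApprox n p → 0ℚ ≤ p →
    grid n 1 < 1ℚ * δ → grid n 1 < ε * (+ 1 / 3) * δ → 0ℚ < ε →
    let r = inv (sqrtApprox n p) in ∣ p * (r * r) - 1ℚ ∣ < ε
  sqrtApprox-relative n {p} {δ} {ε} 0<δ δ<s 0≤p g<δ g<εδ/3 0<ε = Rational.abs-<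
    (≤-<-trans (+-monoˡ-≤ (- 1ℚ) pr²≤) (small-square 0≤h (small g<δ) (small g<εδ/3)))
    (≤-<-trans (≤-gap (p * (r * r) - 1ℚ) (0≤q-p 1≤pr²)
      (solve 1 (λ x → :- (x :- con 1ℚ) :+ (x :- con 1ℚ) := con 0ℚ) refl (p * (r * r)))) 0<ε)
    where
    s r g h : ℚ
    s = sqrtApprox n p
    r = inv s
    g = grid n 1
    h = g * r
    0<s : 0ℚ < s
    0<s = <-trans 0<δ δ<s
    sr≡1 : s * r ≡ 1ℚ
    sr≡1 = inv-inverseʳ 0<s
    0≤r² : 0ℚ ≤ r * r
    0≤r² = square-nonneg r
    0≤h : 0ℚ ≤ h
    0≤h = *-nn (grid-nonneg n 1) (<⇒≤ (inv-pos 0<s))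
    hδ≤g : h * δ ≤ g
    hδ≤g = subst₂ _≤_ (solve 3 (λ g δ r → g :* (δ :* r) := g :* r :* δ) refl g δ r) (*-identityʳ g)
      (*-monoˡ-≤-nonNeg g {{nonNegative (grid-nonneg n 1)}} (inv-bound 0<δ δ<s))
    small : ∀ {c} → g < c * δ → h < c
    small g<cδ = *-cancelʳ-<-nonNeg δ {{nonNegative (<⇒≤ 0<δ)}} (≤-<-trans hδ≤g g<cδ)
    1≤pr² : 1ℚ ≤ p * (r * r)
    1≤pr² = subst (_≤ p * (r * r))
      (trans (solve 2 (λ s r → s :* s :* (r :* r) := (s :* r) :* (s :* r)) refl s r) (cong₂ _*_ sr≡1 sr≡1))
      (*-monoʳ-≤-nonNeg (r * r) {{nonNegative 0≤r²}} (sqrtApprox² n 0≤p))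
    pr²≤ : p * (r * r) ≤ (1ℚ + h) * (1ℚ + h)
    pr²≤ = subst (p * (r * r) ≤_)
      (trans (solve 3 (λ s g r → (s :+ g) :* (s :+ g) :* (r :* r) := (s :* r :+ g :* r) :* (s :* r :+ g :* r)) refl s g r)
        (cong (λ x → (x + h) * (x + h)) sr≡1))
      (*-monoʳ-≤-nonNeg (r * r) {{nonNegative 0≤r²}} (<⇒≤ (sqrtApprox-upper n p)))

-- The real-valued modulus, reciprocals and apartness.

module ComplexModulus where
  open +-*-Solver
  open RationalPowers
  open RationalDisks
  open RationalEstimates
  open ComplexNorm
  open Rational using (*-pos; half-pos; inv-pos; archimedean; sqrtApprox-upper)

  norm² : ℂ → ℕ → ℚ
  norm² z n = seq (re z) n ℚ.* seq (re z) n ℚ.+ seq (im z) n ℚ.* seq (im z) n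

  norm²-nonneg : ∀ z n → 0ℚ ℚ.≤ norm² z n
  norm²-nonneg z n = ℚₚ.+-mono-≤ (square-nonneg (seq (re z) n)) (square-nonneg (seq (im z) n))

  -- The last hypothesis is `0ᴿ <ᴿ x` unfolded with gap `r`, the form in which the tolerance of
  -- `_⟶_` arrives.
  ≺⇒∣∣<ᴿ : ∀ z {r} → z ≺ r → ∀ x N → (∀ n → N ℕ.≤ n → 0ℚ ℚ.+ r ℚ.< seq x n) → Defs.∣ z ∣ <ᴿ x
  ≺⇒∣∣<ᴿ z {r} h@(bound r′ r′<r M hM) x N hN = r ℚ.- r′ , 0<q-p r′<r , M ℕ.⊔ N , λ n M⊔N≤n →
    ℚₚ.≤-<-trans
      (ℚₚ.≤-trans
        (ℚₚ.+-monoˡ-≤ (r ℚ.- r′) (sqrtApprox-≤ n (norm²-nonneg z n) (≺-nonneg-radius h)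
          (norm≤ (hM n (ℕₚ.≤-trans (ℕₚ.m≤m⊔n M N) M⊔N≤n)))))
        (ℚₚ.≤-reflexive (solve 2 (λ r s → s :+ (r :- s) := con 0ℚ :+ r) ≡.refl r r′)))
      (hN n (ℕₚ.≤-trans (ℕₚ.m≤n⊔m M N) M⊔N≤n))

  -- Half of the gap ε pays for the error of the approximate square root, which gives the radius 1 -
  -- η with η = ε/2. Choosing ρ = 1 - η/2 leaves a strict gap on either side.
  ∣∣<1⇒≺ : ∀ z → Defs.∣ z ∣ <ᴿ 1ᴿ → ∃[ ρ ] ρ ℚ.< 1ℚ × z ≺ ρ
  ∣∣<1⇒≺ z (ε , 0<ε , N , hN) =
      1ℚ ℚ.- η ℚ.* ½
    , <-gap (η ℚ.* ½) (half-pos 0<η) (solve 1 (λ x → con 1ℚ :- x :+ x := con 1ℚ) ≡.refl (η ℚ.* ½))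
    , bound (1ℚ ℚ.- η)
        (<-gap (η ℚ.* ½) (half-pos 0<η)
          (solve 1 (λ x → con 1ℚ :- x :+ x :* con ½ := con 1ℚ :- x :* con ½) ≡.refl η))
        (M ℕ.⊔ N) (λ n M⊔N≤n →
          let s+g≤ = ℚₚ.≤-trans
                (ℚₚ.+-monoʳ-≤ (sqrtApprox n (norm² z n)) (ℚₚ.<⇒≤ (hM n (ℕₚ.≤-trans (ℕₚ.m≤m⊔n M N) M⊔N≤n))))
                (rearrange (sqrtApprox n (norm² z n)) (ℚₚ.<⇒≤ (hN n (ℕₚ.≤-trans (ℕₚ.m≤n⊔m M N) M⊔N≤n))))
              0≤s+g = sqrtApprox+grid-nonneg n (norm² z n)
              0≤r   = ℚₚ.≤-trans 0≤s+g s+g≤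
          in disk 0≤r (ℚₚ.≤-trans (ℚₚ.<⇒≤ (sqrtApprox-upper n (norm² z n)))
               (Rational.*-mono-≤ 0≤s+g 0≤r s+g≤ s+g≤)))
    where
    η : ℚ
    η = ε ℚ.* ½
    0<η : 0ℚ ℚ.< η
    0<η = half-pos 0<ε
    M : ℕ
    M = proj₁ (archimedean 0<η)
    hM : ∀ n → M ℕ.≤ n → grid n 1 ℚ.< η
    hM = proj₂ (archimedean 0<η)
    rearrange : ∀ s → s ℚ.+ ε ℚ.≤ 1ℚ → s ℚ.+ η ℚ.≤ 1ℚ ℚ.- η
    rearrange s h = ≡.subst (ℚ._≤ 1ℚ ℚ.- η)
      (solve 2 (λ s e → s :+ e :+ :- (e :* con ½) := s :+ e :* con ½) ≡.refl s ε)
      (ℚₚ.+-monoˡ-≤ (ℚ.- η) h)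

  reciprocal : (w : ℂ) → w ≢0 → ℂ
  reciprocal w w≢0 = (re w *ᴿ recip Defs.∣ w ∣ w≢0 *ᴿ recip Defs.∣ w ∣ w≢0)
                  +i (-ᴿ im w *ᴿ recip Defs.∣ w ∣ w≢0 *ᴿ recip Defs.∣ w ∣ w≢0)

  opaque
    unfolding 𝟏 _⊗_

    /-def : ∀ z w w≢0 → z / w [ w≢0 ] ≃ z ⊗ reciprocal w w≢0
    /-def z w w≢0 = RealRing.pointwise-≃ (z / w [ w≢0 ]) (z ⊗ reciprocal w w≢0) (λ _ → ≡.refl) (λ _ → ≡.refl)

    -- The imaginary part cancels exactly. The real part is `norm²` times the square of an
    -- approximate reciprocal modulus, hence only tends to 1.
    reciprocal-inverse : ∀ w w≢0 → w ⊗ reciprocal w w≢0 ≃ 𝟏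
    reciprocal-inverse w w≢0@(δ , 0<δ , N , hN) = re-close , im-close
      where
      s r x y : ℕ → ℚ
      s n = sqrtApprox n (norm² w n)
      r n = inv (s n)
      x = seq (re w)
      y = seq (im w)
      re-close : RealRing.Nullℚ (λ n → (x n ℚ.* (x n ℚ.* r n ℚ.* r n) ℚ.+ ℚ.- (y n ℚ.* (ℚ.- y n ℚ.* r n ℚ.* r n))) ℚ.- 1ℚ)
      re-close ε 0<ε =
        let J , hJ = archimedean (*-pos 0<1 0<δ)
            K , hK = archimedean (*-pos (*-pos 0<ε (ℚₚ.positive⁻¹ (+ 1 ℚ./ 3))) 0<δ)
        in J ℕ.⊔ K ℕ.⊔ N , λ n h →
          let J⊔K≤n = ℕₚ.≤-trans (ℕₚ.m≤m⊔n (J ℕ.⊔ K) N) h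
          in ≡.subst (λ p → ℚ.∣ p ℚ.- 1ℚ ∣ ℚ.< ε)
               (solve 3 (λ x y r → (x :* x :+ y :* y) :* (r :* r) := x :* (x :* r :* r) :+ :- (y :* (:- y :* r :* r)))
                 ≡.refl (x n) (y n) (r n))
               (sqrtApprox-relative n 0<δ
                 (≡.subst (ℚ._< s n) (ℚₚ.+-identityˡ δ) (hN n (ℕₚ.≤-trans (ℕₚ.m≤n⊔m (J ℕ.⊔ K) N) h)))
                 (norm²-nonneg w n)
                 (hJ n (ℕₚ.≤-trans (ℕₚ.m≤m⊔n J K) J⊔K≤n)) (hK n (ℕₚ.≤-trans (ℕₚ.m≤n⊔m J K) J⊔K≤n)) 0<ε)
      im-close : RealRing.Nullℚ (λ n → (x n ℚ.* (ℚ.- y n ℚ.* r n ℚ.* r n) ℚ.+ y n ℚ.* (x n ℚ.* r n ℚ.* r n)) ℚ.- 0ℚ)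
      im-close = RealRing.pointwise (λ n → x n ℚ.* (ℚ.- y n ℚ.* r n ℚ.* r n) ℚ.+ y n ℚ.* (x n ℚ.* r n ℚ.* r n)) (λ _ → 0ℚ)
        (λ n → solve 3 (λ x y r → x :* (:- y :* r :* r) :+ y :* (x :* r :* r) := con 0ℚ) ≡.refl (x n) (y n) (r n))

    -- If |v| < M and an approximation of z had modulus below δ = 1/(2M), that of z v would have
    -- modulus at most 1/2, although its real part is within 1/2 of 1. The comparison is between
    -- rationals, so arguing by contradiction is constructive.
    invertible⇒≢0 : ∀ z v → z ⊗ v ≃ 𝟏 → z ≢0
    invertible⇒≢0 z v (h , _) =
        δ ℚ.* ½ , half-pos 0<δ , J ℕ.⊔ K ℕ.⊔ start v≺M , λ n J⊔K⊔N≤n →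
        let J⊔K≤n = ℕₚ.≤-trans (ℕₚ.m≤m⊔n (J ℕ.⊔ K) (start v≺M)) J⊔K⊔N≤n
        in ≡.subst (ℚ._< sqrtApprox n (norm² z n)) (≡.sym (ℚₚ.+-identityˡ (δ ℚ.* ½)))
             (sqrtApprox-> n {norm² z n} {δ} (hJ n (ℕₚ.≤-trans (ℕₚ.m≤m⊔n J K) J⊔K≤n))
               (δ²≤norm² n (ℕₚ.≤-trans (ℕₚ.m≤n⊔m J K) J⊔K≤n)
                 (ℕₚ.≤-trans (ℕₚ.m≤n⊔m (J ℕ.⊔ K) (start v≺M)) J⊔K⊔N≤n)))
      where
      M : ℚ
      M = proj₁ (≺-bounded v)
      v≺M : v ≺ M
      v≺M = proj₂ (≺-bounded v)
      0<M : 0ℚ ℚ.< M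
      0<M = ≺-pos v≺M
      δ : ℚ
      δ = ½ ℚ.* inv M
      0<δ : 0ℚ ℚ.< δ
      0<δ = *-pos Rational.0<½ (inv-pos 0<M)
      J K : ℕ
      J = proj₁ (archimedean (half-pos 0<δ))
      K = proj₁ (h ½ Rational.0<½)
      hJ : ∀ n → J ℕ.≤ n → grid n 1 ℚ.< δ ℚ.* ½
      hJ = proj₂ (archimedean (half-pos 0<δ))
      hK : ∀ n → K ℕ.≤ n → ℚ.∣ seq (re (z ⊗ v)) n ℚ.- 1ℚ ∣ ℚ.< ½
      hK = proj₂ (h ½ Rational.0<½)
      ¬near-0-and-1 : ∀ x → ℚ.∣ x ∣ ℚ.≤ ½ → ¬ ℚ.∣ x ℚ.- 1ℚ ∣ ℚ.< ½
      ¬near-0-and-1 x h h′ = ℚₚ.<-irrefl ≡.refl (ℚₚ.≤-<-trans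
        (≡.subst (λ p → p ℚ.≤ ℚ.∣ x ∣ ℚ.+ ℚ.∣ x ℚ.- 1ℚ ∣)
          (≡.cong ℚ.∣_∣ (solve 1 (λ x → x :+ :- (x :- con 1ℚ) := con 1ℚ) ≡.refl x))
          (≡.subst (λ p → ℚ.∣ x ℚ.+ ℚ.- (x ℚ.- 1ℚ) ∣ ℚ.≤ ℚ.∣ x ∣ ℚ.+ p) (ℚₚ.∣-p∣≡∣p∣ (x ℚ.- 1ℚ))
            (ℚₚ.∣p+q∣≤∣p∣+∣q∣ x (ℚ.- (x ℚ.- 1ℚ)))))
        (ℚₚ.+-mono-≤-< h h′))
      δ²≤norm² : ∀ n → K ℕ.≤ n → start v≺M ℕ.≤ n → δ ℚ.* δ ℚ.≤ norm² z n
      δ²≤norm² n K≤n N≤n = ℚₚ.≮⇒≥ λ norm²<δ² → ¬near-0-and-1 (seq (re (z ⊗ v)) n)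
        (≡.subst (ℚ.∣ seq (re (z ⊗ v)) n ∣ ℚ.≤_) (*-cancel-inv ½ 0<M)
          (disk⇒∣x∣≤ (disk-* {seq (re z) n} {seq (im z) n} {r = δ} (disk (ℚₚ.<⇒≤ 0<δ) (ℚₚ.<⇒≤ norm²<δ²))
            (disk-mono (ℚₚ.<⇒≤ (radius< v≺M)) (eventually v≺M n N≤n)))))
        (hK n K≤n)

-- (n+1)(n+2) = n(n+1) + 2(n+1), and floor division splits over a sum whose second summand is a
-- multiple of 2.
triangular-suc : ∀ n → suc n ℕ.* (suc n ℕ.+ 1) ℕ./ 2 ≡ n ℕ.* (n ℕ.+ 1) ℕ./ 2 ℕ.+ suc n
triangular-suc n = ≡.trans
  (≡.cong (ℕ._/ 2) (solve 1 (λ n → (con 1 :+ n) :* (con 1 :+ n :+ con 1) := n :* (n :+ con 1) :+ (con 1 :+ n) :* con 2) ≡.refl n))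
  (≡.trans (ℕ.+-distrib-/-∣ʳ (n ℕ.* (n ℕ.+ 1)) (ℕ.n∣m*n (suc n)))
    (≡.cong (n ℕ.* (n ℕ.+ 1) ℕ./ 2 ℕ.+_) (ℕ.m*n/n≡m (suc n) 2)))
  where open ℕ-Solver

module _ {A : Set} {_≈_ : A → A → Set} where

  rawMonoid : (A → A → A) → A → RawMonoid 0ℓ 0ℓ
  rawMonoid _∙_ ε = record { _≈_ = _≈_ ; _∙_ = _∙_ ; ε = ε }

  -- Powers are iterated products of a raw monoid. This identifies the power built from the opaque
  -- multiplication with the one built from the original.
  ×-ext : ∀ {_∙₁_ _∙₂_ : A → A → A} {ε₁ ε₂} → (∀ x y → x ∙₁ y ≡ x ∙₂ y) → ε₁ ≡ ε₂ → ∀ n x →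
          RawMonoidDefinitions._×_ (rawMonoid _∙₁_ ε₁) n x ≡ RawMonoidDefinitions._×_ (rawMonoid _∙₂_ ε₂) n x
  ×-ext               ∙≗ ε≡ zero    x = ε≡
  ×-ext {_∙₂_ = _∙₂_} ∙≗ ε≡ (suc n) x = ≡.trans (∙≗ x _) (≡.cong (x ∙₂_) (×-ext ∙≗ ε≡ n x))

open Defs using (_+_; _*_; _-_; -_; _^_; ∣_∣)

-- From the opaque ring to the original operations on ℂ.

module Transfer where
  module R = CommutativeRing ℂ-commutativeRing
  open Algebra.Properties.Semiring.Exp R.semiring renaming (_^_ to _^ᴿ_)
  open Identities ℂ-commutativeRing
  open NormedRingProperties ℂ-completeNormedRing
  open ComplexNorm
  open ComplexModulus

  minus-def : ∀ x y → x ⊕ ⊝ y ≡ x - y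
  minus-def x y = ≡.trans (⊕-def x (⊝ y)) (≡.cong (λ z → x + z) {⊝ y} { - y} (⊝-def y))

  ^-def : ∀ x n → x ^ᴿ n ≡ x ^ n
  ^-def x n = ×-ext {ℂ} {_≃_} {_⊗_} {_*_} {𝟏} {1ℂ} ⊗-def 𝟏-def n x

  ∏-def : ∀ {f g} n → (∀ j → f j ≡ g j) → ∏ n f ≡ ∏< n g
  ∏-def zero    f≗g = 𝟏-def
  ∏-def {f} {g} (suc n) f≗g = ≡.trans (⊗-def (∏ n f) (f n))
    (≡.cong₂ _*_ {∏ n f} {∏< n g} {f n} {g n} (∏-def n f≗g) (f≗g n))

  -- Unlike for products, the summands are compared by `_≃_`, because `/-def` relates a quotient to
  -- a ring product only up to that equality.
  ∑-def : ∀ {f g} n → (∀ j → f j ≃ g j) → ∑ n f ≃ ∑< n g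
  ∑-def         zero    f≃g = R.reflexive 𝟘-def
  ∑-def {f} {g} (suc n) f≃g = ≡.subst (∑ (suc n) f ≃_) (⊕-def (∑< n g) (g n))
    (ComplexRing.⊕-cong {∑ n f} {∑< n g} {f n} {g n} (∑-def n f≃g) (f≃g n))

  -- A positive real tolerance eventually exceeds a positive rational, and rational accuracy is what
  -- `_⇝_` provides.
  ⇝⇒⟶ : ∀ s t L → (∀ n → s n ≃ t n) → s ⇝ L → t ⟶ L
  ⇝⇒⟶ s t L s≃t s⇝L ε (e , 0<e , N , hN) =
    let K , hK = ⇝-resp-≈ {s} {t} {L} s≃t s⇝L e 0<e
    in K , λ n K≤n → ≺⇒∣∣<ᴿ (t n - L) (≡.subst (_≺ e) (minus-def (t n) L) (hK n K≤n)) ε N hN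

  ∏-factors-def : ∀ (f g : ℕ → ℂ) → (∀ n → f n ≡ g n) → ∀ x n →
                  ∏ n (λ j → 𝟏 ⊕ ⊝ (x ⊗ f j)) ≡ ∏< n (λ j → 1ℂ - x * g j)
  ∏-factors-def f g f≗g x n = ∏-def n (λ j → ≡.trans (minus-def 𝟏 (x ⊗ f j))
    (≡.cong₂ _-_ {𝟏} {1ℂ} {x ⊗ f j} {x * g j} 𝟏-def
      (≡.trans (⊗-def x (f j)) (≡.cong (x *_) {f j} {g j} (f≗g j)))))

  factor-invertible : ∀ b {x y} → x ≡ y → 1ℂ + b * y ≢0 → ∃[ v ] (𝟏 ⊕ b ⊗ x) ⊗ v ≃ 𝟏
  factor-invertible b {x} ≡.refl 1+bx≢0 = v , ≡.subst (λ w → w ⊗ v ≃ 𝟏) {1ℂ + b * x} {𝟏 ⊕ b ⊗ x}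
    (≡.sym (≡.trans (⊕-def 𝟏 (b ⊗ x)) (≡.cong₂ _+_ {𝟏} {1ℂ} {b ⊗ x} {b * x} 𝟏-def (⊗-def b x))))
    (reciprocal-inverse (1ℂ + b * x) 1+bx≢0)
    where
    v : ℂ
    v = reciprocal (1ℂ + b * x) 1+bx≢0

  quotient-def : ∀ x x′ y y′ w w≢0 → x ≡ x′ → y ≡ y′ → x ⊗ y ⊗ reciprocal w w≢0 ≃ (x′ * y′) / w [ w≢0 ]
  quotient-def x .x y .y w w≢0 ≡.refl ≡.refl = ≡.subst (λ z → z ⊗ reciprocal w w≢0 ≃ (x * y) / w [ w≢0 ])
    {x * y} {x ⊗ y} (≡.sym (⊗-def x y)) (R.sym {(x * y) / w [ w≢0 ]} {(x * y) ⊗ reciprocal w w≢0} (/-def (x * y) w w≢0))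

  module _ (q : ℂ) where
    open QSeries q

    pochhammer-def : ∀ x n → pochhammer x n ≡ poch x q n
    pochhammer-def x n = ∏-factors-def (q ^ᴿ_) (q ^_) (^-def q) x n

    P-def : ∀ b n → P b n ≡ poch (- (b * q)) q n
    P-def b n = ≡.trans (pochhammer-def (⊝ (b ⊗ q)) n)
      (≡.cong (λ x → poch x q n) {⊝ (b ⊗ q)} { - (b * q)}
        (≡.trans (⊝-def (b ⊗ q)) (≡.cong -_ {b ⊗ q} {b * q} (⊗-def b q))))

    denominator-def : ∀ b n → pochhammer q n ⊗ P b n ≡ denominator b q n
    denominator-def b n = ≡.trans (⊗-def (pochhammer q n) (P b n))
      (≡.cong₂ _*_ {pochhammer q n} {poch q q n} {P b n} {poch (- (b * q)) q n} (pochhammer-def q n) (P-def b n))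

    module _ {ρ} (q≺ρ : q ≺ ρ) (ρ<1 : ρ ℚ.< 1ℚ) where
      open Convergence ℂ-completeNormedRing
      open QSeriesLimits q≺ρ ρ<1

      -- Apartness is carried from the factors to the product through invertibility: the inverses
      -- are multiplied, and `invertible⇒≢0` leads back.
      denominator≢0 : ∀ b → (∀ N → 1 ≤ℕ N → 1ℂ + b * q ^ N ≢0) → ∀ n → denominator b q n ≢0
      denominator≢0 b b≢ n =
        let v , inverse = denominator-invertible b
              (λ k → factor-invertible b (^-def q (suc k)) (b≢ (suc k) (ℕ.s≤s ℕ.z≤n))) n
        in ≡.subst _≢0 (denominator-def b n) (invertible⇒≢0 (pochhammer q n ⊗ P b n) v inverse)

      term-def : ∀ a b d≢0 n →
                 numerator _ ≡.refl triangular-suc a n ⊗ reciprocal (denominator b q n) (d≢0 n) ≃ term a b q d≢0 n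
      term-def a b d≢0 n = quotient-def (a ^ᴿ n) (a ^ n) (q ^ᴿ e) (q ^ e) (denominator b q n) (d≢0 n)
        (^-def a n) (^-def q e)
        where
        e : ℕ
        e = n ℕ.* (n ℕ.+ 1) ℕ./ 2

theorem4 : (a b q : ℂ) →
    ∣ q ∣ <ᴿ 1ᴿ →
    (∀ (N : ℕ) → 1 ≤ℕ N → 1ℂ + a * q ^ N ≢0) →
    (∀ (N : ℕ) → 1 ≤ℕ N → 1ℂ + b * q ^ N ≢0) →
    Σ[ dᵇ≢0 ∈ (∀ n → denominator b q n ≢0) ]
    Σ[ dᵃ≢0 ∈ (∀ n → denominator a q n ≢0) ]
    ∃[ Pᵇ ] ∃[ Sᵃ ] ∃[ Pᵃ ] ∃[ Sᵇ ]
    (poch∞ (- (b * q)) , q ≔ Pᵇ) ×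
    (∑∞ term a b q dᵇ≢0 ≔ Sᵃ) ×
    (poch∞ (- (a * q)) , q ≔ Pᵃ) ×
    (∑∞ term b a q dᵃ≢0 ≔ Sᵇ) ×
    (Pᵇ * Sᵃ ≃ Pᵃ * Sᵇ)
theorem4 a b q ∣q∣<1 a≢ b≢ =
    dᵇ≢0 , dᵃ≢0 , proj₁ pᵇ , proj₁ sᵃ , proj₁ pᵃ , proj₁ sᵇ
  , product b pᵇ , series a b dᵇ≢0 sᵃ , product a pᵃ , series b a dᵃ≢0 sᵇ
  , ≡.subst₂ _≃_ (⊗-def _ _) (⊗-def _ _)
      (P*S-sym e ≡.refl triangular-suc {a} {b} (v b dᵇ≢0) (v a dᵃ≢0) (v-inverse b dᵇ≢0) (v-inverse a dᵃ≢0)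
        (proj₂ pᵇ) (proj₂ sᵃ) (proj₂ pᵃ) (proj₂ sᵇ))
  where
  open Transfer
  open ComplexNorm using (_≺_)
  open ComplexModulus
  open Identities ℂ-commutativeRing using (module QSeries; ∑)
  open NormedRingProperties ℂ-completeNormedRing using (_⇝_)
  open Convergence ℂ-completeNormedRing using (module QSeriesLimits)
  contraction : ∃[ ρ ] ρ ℚ.< 1ℚ × q ≺ ρ
  contraction = ∣∣<1⇒≺ q ∣q∣<1
  ρ<1 : proj₁ contraction ℚ.< 1ℚ
  ρ<1 = proj₁ (proj₂ contraction)
  q≺ρ : q ≺ proj₁ contraction
  q≺ρ = proj₂ (proj₂ contraction)
  open QSeries q
  open QSeriesLimits q≺ρ ρ<1
  e : ℕ → ℕ
  e n = n ℕ.* (n ℕ.+ 1) ℕ./ 2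
  c : ℂ → ℕ → ℂ
  c = numerator e ≡.refl triangular-suc
  dᵇ≢0 : ∀ n → denominator b q n ≢0
  dᵇ≢0 = denominator≢0 q q≺ρ ρ<1 b b≢
  dᵃ≢0 : ∀ n → denominator a q n ≢0
  dᵃ≢0 = denominator≢0 q q≺ρ ρ<1 a a≢
  -- The reciprocals inside `term` themselves serve as the abstract inverses in the ring-level
  -- symmetry.
  v : ∀ x → (∀ n → denominator x q n ≢0) → ℕ → ℂ
  v x d≢0 n = reciprocal (denominator x q n) (d≢0 n)
  v-inverse : ∀ x d≢0 n → pochhammer q n ⊗ P x n ⊗ v x d≢0 n ≃ 𝟏
  v-inverse x d≢0 n = ≡.subst (λ d → d ⊗ v x d≢0 n ≃ 𝟏) (≡.sym (denominator-def q x n))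
    (reciprocal-inverse (denominator x q n) (d≢0 n))
  pᵇ : ∃[ L ] P b ⇝ L
  pᵇ = product-converges e ≡.refl triangular-suc b
  pᵃ : ∃[ L ] P a ⇝ L
  pᵃ = product-converges e ≡.refl triangular-suc a
  sᵃ : ∃[ L ] (λ N → ∑ N (λ n → c a n ⊗ v b dᵇ≢0 n)) ⇝ L
  sᵃ = sum-converges e ≡.refl triangular-suc a b (v b dᵇ≢0) (v-inverse b dᵇ≢0)
  sᵇ : ∃[ L ] (λ N → ∑ N (λ n → c b n ⊗ v a dᵃ≢0 n)) ⇝ L
  sᵇ = sum-converges e ≡.refl triangular-suc b a (v a dᵃ≢0) (v-inverse a dᵃ≢0)
  product : ∀ x (p : ∃[ L ] P x ⇝ L) → poch∞ (- (x * q)) , q ≔ proj₁ p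
  product x (L , P⇝L) = ⇝⇒⟶ (P x) (poch (- (x * q)) q) L (λ n → R.reflexive (P-def q x n)) P⇝L
  series : ∀ x y d≢0 (s : ∃[ L ] (λ N → ∑ N (λ n → c x n ⊗ v y d≢0 n)) ⇝ L) → ∑∞ term x y q d≢0 ≔ proj₁ s
  series x y d≢0 (L , ∑⇝L) = ⇝⇒⟶ _ (λ N → ∑< N (term x y q d≢0)) L
    (λ N → ∑-def N (term-def q q≺ρ ρ<1 x y d≢0)) ∑⇝L
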